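{- Let $\Pi$ be an LCL problem and let $\mathbb{G}$ be a class of $\Pi$-colorable finite graphs such that $\mathsf{Rand}_{\Pi,\mathbb{G}}(n)=o(\log n)$. Let $G$ be a Borel graph of finite maximum degree all of whose finite induced subgraphs are in $\mathbb{G}$. If $\mathrm{asi}(G)<\infty$, then $G$ has a Borel $\Pi$-coloring.
   Context: All graphs are undirected and simple; $\mathbb{N}=\{0,1,2,\dots\}$, $\mathbb{N}^+=\mathbb{N}\setminus\{0\}$, and $n\in\mathbb{N}$ is identified with $\{0,\dots,n-1\}$. $B_G(v,R)$ is the set of vertices reachable from $v$ by a path of at most $R$ edges; $G[U]$ is the subgraph induced by $U$. LCL problems. A labeled graph is a pair $(G,f)$ with $f\colon V(G)\to\mathbb{N}$ (a labeling); a rooted labeled graph is a triple $(G,f,v)$ with also $v\in V(G)$; isomorphisms of these are graph isomorphisms preserving the labeling and the root. $[G,f,v]_R$ denotes the isomorphism type of the rooted labeled graph $(G[B_G(v,R)],\,f|_{B_G(v,R)},\,v)$. A locally checkable labeling (LCL) problem is a pair $\Pi=(R,\mathcal{P})$ with $R\in\mathbb{N}$ and $\mathcal{P}$ a map from isomorphism classes of finite rooted labeled graphs to $\{0,1\}$. For a locally finite graph $G$, $f\colon V(G)\to\mathbb{N}$ is a $\Pi$-coloring of $G$ if $\mathcal{P}([G,f,v]_R)=1$ for all $v\in V(G)$; $G$ is $\Pi$-colorable if it has a $\Pi$-coloring. Randomized LOCAL complexity. A LOCAL algorithm is a map $\mathcal{A}$ from isomorphism classes of finite rooted labeled graphs to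 $\mathbb{N}$. For a locally finite labeled graph $(G,f)$ and $T\in\mathbb{N}$, define $\mathcal{A}_T(G,f)\colon V(G)\to\mathbb{N}$ by $(\mathcal{A}_T(G,f))(v)=\mathcal{A}([G,f,v]_T)$. For an LCL problem $\Pi$, a class $\mathbb{G}$ of finite graphs, and $n\in\mathbb{N}^+$, $\mathsf{Rand}_{\Pi,\mathbb{G}}(n)$ is the smallest $T\in\mathbb{N}$ for which there exist $\ell\in\mathbb{N}^+$ and a LOCAL algorithm $\mathcal{A}$ such that for every $n$-vertex graph $G\in\mathbb{G}$, if $\theta\colon V(G)\to\ell$ is chosen uniformly at random, then $\mathbb{P}[\mathcal{A}_T(G,\theta)\text{ is a }\Pi\text{ -coloring of }G]\geq 1-1/n$ (and $\infty$ if no such $T$ exists). Borel notions. A Borel graph is a graph $G$ whose vertex set is a standard Borel space and whose adjacency relation is Borel in $V(G)^2$. A $\Pi$-coloring $f\colon V(G)\to\mathbb{N}$ is Borel if each $f^{ -1}(i)$ is Borel. A graph is component-finite if all its connected components are finite. $\mathrm{si}(G)$ is the smallest $s\in\mathbb{N}$ for which there is a partition $V(G)=U_0\sqcup\dots\sqcup U_s$ into $s+1$ Borel sets such that every $G[U_i]$ is component-finite ($\infty$ if no such $s$ exists). $G^R$ is the graph on $V(G)$ in which two distinct vertices are adjacent iff they are joined by a path of at most $R$ edges in $G$. $\mathrm{asi}(G)=\sup_{R\in\mathbb{N}}\mathrm{si}(G^R)$. -}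

module Defs where

open import Axiom.ExcludedMiddle using (ExcludedMiddle)
open import Data.Bool.Base using (Bool; true)
open import Data.Fin.Base using (Fin; toℕ)
open import Data.Integer.Base using (+_)
open import Data.Irrelevant using () renaming ([_] to irr)
open import Data.Maybe.Base using (Maybe; just)
open import Data.Nat.Base as ℕ using (ℕ; suc; NonZero)
open import Data.Nat.Logarithm using (⌊log₂_⌋)
open import Data.Product using (Σ; Σ-syntax; ∃; ∃!; _×_; _,_)
open import Data.Rational.Base as ℚ using (ℚ; 0ℚ; 1ℚ; _/_)
open import Data.Refinement using (Refinement; Refinement-syntax; _,_; value)
open import Data.Vec.Base using (Vec; lookup)
open import Function.Base using (_∘_)
open import Function.Bundles using (_↔_; _⇔_; Inverse)
open import Level using (Level; Setω; 0ℓ; _⊔_) renaming (suc to lsuc)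
open import Relation.Binary.Construct.Add.Supremum.NonStrict ℕ._≤_ using (_≤⁺_)
open import Relation.Binary.Construct.Closure.ReflexiveTransitive using (Star)
open import Relation.Binary.PropositionalEquality using (_≡_; _≢_; sym)
open import Relation.Nullary.Construct.Add.Supremum using (_⁺; [_]; ⊤⁺)
open import Relation.Nullary.Negation using (¬_)
open import Relation.Unary using (Pred; _∈_; ∅; ∁; ⋃; _≐_; _⟨×⟩_)

private
  variable
    a p ℓ₁ ℓ₂ : Level
    V W X Y : Set
    m n : ℕ

-- The ambient logic of the theorem is classical.  As it ranges over all
-- types (not only propositions), this also yields the axiom of choice, by
-- turning ¬ ¬ A into an element of A.
Classical : Setω
Classical = ∀ {ℓ} → ExcludedMiddle ℓ

------------------------------------------------------------------------
-- Finite sets, extended naturals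

HasSize : Set a → ℕ → Set a
HasSize A n = A ↔ Fin n

Finite : Set a → Set a
Finite A = ∃ (HasSize A)

-- ℕ ⁺ is ℕ ∪ {∞}, with ∞ written ⊤⁺.

-- "The smallest k with P k is e", where e = ∞ if there is no such k.
Smallest_Is_ : Pred ℕ p → ℕ ⁺ → Set p
Smallest P Is [ k ] = P k × (∀ j → P j → k ℕ.≤ j)
Smallest P Is ⊤⁺    = ∀ j → ¬ P j

Supremum_Is_ : (ℕ → ℕ ⁺) → ℕ ⁺ → Set
Supremum σ Is e = (∀ i → σ i ≤⁺ e) × (∀ b → (∀ i → σ i ≤⁺ b) → e ≤⁺ b)

-- Since T is an integer, k · T ≤ log₂ n iff k · T ≤ ⌊log₂ n⌋; thus this
-- is ρ n ≤ ε · log₂ n, eventually, for each ε = 1/k.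
IsLittleOLog : (ℕ → ℕ ⁺) → Set
IsLittleOLog ρ = ∀ k → Σ[ N ∈ ℕ ] ∀ n → N ℕ.≤ n →
  Σ[ T ∈ ℕ ] ρ n ≡ [ T ] × k ℕ.* T ℕ.≤ ⌊log₂ n ⌋

-- ℙ[ E ] = q for the uniform distribution on the finite nonempty set Ω.
Uniformℙ_Is_ : {Ω : Set a} → Pred Ω p → ℚ → Set (a ⊔ p)
Uniformℙ_Is_ {Ω = Ω} E q =
  Σ[ N ∈ ℕ ] Σ[ k ∈ ℕ ]
    HasSize Ω (suc N) × HasSize [ ω ∈ Ω ∣ E ω ] k × q ≡ + k / suc N

------------------------------------------------------------------------
-- Graphs

record Graph (V : Set) : Set₁ where
  field
    Adj    : V → V → Set
    symm   : ∀ {u v} → Adj u v → Adj v u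
    irrefl : ∀ {v} → ¬ Adj v v

open Graph public

-- Refinement types carry an irrelevant membership proof, so the vertices of
-- the induced subgraph are exactly the elements of U.
induced : Graph V → (U : Pred V 0ℓ) → Graph [ v ∈ V ∣ U v ]
induced G U = record
  { Adj    = λ u v → Adj G (value u) (value v)
  ; symm   = symm G
  ; irrefl = irrefl G
  }

PreservesAdj : Graph V → Graph W → V ↔ W → Set
PreservesAdj G H φ = ∀ u v → Adj G u v ⇔ Adj H (to u) (to v)
  where open Inverse φ

_≅_ : Graph V → Graph W → Set
G ≅ H = Σ[ φ ∈ _ ↔ _ ] PreservesAdj G H φ

-- Reach G R u v: there is a walk, equivalently a path, of at most R edges
-- from u to v.
data Reach (G : Graph V) : ℕ → V → V → Set where
  here : ∀ {R v} → Reach G R v v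
  step : ∀ {R u v w} → Adj G u v → Reach G R v w → Reach G (suc R) u w

reach-snoc : ∀ {G : Graph V} {R u v w} →
             Reach G R u v → Adj G v w → Reach G (suc R) u w
reach-snoc here       e = step e here
reach-snoc (step d r) e = step d (reach-snoc r e)

reach-sym : ∀ {G : Graph V} {R u v} → Reach G R u v → Reach G R v u
reach-sym         here       = here
reach-sym {G = G} (step d r) = reach-snoc (reach-sym r) (symm G d)

Ball : Graph V → V → ℕ → Pred V 0ℓ
Ball G v R u = Reach G R v u

power : Graph V → ℕ → Graph V
power G R = record
  { Adj    = λ u v → u ≢ v × Reach G R u v
  ; symm   = λ (u≢v , r) → (λ v≡u → u≢v (sym v≡u)) , reach-sym r
  ; irrefl = λ (v≢v , _) → v≢v _≡_.refl
  }

FiniteMaxDegree : Graph V → Set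
FiniteMaxDegree {V} G =
  Σ[ Δ ∈ ℕ ] ∀ v → Σ[ d ∈ ℕ ] HasSize [ u ∈ V ∣ Adj G v u ] d × d ℕ.≤ Δ

ComponentFinite : Graph V → Set
ComponentFinite {V} G = ∀ v → Finite [ u ∈ V ∣ Star (Adj G) v u ]

-- A class of finite graphs.  Finite graphs are represented, up to
-- isomorphism, on the vertex sets Fin n.
record GraphClass : Set₂ where
  field
    Member    : Graph (Fin n) → Set₁
    invariant : {G : Graph (Fin m)} {H : Graph (Fin n)} →
                G ≅ H → Member G → Member H

open GraphClass public using (Member)

------------------------------------------------------------------------
-- Rooted labeled graphs and LCL problems

record RootedLabeledGraph (V : Set) : Set₁ where
  field
    graph : Graph V
    label : V → ℕ
    root  : V

open RootedLabeledGraph public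

_≅ʳ_ : RootedLabeledGraph V → RootedLabeledGraph W → Set
_≅ʳ_ {V} {W} K L = Σ[ φ ∈ V ↔ W ]
    PreservesAdj (graph K) (graph L) φ
  × (∀ v → label L (Inverse.to φ v) ≡ label K v)
  × Inverse.to φ (root K) ≡ root L

-- A representative of the isomorphism type [G, f, v]_R.
⟦_,_,_⟧ : (G : Graph V) → (V → ℕ) → (v : V) → (R : ℕ) →
          RootedLabeledGraph [ u ∈ V ∣ Ball G v R u ]
⟦ G , f , v ⟧ R = record
  { graph = induced G (Ball G v R)
  ; label = λ u → f (value u)
  ; root  = v , irr here
  }

-- A map from isomorphism classes of finite rooted labeled graphs to A.
record LocalMap (A : Set) : Set₁ where
  field
    eval      : RootedLabeledGraph (Fin n) → A
    invariant : {K : RootedLabeledGraph (Fin m)}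
                {L : RootedLabeledGraph (Fin n)} →
                K ≅ʳ L → eval K ≡ eval L

open LocalMap public using (eval)

-- The value of F at the isomorphism class of the finite graph K is b.
_at_Is_ : {A : Set} → LocalMap A → RootedLabeledGraph V → A → Set₁
F at K Is b = Σ[ n ∈ ℕ ] Σ[ L ∈ RootedLabeledGraph (Fin n) ]
  L ≅ʳ K × eval F L ≡ b

record LCL : Set₁ where
  field
    radius : ℕ
    accept : LocalMap Bool

open LCL public

IsColoring : LCL → Graph V → (V → ℕ) → Set₁
IsColoring Π G f = ∀ v → accept Π at ⟦ G , f , v ⟧ (radius Π) Is true

Colorable : LCL → Graph V → Set₁
Colorable {V} Π G = Σ[ f ∈ (V → ℕ) ] IsColoring Π G f

------------------------------------------------------------------------
-- Randomized LOCAL complexity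

LocalAlgorithm : Set₁
LocalAlgorithm = LocalMap ℕ

-- 𝒜_T(G, f) = g
Run : LocalAlgorithm → ℕ → (G : Graph V) → (f g : V → ℕ) → Set₁
Run 𝒜 T G f g = ∀ v → 𝒜 at ⟦ G , f , v ⟧ T Is g v

Succeeds : LCL → LocalAlgorithm → ℕ → Graph V → (V → ℕ) → Set₁
Succeeds {V} Π 𝒜 T G f = Σ[ g ∈ (V → ℕ) ] Run 𝒜 T G f g × IsColoring Π G g

-- T rounds suffice on the n-vertex graphs of the class.  A labeling
-- θ : V(G) → ℓ is a vector, as V(G) = Fin n.
RandSolvable : LCL → GraphClass → (n : ℕ) .{{_ : NonZero n}} → Pred ℕ (lsuc 0ℓ)
RandSolvable Π 𝔾 n T =
  Σ[ ℓ ∈ ℕ ] NonZero ℓ × Σ[ 𝒜 ∈ LocalAlgorithm ]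
    ∀ (G : Graph (Fin n)) → Member 𝔾 G →
      Σ[ q ∈ ℚ ]
          (Uniformℙ (λ (θ : Vec (Fin ℓ) n) →
             Succeeds Π 𝒜 T G (toℕ ∘ lookup θ)) Is q)
        × 1ℚ ℚ.- (+ 1 / n) ℚ.≤ q

-- The value of ρ at 0 is irrelevant.
RandIs : LCL → GraphClass → (ℕ → ℕ ⁺) → Set₁
RandIs Π 𝔾 ρ =
  ∀ n .{{_ : NonZero n}} → Smallest (RandSolvable Π 𝔾 n) Is (ρ n)

RandIsLittleOLog : LCL → GraphClass → Set₁
RandIsLittleOLog Π 𝔾 = Σ[ ρ ∈ (ℕ → ℕ ⁺) ] RandIs Π 𝔾 ρ × IsLittleOLog ρ

------------------------------------------------------------------------
-- Standard Borel spaces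

-- The σ-algebra generated by 𝓖.
data σ⟨_⟩ {X : Set} (𝓖 : Pred (Pred X 0ℓ) ℓ₁) : Pred (Pred X 0ℓ) (lsuc 0ℓ ⊔ ℓ₁) where
  basic : ∀ {A} → A ∈ 𝓖 → A ∈ σ⟨ 𝓖 ⟩
  empty : ∅ ∈ σ⟨ 𝓖 ⟩
  compl : ∀ {A} → A ∈ σ⟨ 𝓖 ⟩ → ∁ A ∈ σ⟨ 𝓖 ⟩
  union : ∀ {A : ℕ → Pred X 0ℓ} → (∀ n → A n ∈ σ⟨ 𝓖 ⟩) → ⋃ ℕ A ∈ σ⟨ 𝓖 ⟩
  resp  : ∀ {A B} → A ≐ B → A ∈ σ⟨ 𝓖 ⟩ → B ∈ σ⟨ 𝓖 ⟩

Rectangle : Pred (Pred X 0ℓ) ℓ₁ → Pred (Pred Y 0ℓ) ℓ₂ →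
            Pred (Pred (X × Y) 0ℓ) (lsuc 0ℓ ⊔ ℓ₁ ⊔ ℓ₂)
Rectangle {X} {Y = Y} 𝓐 𝓑 C =
  Σ[ A ∈ Pred X 0ℓ ] Σ[ B ∈ Pred Y 0ℓ ] 𝓐 A × 𝓑 B × C ≐ (A ⟨×⟩ B)

-- A nonnegative real r, given by its Dedekind cut { q ∈ ℚ ∣ r < q }.
record ℝ≥0 : Set₁ where
  field
    below       : ℚ → Set
    inhabited   : ∃ below
    upward      : ∀ {q r} → below q → q ℚ.≤ r → below r
    rounded     : ∀ {q} → below q → Σ[ r ∈ ℚ ] r ℚ.< q × below r
    nonnegative : ∀ {q} → below q → 0ℚ ℚ.< q

infix 4 _<ᴿ_
_<ᴿ_ : ℝ≥0 → ℚ → Set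
r <ᴿ q = ℝ≥0.below r q

record Metric (X : Set) : Set₁ where
  field
    d         : X → X → ℝ≥0
    reflexive : ∀ x {ε} → 0ℚ ℚ.< ε → d x x <ᴿ ε
    separated : ∀ {x y} → (∀ {ε} → 0ℚ ℚ.< ε → d x y <ᴿ ε) → x ≡ y
    symmetric : ∀ {x y q} → d x y <ᴿ q → d y x <ᴿ q
    triangle  : ∀ {x y z q r} → d x y <ᴿ q → d y z <ᴿ r → d x z <ᴿ q ℚ.+ r

module _ {X : Set} (μ : Metric X) where
  open Metric μ

  Open : Pred (Pred X 0ℓ) 0ℓ
  Open U = ∀ x → U x → Σ[ ε ∈ ℚ ] 0ℚ ℚ.< ε × (∀ y → d x y <ᴿ ε → U y)

  Cauchy : (ℕ → X) → Set
  Cauchy s = ∀ ε → 0ℚ ℚ.< ε →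
    Σ[ N ∈ ℕ ] ∀ i j → N ℕ.≤ i → N ℕ.≤ j → d (s i) (s j) <ᴿ ε

  ConvergesTo : (ℕ → X) → X → Set
  ConvergesTo s x = ∀ ε → 0ℚ ℚ.< ε →
    Σ[ N ∈ ℕ ] ∀ i → N ℕ.≤ i → d (s i) x <ᴿ ε

  Complete : Set
  Complete = ∀ s → Cauchy s → ∃ (ConvergesTo s)

  -- Maybe allows for the empty space.
  Separable : Set
  Separable = Σ[ s ∈ (ℕ → Maybe X) ] ∀ x ε → 0ℚ ℚ.< ε →
    Σ[ n ∈ ℕ ] Σ[ y ∈ X ] s n ≡ just y × d x y <ᴿ ε

record StandardBorelSpace : Set₂ where
  field
    Carrier  : Set
    IsBorel  : Pred (Pred Carrier 0ℓ) (lsuc 0ℓ)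
    isPolish : Σ[ μ ∈ Metric Carrier ] Complete μ × Separable μ ×
               (∀ A → IsBorel A ⇔ A ∈ σ⟨ Open μ ⟩)

open StandardBorelSpace public using (Carrier; IsBorel)

record BorelGraph : Set₂ where
  field
    space    : StandardBorelSpace
    graph    : Graph (Carrier space)
    adjBorel : (λ (u , v) → Adj graph u v) ∈
               σ⟨ Rectangle (IsBorel space) (IsBorel space) ⟩

module _ (S : StandardBorelSpace) where

  -- V(G) splits into s + 1 Borel sets inducing component-finite subgraphs.
  Separates : Graph (Carrier S) → Pred ℕ (lsuc 0ℓ)
  Separates G s = Σ[ U ∈ (Fin (suc s) → Pred (Carrier S) 0ℓ) ]
      (∀ v → ∃! _≡_ (λ i → U i v))
    × (∀ i → IsBorel S (U i))
    × (∀ i → ComponentFinite (induced G (U i)))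

  SiIs : Graph (Carrier S) → ℕ ⁺ → Set₁
  SiIs G e = Smallest Separates G Is e

  AsiIs : Graph (Carrier S) → ℕ ⁺ → Set₁
  AsiIs G e = Σ[ σ ∈ (ℕ → ℕ ⁺) ]
    (∀ R → SiIs (power G R) (σ R)) × (Supremum σ Is e)

  AsiFinite : Graph (Carrier S) → Set₁
  AsiFinite G = Σ[ s ∈ ℕ ] AsiIs G [ s ]

  BorelFunction : Pred (Carrier S → ℕ) (lsuc 0ℓ)
  BorelFunction f = ∀ i → IsBorel S (λ v → f v ≡ i)

FiniteInducedSubgraphsIn : GraphClass → Graph V → Set₁
FiniteInducedSubgraphsIn {V} 𝔾 G =
  ∀ (U : Pred V 0ℓ) {n} (H : Graph (Fin n)) → H ≅ induced G U → Member 𝔾 H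

{-# OPTIONS --safe #-}
-- Pretend that G has n vertices, for n large: in T = o(log n) rounds the
-- algorithm fails at a given vertex with probability at most 1/n, and two
-- failures depend on each other only within distance 2 (R + T), so that there
-- are d = n^o(1) neighbouring failures.  Let U_0, ..., U_s be Borel sets that
-- split the 2 (R + T)-th power of G into finite components.  The random labels
-- are fixed on U_0, then on U_1, and so on: on each component the local lemma
-- yields labels that multiply all conditional failure probabilities by at most
-- 4 d.  After s + 1 stages these are at most (4 d)^(s + 1) / n < 1, hence 0.
--
-- The choices are Borel because the neighbourhood of a Borel set is Borel.
-- This is where Lusin's separation theorem enters: a Borel set with sections
-- of at most k points has a Borel projection, by induction on k, splitting the
-- sections with k points into one-valued pieces, which extend to Borel
-- partial functions.
module Submission where

open import Defs
import Data.Integer.Base as ℤ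
import Data.Integer.Properties as ℤ
import Data.Nat.Properties as ℕ
import Data.Rational.Base as ℚ
import Data.Rational.Properties as ℚ
import Data.Rational.Unnormalised.Base as ℚᵘ
import Data.Rational.Unnormalised.Properties as ℚᵘ
import Data.List.Relation.Unary.Unique.DecPropositional.Properties as DecUnique
import Data.List.Relation.Unary.Unique.Propositional.Properties as Unique
open import Algebra.Properties.CommutativeSemigroup ℕ.+-commutativeSemigroup using () renaming (interchange to +-interchange)
open import Algebra.Properties.CommutativeSemigroup ℕ.*-commutativeSemigroup using () renaming (x∙yz≈y∙xz to *-swapˡ; xy∙z≈xz∙y to *-swapʳ)
open import Data.Bool.Base using (true)
open import Data.Empty using (⊥; ⊥-elim)
open import Data.Fin.Base using (Fin; toℕ)
open import Data.Irrelevant as Irrelevant using (Irrelevant) renaming ([_] to irr)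
open import Data.List.Base using (List; []; _∷_; _++_; length; map; filter; upTo; deduplicate; concatMap; allFin; tabulate; lookup; cartesianProductWith)
open import Data.List.Membership.Propositional using () renaming (_∈_ to _∈ˡ_)
open import Data.List.Membership.Propositional.Properties
  using (∈-filter⁺; ∈-filter⁻; ∈-upTo⁺; ∈-upTo⁻; ∈-map⁺; ∈-map⁻; ∈-deduplicate⁺; ∈-deduplicate⁻; ∈-allFin; ∈-lookup;
         ∈-++⁺ˡ; ∈-++⁺ʳ; ∈-++⁻; ∈-concatMap⁺; ∈-concatMap⁻; ∈-cartesianProductWith⁺)
open import Data.List.Properties
  using (filter-notAll; filter-none; length-map; length-upTo; length-++; length-tabulate; length-filter; length-deduplicate;
         map-++; map-∘; map-tabulate)
open import Data.List.Relation.Unary.All as All using (All; []; _∷_)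
open import Data.List.Relation.Unary.AllPairs using ([]; _∷_)
open import Data.List.Relation.Unary.Any as Any using (Any; here; there)
open import Data.List.Relation.Unary.Any.Properties using (lookup-index)
open import Data.List.Relation.Unary.Unique.Propositional using (Unique)
open import Data.Maybe.Base using (fromMaybe)
open import Data.Nat.Base as ℕ using (ℕ; zero; suc; _+_; _*_; _^_; _≤_; _<_; _⊔_; z≤n; s≤s; NonZero; >-nonZero)
open import Data.Nat.Induction using (<-rec)
open import Data.Nat.ListAction using (sum)
open import Data.Nat.ListAction.Properties using (sum-++)
open import Data.Nat.Logarithm using (⌊log₂_⌋; ⌊log₂⌋-mono-≤; ⌊log₂[2^n]⌋≡n)
open import Data.Nat.Tactic.RingSolver using (solve-∀)
open import Data.Product using (Σ; Σ-syntax; ∃; ∃!; _×_; _,_; proj₁; proj₂; uncurry)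
open import Data.Rational.Base using (ℚ; 0ℚ; 1ℚ; ½)
open import Data.Rational.Unnormalised.Base using (ℚᵘ; mkℚᵘ)
open import Data.Refinement using (Refinement-syntax; _,_; value; proof)
open import Data.Refinement.Properties using (value-injective)
open import Data.Sum.Base using (_⊎_; inj₁; inj₂; [_,_]′)
open import Data.Vec.Base as Vec using (Vec)
open import Function.Base using (_∘_; id; case_of_)
open import Function.Bundles using (_↔_; Inverse; Equivalence; mk↔ₛ′; mk⇔)
open import Function.Properties.Inverse using (↔-sym; ↔-trans)
open import Level as Level using (Level; 0ℓ) renaming (suc to lsuc)
open import Relation.Binary.Construct.Add.Supremum.NonStrict ℕ._≤_ using (_≤⁺_; [_])
open import Relation.Binary.Construct.Closure.ReflexiveTransitive using (Star; _◅_; _◅◅_)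
open import Relation.Binary.Definitions using (tri<; tri≈; tri>)
open import Relation.Binary.PropositionalEquality hiding (resp; [_])
open import Relation.Nullary.Construct.Add.Supremum using (_⁺) renaming ([_] to fin)
open import Relation.Nullary.Decidable.Core using (Dec; yes; no; True; toWitness; fromWitness; recompute)
open import Relation.Nullary.Negation using (¬_; contradiction)
open import Relation.Unary using (Pred; _∈_; _⊆_; ∅; ∁; U; ⋃; _≐_; _∩_; _∪_)


-- Three obstacles shape the proof. (1) The power of G that is split depends on T, hence on n, while
-- the exponent s + 1 has to be known before n is chosen. Finiteness of asi resolves this circle:
-- one s serves all powers at once. (2) The algorithm promises something only on graphs with exactly
-- n vertices. So the ball of radius R + T around a vertex is padded with arbitrary further
-- vertices; the induced subgraph lies in the class, and failure at the centre is the same event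
-- there as in G. Padding needs infinitely many vertices, and a finite G is coloured directly, being
-- itself a member of the class. (3) Each stage makes a choice for every component, of which there
-- may be uncountably many. No failure sees labels of two components, so each is solved by itself. A
-- solution is a labelling of a finite set, and a fixed countable family of Borel labellings of X
-- restricts to every such labelling; the least index that solves a component is a Borel function.
-- Probabilities are integer sums over labellings with the denominators cleared, so that no
-- arithmetic of rationals is needed after the hypothesis on the algorithm has been unpacked.

-- Pairing of natural numbers, classical logic

-- One step along the antidiagonals of ℕ × ℕ; iterated from (0 , 0) it is Cantor's enumeration.
next : ℕ × ℕ → ℕ × ℕ
next (zero  , j) = suc j , zero
next (suc i , j) = i , suc j

unpair : ℕ → ℕ × ℕ
unpair zero    = zero , zero
unpair (suc n) = next (unpair n)

unpair-onto : ∀ i j → Σ[ n ∈ ℕ ] unpair n ≡ (i , j)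
unpair-onto i j = go (i + j) i j refl
  where
  go : ∀ k i j → i + j ≡ k → Σ[ n ∈ ℕ ] unpair n ≡ (i , j)
  go k       zero    zero    e = zero , refl
  go (suc k) (suc i) zero    e with go k zero i (ℕ.suc-injective (trans (cong suc (sym (ℕ.+-identityʳ i))) e))
  ... | n , eq = suc n , cong next eq
  go k       i       (suc j) e with go k (suc i) j (trans (sym (ℕ.+-suc i j)) e)
  ... | n , eq = suc n , cong next eq

abstract
  pair : ℕ → ℕ → ℕ
  pair i j = proj₁ (unpair-onto i j)

  unpair-pair : ∀ i j → unpair (pair i j) ≡ (i , j)
  unpair-pair i j = proj₂ (unpair-onto i j)

module Logic (em : Classical) where

  dne : ∀ {ℓ} {A : Set ℓ} → ¬ ¬ A → A
  dne {A = A} ¬¬a with em {P = A}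
  ... | yes a = a
  ... | no ¬a = contradiction ¬a ¬¬a

  -- Brings a type of any level down to `Set` by keeping only its truth value. Acceptance at a
  -- vertex lives in `Set₁`, whereas the events of the probabilistic argument have to be in `Set`.
  ⟪_⟫ : ∀ {ℓ} → Set ℓ → Set
  ⟪ A ⟫ = True (em {P = A})

  into : ∀ {ℓ} {A : Set ℓ} → A → ⟪ A ⟫
  into = fromWitness

  out : ∀ {ℓ} {A : Set ℓ} → ⟪ A ⟫ → A
  out = toWitness

  ¬∀ : ∀ {ℓ ℓ′} {A : Set ℓ} {P : A → Set ℓ′} → ¬ (∀ x → P x) → Σ[ x ∈ A ] ¬ P x
  ¬∀ h = dne λ k → h λ x → dne λ ¬p → k (x , ¬p)

  IsLeast : ∀ {ℓ} → (ℕ → Set ℓ) → ℕ → Set ℓ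
  IsLeast P n = P n × (∀ m → m < n → ¬ P m)

  least : ∀ {ℓ} {P : ℕ → Set ℓ} → ∃ P → ∃ (IsLeast P)
  least {P = P} (n , p) = <-rec (λ n → P n → ∃ (IsLeast P)) go n p
    where
    go : ∀ n → (∀ {m} → m < n → P m → ∃ (IsLeast P)) → P n → ∃ (IsLeast P)
    go n rec p with em {P = Σ[ m ∈ ℕ ] m < n × P m}
    ... | yes (m , m<n , pm) = rec m<n pm
    ... | no none = n , p , λ m m<n pm → none (m , m<n , pm)

  least-unique : ∀ {ℓ} {P : ℕ → Set ℓ} {m n} → IsLeast P m → IsLeast P n → m ≡ n
  least-unique {m = m} {n} (pm , lm) (pn , ln) with ℕ.<-cmp m n
  ... | tri< m<n _ _ = contradiction pm (ln m m<n)
  ... | tri≈ _ eq _ = eq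
  ... | tri> _ _ n<m = contradiction pn (lm n n<m)

-- Closure properties of σ-algebras

module Sigma (em : Classical) {X : Set} {ℓ : Level} {𝓖 : Pred (Pred X 0ℓ) ℓ} where
  open Logic em

  Mble : Pred (Pred X 0ℓ) (lsuc 0ℓ Level.⊔ ℓ)
  Mble A = A ∈ σ⟨ 𝓖 ⟩

  ⋂-mble : {A : ℕ → Pred X 0ℓ} → (∀ n → Mble (A n)) → Mble (λ x → ∀ n → A n x)
  ⋂-mble m = resp ((λ h n → dne λ ¬a → h (n , ¬a)) , λ h (n , ¬a) → ¬a (h n))
                  (compl (union λ n → compl (m n)))

  ∪-mble : {A B : Pred X 0ℓ} → Mble A → Mble B → Mble (A ∪ B)
  ∪-mble {A} {B} a b = resp (to , from) (union {A = F} λ { zero → a ; (suc _) → b })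
    where
    F : ℕ → Pred X 0ℓ
    F zero    = A
    F (suc _) = B
    to : ∀ {x} → ⋃ ℕ F x → (A ∪ B) x
    to (zero  , p) = inj₁ p
    to (suc _ , p) = inj₂ p
    from : ∀ {x} → (A ∪ B) x → ⋃ ℕ F x
    from (inj₁ p) = 0 , p
    from (inj₂ p) = 1 , p

  ∩-mble : {A B : Pred X 0ℓ} → Mble A → Mble B → Mble (A ∩ B)
  ∩-mble a b = resp ((λ h → dne (h ∘ inj₁) , dne (h ∘ inj₂)) , λ (p , q) → [ (λ ¬p → ¬p p) , (λ ¬q → ¬q q) ]′)
                    (compl (∪-mble (compl a) (compl b)))

  →-mble : {A B : Pred X 0ℓ} → Mble A → Mble B → Mble (λ x → A x → B x)
  →-mble {A} {B} a b = resp (to , from) (∪-mble (compl a) b)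
    where
    to : ∀ {x} → (∁ A ∪ B) x → A x → B x
    to (inj₁ ¬a) p = contradiction p ¬a
    to (inj₂ q)  _ = q
    from : ∀ {x} → (A x → B x) → (∁ A ∪ B) x
    from {x} h with em {P = A x}
    ... | yes p = inj₂ (h p)
    ... | no ¬p = inj₁ ¬p

  const-mble : (P : Set) → Mble (λ _ → P)
  const-mble P with em {P = P}
  ... | yes p = resp ((λ _ → p) , λ _ ()) (compl empty)
  ... | no ¬p = resp ((λ ()) , ¬p) empty

  Mbleᶠ : Pred (X → ℕ) (lsuc 0ℓ Level.⊔ ℓ)
  Mbleᶠ f = ∀ i → Mble (λ x → f x ≡ i)

  value-mble : {f : X → ℕ} → Mbleᶠ f → (P : ℕ → Set) → Mble (P ∘ f)
  value-mble {f} m P = resp ((λ { (i , refl , p) → p }) , λ p → _ , refl , p)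
    (union λ i → ∩-mble (m i) (const-mble (P i)))

  value₂-mble : {f g : X → ℕ} → Mbleᶠ f → Mbleᶠ g → (P : ℕ → ℕ → Set) → Mble (λ x → P (f x) (g x))
  value₂-mble {f} {g} mf mg P = resp ((λ { (i , refl , p) → p }) , λ p → _ , refl , p)
    (union λ i → ∩-mble (mf i) (value-mble mg (P i)))

  -- The sets `S i` with `i` in the list cut `D` into finitely many measurable atoms, and by the
  -- last hypothesis `P` holds throughout an atom or nowhere in it. The induction cuts along one set
  -- at a time; with the list exhausted, `D` is itself an atom.
  determined-mble : ∀ {I : Set} (S : I → Pred X 0ℓ) → (∀ i → Mble (S i)) → (is : List I) →
    {D : Pred X 0ℓ} → Mble D → (P : Pred X 0ℓ) →
    (∀ {x y} → D x → D y → (∀ {i} → i ∈ˡ is → (S i x → S i y) × (S i y → S i x)) → P x → P y) →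
    Mble (D ∩ P)
  determined-mble S mS [] {D} mD P det with em {P = Σ[ x ∈ X ] D x × P x}
  ... | yes (x , d , p) = resp ((λ d′ → d′ , det d d′ (λ ()) p) , proj₁) mD
  ... | no none = resp ((λ ()) , λ {x} (d , p) → none (x , d , p)) empty
  determined-mble S mS (i ∷ is) {D} mD P det = resp (to , from) (∪-mble inside outside)
    where
    half : {E : Pred X 0ℓ} → Mble E → (∀ {x y} → E x → E y → (S i x → S i y) × (S i y → S i x)) →
           Mble ((D ∩ E) ∩ P)
    half mE agree = determined-mble S mS is (∩-mble mD mE) P
      λ { (d , e) (d′ , e′) eq p → det d d′ (λ { (here refl) → agree e e′ ; (there i∈) → eq i∈ }) p }
    inside = half {S i} (mS i) (λ p q → (λ _ → q) , (λ _ → p))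
    outside = half {∁ (S i)} (compl (mS i)) (λ p q → (λ p′ → contradiction p′ p) , (λ q′ → contradiction q′ q))
    to : ∀ {x} → (((D ∩ S i) ∩ P) ∪ ((D ∩ ∁ (S i)) ∩ P)) x → (D ∩ P) x
    to (inj₁ ((d , _) , p)) = d , p
    to (inj₂ ((d , _) , p)) = d , p
    from : ∀ {x} → (D ∩ P) x → (((D ∩ S i) ∩ P) ∪ ((D ∩ ∁ (S i)) ∩ P)) x
    from {x} (d , p) with em {P = S i x}
    ... | yes s = inj₁ ((d , s) , p)
    ... | no ¬s = inj₂ ((d , ¬s) , p)

-- Polish spaces in terms of dyadic distances

dyadic : ℕ → ℚ
dyadic zero    = 1ℚ
dyadic (suc j) = ½ ℚ.* dyadic j

dyadic-double : ∀ j → dyadic (suc j) ℚ.+ dyadic (suc j) ≡ dyadic j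
dyadic-double j = trans (sym (ℚ.*-distribʳ-+ (dyadic j) ½ ½)) (ℚ.*-identityˡ (dyadic j))

dyadic-positive : ∀ j → 0ℚ ℚ.< dyadic j
dyadic-positive zero    = ℚ.positive⁻¹ 1ℚ
dyadic-positive (suc j) = ℚ.positive⁻¹ _ {{ℚ.pos*pos⇒pos ½ (dyadic j) {{ℚ.positive (dyadic-positive j)}}}}

-- `mkℚᵘ (ℤ.+ 1) m` is 1 / (m + 1). Halving replaces m + 1 by 2 (m + 1), which is the successor of m
-- + (m + 1).
dyadic-unitFraction : ∀ j → Σ[ m ∈ ℕ ] j ≤ m × ℚ.toℚᵘ (dyadic j) ℚᵘ.≃ mkℚᵘ (ℤ.+ 1) m
dyadic-unitFraction zero    = 0 , z≤n , ℚᵘ.≃-refl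
dyadic-unitFraction (suc j) with dyadic-unitFraction j
... | m , j≤m , eq = m + suc (m + 0) , bound ,
    ℚᵘ.≃-trans (ℚ.toℚᵘ-homo-* ½ (dyadic j)) (ℚᵘ.*-congˡ {ℚ.toℚᵘ ½} eq)
  where
  bound : suc j ≤ m + suc (m + 0)
  bound = ℕ.≤-trans (s≤s j≤m) (ℕ.≤-trans (s≤s (ℕ.m≤m+n m (m + 0))) (ℕ.≤-reflexive (sym (ℕ.+-suc m (m + 0)))))

-- The exponent is the denominator minus 1: q = (a + 1) / (d + 1) ≥ 1 / (d + 1) ≥ 2⁻ᵈ.
archimedean : ∀ {q} → 0ℚ ℚ.< q → Σ[ j ∈ ℕ ] dyadic j ℚ.≤ q
archimedean {q@(ℚ.mkℚ (ℤ.+ suc a) d _)} 0<q with dyadic-unitFraction d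
... | m , d≤m , eq = d , ℚ.toℚᵘ-cancel-≤ (ℚᵘ.≤-respˡ-≃ (ℚᵘ.≃-sym eq) (ℚᵘ.*≤* bound))
  where
  bound : ℤ.+ 1 ℤ.* ℤ.+ suc d ℤ.≤ ℤ.+ suc a ℤ.* ℤ.+ suc m
  bound = subst₂ ℤ._≤_ (ℤ.pos-* 1 (suc d)) (ℤ.pos-* (suc a) (suc m))
    (ℤ.+≤+ (ℕ.*-mono-≤ {1} {suc a} (s≤s z≤n) (s≤s d≤m)))
archimedean {ℚ.mkℚ (ℤ.+ zero) d _} (ℚ.*<* (ℤ.+<+ ()))
archimedean {ℚ.mkℚ (ℤ.-[1+ _ ]) d _} (ℚ.*<* ())

-- A Polish space through the dyadic entourages of its metric: Near j x y
-- stands for d(x, y) < 2⁻ʲ.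
record Polish (X : Set) : Set₁ where
  field
    Near : ℕ → X → X → Set
    near-refl : ∀ {j x} → Near j x x
    near-sym  : ∀ {j x y} → Near j x y → Near j y x
    near-tri  : ∀ {j x y z} → Near (suc j) x y → Near (suc j) y z → Near j x z
    near-sep  : ∀ {x y} → (∀ j → Near j x y) → x ≡ y
    ball-open : ∀ {j x y} → Near j x y → Σ[ k ∈ ℕ ] (∀ {z} → Near k y z → Near j x z)
    dense     : ℕ → X
    dense-near : ∀ x j → Σ[ n ∈ ℕ ] Near j (dense n) x

  Cauchyᵁ : (ℕ → X) → Set
  Cauchyᵁ s = ∀ j → Σ[ N ∈ ℕ ] (∀ i k → N ≤ i → N ≤ k → Near j (s i) (s k))

  _⟶_ : (ℕ → X) → X → Set
  s ⟶ x = ∀ j → Σ[ N ∈ ℕ ] (∀ i → N ≤ i → Near j (s i) x)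

  field
    complete : ∀ s → Cauchyᵁ s → Σ[ x ∈ X ] s ⟶ x

  near-weaken : ∀ {j x y} → Near (suc j) x y → Near j x y
  near-weaken p = near-tri p near-refl

  near-≤ : ∀ {j k x y} → j ≤ k → Near k x y → Near j x y
  near-≤ {j} {k} j≤k p with ℕ.m≤n⇒m<n∨m≡n j≤k
  near-≤ {j} {k} j≤k p | inj₂ refl = p
  near-≤ {j} {suc k} j≤k p | inj₁ (s≤s j≤k′) = near-≤ j≤k′ (near-weaken p)

  OpenSet : Pred X 0ℓ → Set
  OpenSet U = ∀ {x} → U x → Σ[ j ∈ ℕ ] (∀ {y} → Near j x y → U y)

module _ {X : Set} (μ : Metric X) (cμ : Complete μ) (sμ : Separable μ) (x₀ : X) where
  open Metric μ

  private
    Near : ℕ → X → X → Set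
    Near j x y = d x y <ᴿ dyadic j

    upward : ∀ {x y q r} → d x y <ᴿ q → q ℚ.≤ r → d x y <ᴿ r
    upward {x} {y} = ℝ≥0.upward (d x y)

    Cauchyᵁ : (ℕ → X) → Set
    Cauchyᵁ s = ∀ j → Σ[ N ∈ ℕ ] (∀ i k → N ≤ i → N ≤ k → Near j (s i) (s k))

    _⟶_ : (ℕ → X) → X → Set
    s ⟶ x = ∀ j → Σ[ N ∈ ℕ ] (∀ i → N ≤ i → Near j (s i) x)

    complete : ∀ s → Cauchyᵁ s → Σ[ x ∈ X ] s ⟶ x
    complete s cs with cμ s (λ ε 0<ε → let j , ≤ε = archimedean 0<ε ; N , h = cs j in
                                       N , λ i k N≤i N≤k → upward (h i k N≤i N≤k) ≤ε)
    ... | x , lim = x , λ j → lim (dyadic j) (dyadic-positive j)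

    -- Since the cut d(x, y) is rounded, it lies below some r < 2⁻ʲ, and any 2⁻ᵏ ≤ 2⁻ʲ - r serves.
    ball-open : ∀ {j x y} → Near j x y → Σ[ k ∈ ℕ ] (∀ {z} → Near k y z → Near j x z)
    ball-open {j} {x} {y} p with ℝ≥0.rounded (d x y) p
    ... | r , r<ρ , p′ with archimedean {dyadic j ℚ.+ ℚ.- r}
                              (subst (ℚ._< dyadic j ℚ.+ ℚ.- r) (ℚ.+-inverseʳ r) (ℚ.+-monoˡ-< (ℚ.- r) r<ρ))
    ... | k , ≤gap = k , λ q → upward (triangle p′ q) (ℚ.≤-trans (ℚ.+-monoʳ-≤ r ≤gap) (ℚ.≤-reflexive cancel))
      where
      cancel : r ℚ.+ (dyadic j ℚ.+ ℚ.- r) ≡ dyadic j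
      cancel = trans (cong (r ℚ.+_) (ℚ.+-comm (dyadic j) (ℚ.- r)))
        (trans (sym (ℚ.+-assoc r (ℚ.- r) (dyadic j)))
        (trans (cong (ℚ._+ dyadic j) (ℚ.+-inverseʳ r)) (ℚ.+-identityˡ (dyadic j))))

    dense-near : ∀ x j → Σ[ n ∈ ℕ ] Near j (fromMaybe x₀ (proj₁ sμ n)) x
    dense-near x j with proj₂ sμ x (dyadic j) (dyadic-positive j)
    ... | n , y , eq , p = n , subst (λ m → Near j (fromMaybe x₀ m) x) (sym eq) (symmetric p)

  polish : Polish X
  polish = record
    { Near = Near
    ; near-refl = λ {j} {x} → reflexive x (dyadic-positive j)
    ; near-sym = symmetric
    ; near-tri = λ {j} p q → upward (triangle p q) (ℚ.≤-reflexive (dyadic-double j))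
    ; near-sep = λ h → separated λ 0<ε → let j , ≤ε = archimedean 0<ε in upward (h j) ≤ε
    ; ball-open = λ {j} → ball-open {j}
    -- The given dense sequence may have gaps; `x₀` fills them.
    ; dense = λ n → fromMaybe x₀ (proj₁ sμ n)
    ; dense-near = dense-near
    ; complete = complete
    }

  Open⇒OpenSet : Open μ ⊆ Polish.OpenSet polish
  Open⇒OpenSet o {x} u with o x u
  ... | ε , 0<ε , h with archimedean 0<ε
  ... | j , ≤ε = j , λ {y} p → h y (upward p ≤ε)

  OpenSet⇒Open : Polish.OpenSet polish ⊆ Open μ
  OpenSet⇒Open o x u with o u
  ... | j , h = dyadic j , dyadic-positive j , λ y p → h p

-- Baire space

Sequence : Set
Sequence = ℕ → ℕ

section : ℕ → Sequence → Sequence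
section i b k = b (pair i k)

merge : (ℕ → Sequence) → Sequence
merge bs m = let i , k = unpair m in bs i k

section-merge : ∀ bs i k → section i (merge bs) k ≡ bs i k
section-merge bs i k = cong (λ (i , k) → bs i k) (unpair-pair i k)

infix 4 _⇝_
-- Convergence in Baire space: every coordinate is eventually constant.
_⇝_ : (ℕ → Sequence) → Sequence → Set
bs ⇝ b = ∀ k → Σ[ N ∈ ℕ ] (∀ n → N ≤ n → bs n k ≡ b k)

_[_≔_] : ∀ {a} {A : Set a} → (ℕ → A) → ℕ → A → ℕ → A
(v [ n ≔ c ]) k with k ℕ.≟ n
... | yes _ = c
... | no _  = v k

≔-same : ∀ {a} {A : Set a} (v : ℕ → A) n {c} → (v [ n ≔ c ]) n ≡ c
≔-same v n with n ℕ.≟ n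
... | yes _ = refl
... | no n≢n = contradiction refl n≢n

≔-below : ∀ {a} {A : Set a} (v : ℕ → A) n {c k} → k < n → (v [ n ≔ c ]) k ≡ v k
≔-below v n {k = k} k<n with k ℕ.≟ n
... | yes refl = contradiction k<n (ℕ.<-irrefl refl)
... | no _ = refl

-- Analytic sets and Lusin separation

-- All that is kept of a topology is which sequences converge. This suffices for sequentially closed
-- sets and passes to products coordinatewise.
record Convergence (Z : Set) : Set₁ where
  field
    Lim      : (ℕ → Z) → Z → Set
    lim-tail : ∀ {s z} N → Lim s z → Lim (λ n → s (N + n)) z
    lim-const : ∀ {z} → Lim (λ _ → z) z

open Convergence

×-convergence : ∀ {Y Z} → Convergence Y → Convergence Z → Convergence (Y × Z)
×-convergence κ κ′ = record
  { Lim = λ s (y , z) → Lim κ (proj₁ ∘ s) y × Lim κ′ (proj₂ ∘ s) z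
  ; lim-tail = λ N (l , l′) → lim-tail κ N l , lim-tail κ′ N l′
  ; lim-const = lim-const κ , lim-const κ′
  }

module Analytic (em : Classical) where
  open Logic em

  module _ {Z : Set} (κ : Convergence Z) where

    -- Sequential closedness in the product of Baire space with Z; analytic sets
    -- are the projections of such sets.
    Closed : (Sequence → Pred Z 0ℓ) → Set
    Closed C = ∀ bs zs {b z} → bs ⇝ b → Lim κ zs z → (∀ n → C (bs n) (zs n)) → C b z

    record IsAnalytic (A : Pred Z 0ℓ) : Set₁ where
      constructor mkAnalytic
      field
        code      : Sequence → Pred Z 0ℓ
        is-closed : Closed code
        encode    : ∀ {z} → A z → ∃ λ b → code b z
        decode    : ∀ {z} → (∃ λ b → code b z) → A z

    ClosedSet : Pred Z 0ℓ → Set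
    ClosedSet F = ∀ zs {z} → Lim κ zs z → (∀ n → F (zs n)) → F z

  open IsAnalytic

  module _ {Z : Set} {κ : Convergence Z} where

    -- The constant sequence at `b` converges to every pointwise equal `b′`, so closedness takes the
    -- place of extensionality of functions.
    closed-ext : ∀ {C : Sequence → Pred Z 0ℓ} → Closed κ C → ∀ {b b′ z} → (∀ k → b k ≡ b′ k) → C b z → C b′ z
    closed-ext cl {b} {b′} {z} eq c = cl (λ _ → b) (λ _ → z) (λ k → 0 , λ _ _ → eq k) (lim-const κ) (λ _ → c)

    closed⇒analytic : ∀ {F} → ClosedSet κ F → IsAnalytic κ F
    closed⇒analytic {F} cl = mkAnalytic (λ _ → F) (λ _ zs _ → cl zs) (λ p → (λ _ → 0) , p) proj₂

    analytic-resp : ∀ {A B} → A ≐ B → IsAnalytic κ A → IsAnalytic κ B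
    analytic-resp (A⊆B , B⊆A) (mkAnalytic C cl to from) = mkAnalytic C cl (to ∘ B⊆A) (A⊆B ∘ from)

    -- The first term of a code names one of the sets, and the remaining terms are a code for that
    -- set. Along a convergent sequence of codes the first term is eventually constant, so after
    -- dropping finitely many terms closedness concerns a single set.
    ⋃-analytic : {A : ℕ → Pred Z 0ℓ} → (∀ n → IsAnalytic κ (A n)) → IsAnalytic κ (⋃ ℕ A)
    ⋃-analytic {A} an = mkAnalytic C cl to from
      where
      C : Sequence → Pred Z 0ℓ
      C b = code (an (b 0)) (b ∘ suc)
      cl : Closed κ C
      cl bs zs {b} {z} bs⇝b lim c with bs⇝b 0
      ... | N , h = is-closed (an (b 0)) (λ n → bs (N + n) ∘ suc) (λ n → zs (N + n))
        (λ k → let M , h′ = bs⇝b (suc k) in M , λ n M≤n → h′ (N + n) (ℕ.≤-trans M≤n (ℕ.m≤n+m n N)))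
        (lim-tail κ N lim)
        (λ n → subst (λ i → code (an i) (bs (N + n) ∘ suc) (zs (N + n))) (h (N + n) (ℕ.m≤m+n N n)) (c (N + n)))
      to : ∀ {z} → ⋃ ℕ A z → ∃ λ b → C b z
      to (n , a) with encode (an n) a
      ... | b , c = (λ { zero → n ; (suc k) → b k }) , c
      from : ∀ {z} → (∃ λ b → C b z) → ⋃ ℕ A z
      from (b , c) = b 0 , decode (an (b 0)) (_ , c)

    section-⇝ : ∀ {bs b} i → bs ⇝ b → (section i ∘ bs) ⇝ section i b
    section-⇝ i h k = h (pair i k)

    -- One sequence carries a code for each of the sets in its sections, and convergence passes to
    -- each section.
    ⋂-analytic : {A : ℕ → Pred Z 0ℓ} → (∀ n → IsAnalytic κ (A n)) → IsAnalytic κ (λ z → ∀ n → A n z)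
    ⋂-analytic {A} an = mkAnalytic C cl to from
      where
      C : Sequence → Pred Z 0ℓ
      C b z = ∀ n → code (an n) (section n b) z
      cl : Closed κ C
      cl bs zs bs⇝b lim c n = is-closed (an n) (section n ∘ bs) zs (section-⇝ n bs⇝b) lim (λ m → c m n)
      to : ∀ {z} → (∀ n → A n z) → ∃ λ b → C b z
      to a = merge (λ n → proj₁ (w n)) ,
             λ n → closed-ext {code (an n)} (is-closed (an n)) (λ k → sym (section-merge (λ m → proj₁ (w m)) n k)) (proj₂ (w n))
        where w = λ n → encode (an n) (a n)
      from : ∀ {z} → (∃ λ b → C b z) → ∀ n → A n z
      from (b , c) n = decode (an n) (_ , c n)

    ∪-analytic : ∀ {A B} → IsAnalytic κ A → IsAnalytic κ B → IsAnalytic κ (A ∪ B)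
    ∪-analytic {A} {B} a b = analytic-resp (to , from) (⋃-analytic {F} λ { zero → a ; (suc _) → b })
      where
      F : ℕ → Pred Z 0ℓ
      F zero    = A
      F (suc _) = B
      to : ⋃ ℕ F ⊆ A ∪ B
      to (zero  , p) = inj₁ p
      to (suc _ , p) = inj₂ p
      from : A ∪ B ⊆ ⋃ ℕ F
      from (inj₁ p) = 0 , p
      from (inj₂ p) = 1 , p

    ∩-analytic : ∀ {A B} → IsAnalytic κ A → IsAnalytic κ B → IsAnalytic κ (A ∩ B)
    ∩-analytic {A} {B} a b = analytic-resp
      ((λ h → h 0 , h 1) , λ { (p , q) zero → p ; (p , q) (suc _) → q })
      (⋂-analytic {F} λ { zero → a ; (suc _) → b })
      where
      F : ℕ → Pred Z 0ℓ
      F zero    = A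
      F (suc _) = B

    Bianalytic : Pred Z 0ℓ → Set₁
    Bianalytic A = IsAnalytic κ A × IsAnalytic κ (∁ A)

    -- Analytic sets are not closed under complement, so the induction carries a set together with
    -- its complement; `compl` then swaps the two.
    σ-bianalytic : ∀ {ℓ} {𝓖 : Pred (Pred Z 0ℓ) ℓ} → 𝓖 ⊆ Bianalytic → σ⟨ 𝓖 ⟩ ⊆ Bianalytic
    σ-bianalytic g (basic a) = g a
    σ-bianalytic g empty = closed⇒analytic (λ _ _ h → h 0) , closed⇒analytic (λ _ _ _ ())
    σ-bianalytic g (compl m) with σ-bianalytic g m
    ... | a , a′ = a′ , analytic-resp ((λ p ¬p → ¬p p) , dne) a
    σ-bianalytic g (union m) = ⋃-analytic (λ n → proj₁ (σ-bianalytic g (m n))) ,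
      analytic-resp ((λ h (n , p) → h n p) , λ h n p → h (n , p)) (⋂-analytic (λ n → proj₂ (σ-bianalytic g (m n))))
    σ-bianalytic g (resp (A⊆B , B⊆A) m) with σ-bianalytic g m
    ... | a , a′ = analytic-resp (A⊆B , B⊆A) a , analytic-resp ((_∘ B⊆A) , (_∘ A⊆B)) a′

  preimage-analytic : ∀ {Y Z} {κ : Convergence Y} {κ′ : Convergence Z} (h : Y → Z) →
    (∀ {s y} → Lim κ s y → Lim κ′ (h ∘ s) (h y)) → ∀ {A} → IsAnalytic κ′ A → IsAnalytic κ (A ∘ h)
  preimage-analytic h cont (mkAnalytic C cl to from) =
    mkAnalytic (λ b y → C b (h y)) (λ bs ys b⇝ lim c → cl bs (h ∘ ys) b⇝ (cont lim) c) to from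

  module Separation {X : Set} (Ξ : Polish X) where
    open Polish Ξ

    convergence : Convergence X
    convergence = record
      { Lim = _⟶_
      ; lim-tail = λ N lim j → let M , h = lim j in M , λ n M≤n → h (N + n) (ℕ.≤-trans M≤n (ℕ.m≤n+m n N))
      ; lim-const = λ j → 0 , λ _ _ → near-refl
      }

    Borel : Pred (Pred X 0ℓ) (lsuc 0ℓ)
    Borel A = A ∈ σ⟨ OpenSet ⟩

    open Sigma em {𝓖 = OpenSet} using (⋂-mble; const-mble)

    -- An open set is a countable union of closed sets: for each j, the points whose 2⁻ʲ-ball lies
    -- inside it form a closed set.
    open-analytic : OpenSet ⊆ Bianalytic {κ = convergence}
    open-analytic {O} o =
      analytic-resp ((λ { (j , h) → h near-refl }) , o) (⋃-analytic (λ j → closed⇒analytic (F-closed j))) ,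
      closed⇒analytic ∁-closed
      where
      F : ℕ → Pred X 0ℓ
      F j x = ∀ {y} → Near j x y → O y
      F-closed : ∀ j → ClosedSet convergence (F j)
      F-closed j zs {z} lim h {y} p with ball-open (near-sym p)
      ... | k , b with lim k
      ... | N , l = h N (near-sym (b (near-sym (l N ℕ.≤-refl))))
      ∁-closed : ClosedSet convergence (∁ O)
      ∁-closed zs lim h p with o p
      ... | j , b with lim j
      ... | N , l = h N (b (near-sym (l N ℕ.≤-refl)))

    Borel⇒bianalytic : Borel ⊆ Bianalytic {κ = convergence}
    Borel⇒bianalytic = σ-bianalytic open-analytic

    ball-Borel : ∀ j x → Borel (Near j x)
    ball-Borel j x = basic λ p → ball-open p

    -- `b` is a name of y: the dense points that it lists move by less than 2⁻ᵏ⁻¹ in step k and tend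
    -- to y. Names form a closed set in Baire space that maps continuously onto X; this is how
    -- points become part of a code.
    Represents : Sequence → Pred X 0ℓ
    Represents b y = (∀ k → Near (suc k) (dense (b k)) (dense (b (suc k)))) × (dense ∘ b) ⟶ y

    -- Term k is taken within 2⁻ᵏ⁻² of y, so that two consecutive terms are less than 2⁻ᵏ⁻¹ apart.
    representation : ∀ y → ∃ λ b → Represents b y
    representation y = b , (λ k → near-tri (near k) (near-sym (near-weaken (near (suc k))))) ,
      λ j → j , λ i j≤i → near-≤ (ℕ.≤-trans j≤i (ℕ.m≤n+m i 2)) (near i)
      where
      b : Sequence
      b k = proj₁ (dense-near y (suc (suc k)))
      near : ∀ k → Near (suc (suc k)) (dense (b k)) y
      near k = proj₂ (dense-near y (suc (suc k)))

    -- The first step is peeled off, not the last: it costs 2⁻ᵏ⁻¹, and all the later ones together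
    -- cost 2⁻ᵏ⁻¹ by induction.
    fast-near : ∀ {s : ℕ → X} → (∀ k → Near (suc k) (s k) (s (suc k))) → ∀ m k → Near k (s k) (s (m + k))
    fast-near f zero    k = near-refl
    fast-near {s} f (suc m) k = near-tri (f k) (subst (λ i → Near (suc k) (s (suc k)) (s i)) (ℕ.+-suc m k) (fast-near f m (suc k)))

    fast-near-≤ : ∀ {s : ℕ → X} → (∀ k → Near (suc k) (s k) (s (suc k))) → ∀ {k n} → k ≤ n → Near k (s k) (s n)
    fast-near-≤ {s} f {k} {n} k≤n = subst (λ i → Near k (s k) (s i)) (ℕ.m∸n+n≡m k≤n) (fast-near f (n ℕ.∸ k) k)

    represents-near : ∀ {b y} → Represents b y → ∀ k → Near k (dense (b (suc k))) y
    represents-near (f , lim) k with lim (suc k)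
    ... | N , h = near-tri (fast-near-≤ f (ℕ.m≤m⊔n (suc k) N)) (h (suc k ⊔ N) (ℕ.m≤n⊔m (suc k) N))

    -- Fastness is a condition on two consecutive terms, so `b` inherits it, and completeness
    -- supplies y. Term j + 2 of `bs n` is eventually that of `b`, and this one term locates both
    -- `ys n` and y.
    represents-limit : ∀ {bs b ys} → bs ⇝ b → (∀ n → Represents (bs n) (ys n)) →
                       Σ[ y ∈ X ] Represents b y × ys ⟶ y
    represents-limit {bs} {b} {ys} bs⇝b r = y , rep , lim
      where
      f : ∀ k → Near (suc k) (dense (b k)) (dense (b (suc k)))
      f k with bs⇝b k | bs⇝b (suc k)
      ... | N , h | N′ , h′ = subst₂ (λ i j → Near (suc k) (dense i) (dense j))
        (h (N ⊔ N′) (ℕ.m≤m⊔n N N′)) (h′ (N ⊔ N′) (ℕ.m≤n⊔m N N′)) (proj₁ (r (N ⊔ N′)) k)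
      limit : Σ[ y ∈ X ] (dense ∘ b) ⟶ y
      limit = complete (dense ∘ b) λ j → suc j , λ i k j<i j<k →
        near-tri (near-sym (fast-near-≤ f j<i)) (fast-near-≤ f j<k)
      y = proj₁ limit
      rep : Represents b y
      rep = f , proj₂ limit
      lim : ys ⟶ y
      lim j with bs⇝b (suc (suc j))
      ... | N , h = N , λ n N≤n → near-tri
        (near-sym (subst (λ i → Near (suc j) (dense i) (ys n)) (h n N≤n) (represents-near (r n) (suc j))))
        (represents-near rep (suc j))

    -- The projected coordinate is absorbed into the code: section 0 codes membership in `A`,
    -- section 1 names y. Closedness survives because convergent names have convergent points.
    projection-analytic : ∀ {A : Pred (X × X) 0ℓ} → IsAnalytic (×-convergence convergence convergence) A →
      IsAnalytic convergence (λ x → ∃ λ y → A (x , y))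
    projection-analytic {A} (mkAnalytic C cl to from) = mkAnalytic C′ cl′ to′ from′
      where
      C′ : Sequence → Pred X 0ℓ
      C′ b x = ∃ λ y → C (section 0 b) (x , y) × Represents (section 1 b) y
      cl′ : Closed convergence C′
      cl′ bs xs {b} bs⇝b lim c with represents-limit {b = section 1 b} (λ k → bs⇝b (pair 1 k)) (λ n → proj₂ (proj₂ (c n)))
      ... | y , r , lim′ = y , cl (section 0 ∘ bs) (λ n → xs n , proj₁ (c n)) (λ k → bs⇝b (pair 0 k))
                                 (lim , lim′) (λ n → proj₁ (proj₂ (c n))) , r
      to′ : ∀ {x} → (∃ λ y → A (x , y)) → ∃ λ b → C′ b x
      to′ {x} (y , a) with to a | representation y
      ... | b₀ , c | b₁ , f , l = b , y , closed-ext {κ = ×-convergence convergence convergence} {C} cl (λ k → sym (section-merge pick 0 k)) c ,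
          (λ k → subst₂ (λ i j → Near (suc k) (dense i) (dense j)) (sym (eq₁ k)) (sym (eq₁ (suc k))) (f k)) ,
          (λ j → let N , h = l j in N , λ i N≤i → subst (λ m → Near j (dense m) y) (sym (eq₁ i)) (h i N≤i))
        where
        pick : ℕ → Sequence
        pick zero    = b₀
        pick (suc _) = b₁
        b = merge pick
        eq₁ : ∀ k → section 1 b k ≡ b₁ k
        eq₁ k = section-merge pick 1 k
      from′ : ∀ {x} → (∃ λ b → C′ b x) → ∃ λ y → A (x , y)
      from′ (b , y , c , _) = y , from (_ , c)

    Separable-by-Borel : Pred X 0ℓ → Pred X 0ℓ → Set₁
    Separable-by-Borel P Q = Σ[ B ∈ Pred X 0ℓ ] Borel B × P ⊆ B × Q ⊆ ∁ B

    -- If Bᵢⱼ separates the i-th piece from the j-th, then ⋃ᵢ ⋂ⱼ Bᵢⱼ separates the unions. Used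
    -- contrapositively: inseparable sets have an inseparable pair of pieces.
    separate-unions : ∀ {P Q : Pred X 0ℓ} {P′ Q′ : ℕ → Pred X 0ℓ} → P ⊆ ⋃ ℕ P′ → Q ⊆ ⋃ ℕ Q′ →
      (∀ i j → Separable-by-Borel (P′ i) (Q′ j)) → Separable-by-Borel P Q
    separate-unions {P} {Q} {P′} {Q′} P⊆ Q⊆ s =
      (λ x → ∃ λ i → ∀ j → proj₁ (s i j) x) , union (λ i → ⋂-mble λ j → proj₁ (proj₂ (s i j))) ,
      (λ p → let i , p′ = P⊆ p in i , λ j → proj₁ (proj₂ (proj₂ (s i j))) p′) ,
      λ q (i , h) → let j , q′ = Q⊆ q in proj₂ (proj₂ (proj₂ (s i j))) q′ (h j)

    module _ {C C′ : Sequence → Pred X 0ℓ} (cl : Closed convergence C) (cl′ : Closed convergence C′)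
             (disjoint : ∀ {b b′ x} → C b x → C′ b′ x → ⊥) where
      private
        -- The code includes a name of the point x itself in section 1, so that longer prefixes also
        -- confine the part to smaller balls.
        Part : (Sequence → Pred X 0ℓ) → ℕ → Sequence → Pred X 0ℓ
        Part C n v x = ∃ λ b → (C (section 0 b) x × Represents (section 1 b) x) × (∀ k → k < n → b k ≡ v k)

        split : ∀ (C : Sequence → Pred X 0ℓ) n v → Part C n v ⊆ ⋃ ℕ (λ c → Part C (suc n) (v [ n ≔ c ]))
        split C n v (b , c , agree) = b n , b , c , λ k k<sn → case ℕ.m≤n⇒m<n∨m≡n (ℕ.s≤s⁻¹ k<sn) of λ
          { (inj₁ k<n) → trans (agree k k<n) (sym (≔-below v n k<n))
          ; (inj₂ refl) → sym (≔-same v n) }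

        State : ℕ → Set₁
        State n = Σ[ v ∈ Sequence ] Σ[ v′ ∈ Sequence ] ¬ Separable-by-Borel (Part C n v) (Part C′ n v′)

        Extends : ∀ {n} → State n → State (suc n) → Set
        Extends {n} (v , v′ , _) (w , w′ , _) = ∀ k → k < n → w k ≡ v k × w′ k ≡ v′ k

        advance : ∀ {n} (s : State n) → Σ[ t ∈ State (suc n) ] Extends s t
        advance {n} (v , v′ , ns) with ¬∀ (λ h → ns (separate-unions (split C n v) (split C′ n v′) h))
        ... | i , h with ¬∀ h
        ... | j , ns′ = (v [ n ≔ i ] , v′ [ n ≔ j ] , ns′) , λ k k<n → ≔-below v n k<n , ≔-below v′ n k<n

        branch : State 0 → Σ[ w ∈ Sequence ] Σ[ w′ ∈ Sequence ] (∀ n → ¬ Separable-by-Borel (Part C n w) (Part C′ n w′))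
        branch start = w , w′ , inseparable
          where
          state : ∀ n → State n
          state zero    = start
          state (suc n) = proj₁ (advance (state n))

          w w′ : Sequence
          -- Term k is settled at stage k + 1 and never changed afterwards.
          w k = proj₁ (state (suc k)) k
          w′ k = proj₁ (proj₂ (state (suc k))) k

          stable : ∀ n k → k < n → proj₁ (state n) k ≡ w k × proj₁ (proj₂ (state n)) k ≡ w′ k
          stable (suc n) k k<sn = [ below , (λ { refl → refl , refl }) ]′ (ℕ.m≤n⇒m<n∨m≡n (ℕ.s≤s⁻¹ k<sn))
            where
            below : k < n → proj₁ (state (suc n)) k ≡ w k × proj₁ (proj₂ (state (suc n))) k ≡ w′ k
            below k<n = let e , e′ = proj₂ (advance (state n)) k k<n ; f , f′ = stable n k k<n
                        in trans e f , trans e′ f′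

          inseparable : ∀ n → ¬ Separable-by-Borel (Part C n w) (Part C′ n w′)
          inseparable n (B , mB , P⊆ , Q⊆) = proj₂ (proj₂ (state n)) (B , mB ,
            (λ { (b , c , agree) → P⊆ (b , c , λ k k<n → trans (agree k k<n) (proj₁ (stable n k k<n))) }) ,
            (λ { (b , c , agree) → Q⊆ (b , c , λ k k<n → trans (agree k k<n) (proj₂ (stable n k k<n))) }))

        module _ (w w′ : Sequence) (inseparable : ∀ n → ¬ Separable-by-Borel (Part C n w) (Part C′ n w′)) where

          -- A part without points would be separated from every set by the empty set.
          point : ∀ n → ∃ (Part C n w)
          point n = dne λ none → inseparable n (∅ , empty , (λ {x} p → none (x , p)) , λ _ ())

          point′ : ∀ n → ∃ (Part C′ n w′)
          point′ n = dne λ none → inseparable n (U , resp ((λ _ → _) , λ _ ()) (compl empty) , (λ _ → _) , λ {x} p _ → none (x , p))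

          limit : ∀ {D : Sequence → Pred X 0ℓ} {v} → Closed convergence D → (∀ n → ∃ (Part D n v)) →
                  Σ[ x ∈ X ] D (section 0 v) x × Represents (section 1 v) x
          limit {D} {v} clD p = x , clD (section 0 ∘ bs) xs (λ k → conv (pair 0 k)) lim (λ n → proj₁ (proj₁ (proj₂ (proj₂ (p n))))) , r
            where
            bs = λ n → proj₁ (proj₂ (p n))
            xs = λ n → proj₁ (p n)
            conv : bs ⇝ v
            conv k = suc k , λ n k<n → proj₂ (proj₂ (proj₂ (p n))) k k<n
            loc = represents-limit {b = section 1 v} (λ k → conv (pair 1 k)) (λ n → proj₂ (proj₁ (proj₂ (proj₂ (p n)))))
            x = proj₁ loc
            r = proj₁ (proj₂ loc)
            lim = proj₂ (proj₂ loc)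

          part-near : ∀ {D : Sequence → Pred X 0ℓ} {v x} → Represents (section 1 v) x → ∀ j {z} →
                      Part D (suc (pair 1 (suc (suc j)))) v z → Near j x z
          part-near {v = v} {x} r j {z} (b , (_ , r′) , agree) = near-tri
            (near-sym (represents-near r (suc j)))
            (subst (λ i → Near (suc j) (dense i) z) (agree (pair 1 (suc (suc j))) ℕ.≤-refl) (represents-near r′ (suc j)))

          -- As the two coded sets are disjoint, the limit points differ, say at scale 2⁻ʲ. Prefixes
          -- that include term j + 3 of both names put the first part inside the ball of radius
          -- 2⁻ʲ⁻¹ around x and the second outside it, against inseparability.
          collide : ∀ {x x′} → C (section 0 w) x × Represents (section 1 w) x →
                    C′ (section 0 w′) x′ × Represents (section 1 w′) x′ → Dec (x ≡ x′) → ⊥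
          collide (c , _) (c′ , _) (yes refl) = disjoint c c′
          collide {x} {x′} (_ , r) (_ , r′) (no x≢x′) = let j , far = ¬∀ (λ h → x≢x′ (near-sep h)) in
            inseparable (suc (pair 1 (suc (suc (suc j))))) (Near (suc j) x , ball-Borel (suc j) x ,
              part-near {C} r (suc j) ,
              λ q near → far (near-tri near (near-sym (part-near {C′} r′ (suc j) q))))

          absurd : ⊥
          absurd = collide (proj₂ (limit {C} cl point)) (proj₂ (limit {C′} cl′ point′)) em

      separate : Separable-by-Borel (λ x → ∃ λ b → C b x) (λ x → ∃ λ b → C′ b x)
      separate = dne λ ns → conclude (branch (start ns))
        where
        conclude : (Σ[ w ∈ Sequence ] Σ[ w′ ∈ Sequence ] (∀ n → ¬ Separable-by-Borel (Part C n w) (Part C′ n w′))) → ⊥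
        conclude (w , w′ , ins) = absurd w w′ ins

        enlarge : ∀ {D : Sequence → Pred X 0ℓ} {v x} → Closed convergence D → ∀ b → D b x → Part D 0 v x
        enlarge {D} {x = x} clD b d = merge pick , (closed-ext {κ = convergence} {D} clD (λ k → sym (section-merge pick 0 k)) d ,
            (λ k → subst₂ (λ i j → Near (suc k) (dense i) (dense j)) (sym (eq₁ k)) (sym (eq₁ (suc k))) (f k)) ,
            (λ j → let N , h = l j in N , λ i N≤i → subst (λ m → Near j (dense m) x) (sym (eq₁ i)) (h i N≤i))) , λ _ ()
          where
          b₁ = proj₁ (representation x)
          pick : ℕ → Sequence
          pick zero    = b
          pick (suc _) = b₁
          f = proj₁ (proj₂ (representation x))
          l = proj₂ (proj₂ (representation x))
          eq₁ : ∀ k → section 1 (merge pick) k ≡ b₁ k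
          eq₁ k = section-merge pick 1 k

        start : ¬ Separable-by-Borel (λ x → ∃ λ b → C b x) (λ x → ∃ λ b → C′ b x) → State 0
        start ns = (λ _ → 0) , (λ _ → 0) , λ (B , mB , P⊆ , Q⊆) → ns (B , mB ,
          (λ { (b , c) → P⊆ (enlarge {C} cl b c) }) , λ { (b , c) → Q⊆ (enlarge {C′} cl′ b c) })

    lusin-separation : ∀ {P Q} → IsAnalytic convergence P → IsAnalytic convergence Q → (∀ {x} → P x → Q x → ⊥) →
                       Separable-by-Borel P Q
    lusin-separation (mkAnalytic C cl P⊆ ⊆P) (mkAnalytic C′ cl′ Q⊆ ⊆Q) disj =
      let B , mB , p , q = separate {C} {C′} cl cl′ (λ c c′ → disj (⊆P (_ , c)) (⊆Q (_ , c′)))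
      in B , mB , (λ x → p (P⊆ x)) , λ x → q (Q⊆ x)

-- Finite lists, and a countable family of Borel labellings

-- Numbers as codes of sequences, among which every finite prefix occurs.
table : ℕ → ℕ → ℕ
table e zero    = proj₁ (unpair e)
table e (suc i) = table (proj₂ (unpair e)) i

table-onto : ∀ m (g : ℕ → ℕ) → Σ[ e ∈ ℕ ] (∀ i → i < m → table e i ≡ g i)
table-onto zero    g = 0 , λ _ ()
table-onto (suc m) g = let e , h = table-onto m (g ∘ suc) in pair (g 0) e , λ
  { zero    _         → cong proj₁ (unpair-pair (g 0) e)
  ; (suc i) (s≤s i<m) → trans (cong (λ p → table (proj₂ p) i) (unpair-pair (g 0) e)) (h i i<m) }

module FiniteLists (em : Classical) where
  open Logic em

  _≟_ : ∀ {a} {A : Set a} (x y : A) → Dec (x ≡ y)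
  x ≟ y = em

  remove : ∀ {a} {A : Set a} → A → List A → List A
  remove x = filter (λ y → em {P = ¬ y ≡ x})

  ∈-remove : ∀ {a} {A : Set a} {x y : A} {ys} → y ∈ˡ ys → ¬ y ≡ x → y ∈ˡ remove x ys
  ∈-remove = ∈-filter⁺ _

  length-remove : ∀ {a} {A : Set a} {x : A} {ys} → x ∈ˡ ys → length (remove x ys) < length ys
  length-remove x∈ys = filter-notAll _ _ (Any.map (λ { refl ne → ne refl }) x∈ys)

  unique-length-≤ : ∀ {a} {A : Set a} {xs ys : List A} → Unique xs → (∀ {x} → x ∈ˡ xs → x ∈ˡ ys) →
                    length xs ≤ length ys
  unique-length-≤ [] _ = z≤n
  unique-length-≤ {xs = x ∷ xs} (x∉xs ∷ uxs) xs⊆ys = ℕ.≤-<-trans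
    (unique-length-≤ uxs λ y∈xs → ∈-remove (xs⊆ys (there y∈xs)) λ { refl → All.lookup x∉xs y∈xs refl })
    (length-remove (xs⊆ys (here refl)))

  numbering : ∀ {A : Set} {xs : List A} → Unique xs →
              Σ[ g ∈ (A → ℕ) ] (∀ i → i < length xs → Σ[ x ∈ A ] x ∈ˡ xs × g x ≡ i)
  numbering [] = (λ _ → 0) , λ _ ()
  numbering {A} {x ∷ xs} (x∉xs ∷ uxs) = g′ , onto
    where
    g = proj₁ (numbering uxs)
    pick : ∀ {y} → Dec (y ≡ x) → ℕ
    pick     (yes _) = length xs
    pick {y} (no _)  = g y
    g′ : A → ℕ
    g′ y = pick (y ≟ x)
    pick-no : ∀ {y} (d : Dec (y ≡ x)) → ¬ y ≡ x → pick d ≡ g y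
    pick-no (yes e) n = contradiction e n
    pick-no (no _)  _ = refl
    pick-yes : ∀ (d : Dec (x ≡ x)) → pick d ≡ length xs
    pick-yes (yes _) = refl
    pick-yes (no n)  = contradiction refl n
    onto : ∀ i → i < suc (length xs) → Σ[ y ∈ A ] y ∈ˡ x ∷ xs × g′ y ≡ i
    onto i i<1+n with ℕ.m≤n⇒m<n∨m≡n (ℕ.s≤s⁻¹ i<1+n)
    ... | inj₂ refl = x , here refl , pick-yes em
    ... | inj₁ i<n with proj₂ (numbering uxs) i i<n
    ... | y , y∈xs , eq = y , there y∈xs , trans (pick-no em λ { refl → All.lookup x∉xs y∈xs refl }) eq

  bound : ∀ {A : Set} (f : A → ℕ) xs → Σ[ m ∈ ℕ ] (∀ {x} → x ∈ˡ xs → f x < m)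
  bound f []       = 0 , λ ()
  bound f (x ∷ xs) = let m , h = bound f xs in suc (f x) ⊔ m , λ
    { (here refl) → ℕ.m≤m⊔n (suc (f x)) m
    ; (there p)   → ℕ.≤-trans (h p) (ℕ.m≤n⊔m (suc (f x)) m) }

  eventually-all : ∀ {A : Set} {P : ℕ → A → Set} xs → (∀ {x} → x ∈ˡ xs → Σ[ j ∈ ℕ ] (∀ k → j ≤ k → P k x)) →
                   Σ[ j ∈ ℕ ] (∀ k → j ≤ k → ∀ {x} → x ∈ˡ xs → P k x)
  eventually-all []       h = 0 , λ _ _ ()
  eventually-all (x ∷ xs) h =
    let j , p = h (here refl) ; j′ , q = eventually-all xs (h ∘ there) in
    j ⊔ j′ , λ { k le (here refl) → p k (ℕ.≤-trans (ℕ.m≤m⊔n j j′) le)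
               ; k le (there m)   → q k (ℕ.≤-trans (ℕ.m≤n⊔m j j′) le) m }

  dedup : ∀ {A : Set} → List A → List A
  dedup = deduplicate _≟_

module LeastIndex (em : Classical) {X : Set} {ℓ : Level} {𝓖 : Pred (Pred X 0ℓ) ℓ} where
  open Logic em
  open Sigma em {𝓖 = 𝓖}

  module _ (S : ℕ → Pred X 0ℓ) where
    private
      pick : ∀ {x} → Dec (Σ[ i ∈ ℕ ] S i x) → ℕ
      pick (yes s) = proj₁ (least s)
      pick (no _)  = 0

      pick-least : ∀ {x} (d : Dec (Σ[ i ∈ ℕ ] S i x)) → Σ[ i ∈ ℕ ] S i x → IsLeast (λ i → S i x) (pick d)
      pick-least (yes s) _ = proj₂ (least s)
      pick-least (no n)  s = contradiction s n

      pick-none : ∀ {x} (d : Dec (Σ[ i ∈ ℕ ] S i x)) → ¬ (Σ[ i ∈ ℕ ] S i x) → pick d ≡ 0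
      pick-none (yes s) n = contradiction s n
      pick-none (no _)  _ = refl

    abstract
      -- The value is 0 at points that lie in no S i.
      leastIndex : X → ℕ
      leastIndex x = pick (em {P = Σ[ i ∈ ℕ ] S i x})

      leastIndex-least : ∀ {x} → Σ[ i ∈ ℕ ] S i x → IsLeast (λ i → S i x) (leastIndex x)
      leastIndex-least = pick-least em

      leastIndex-none : ∀ {x} → ¬ (Σ[ i ∈ ℕ ] S i x) → leastIndex x ≡ 0
      leastIndex-none = pick-none em

    leastIndex-∈ : ∀ {x} → Σ[ i ∈ ℕ ] S i x → S (leastIndex x) x
    leastIndex-∈ = proj₁ ∘ leastIndex-least

    leastIndex-mble : (∀ i → Mble (S i)) → Mbleᶠ leastIndex
    leastIndex-mble mS i = resp (to , from) (∪-mble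
        (∩-mble (mS i) (⋂-mble λ m → →-mble (const-mble (m < i)) (compl (mS m))))
        (∩-mble (const-mble (i ≡ 0)) (compl (union mS))))
      where
      to : ∀ {x} → (IsLeast (λ i → S i x) i) ⊎ (i ≡ 0 × ¬ ⋃ ℕ S x) → leastIndex x ≡ i
      to {x} (inj₁ l) = least-unique {P = λ i → S i x} (leastIndex-least (i , proj₁ l)) l
      to (inj₂ (refl , n)) = leastIndex-none n
      from : ∀ {x} → leastIndex x ≡ i → (IsLeast (λ i → S i x) i) ⊎ (i ≡ 0 × ¬ ⋃ ℕ S x)
      from {x} refl with em {P = ⋃ ℕ S x}
      ... | yes s = inj₁ (leastIndex-least s)
      ... | no ns = inj₂ (leastIndex-none ns , ns)

module Colours (em : Classical) {X : Set} (Ξ : Polish X) where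
  open Logic em
  open FiniteLists em
  open Polish Ξ
  open Analytic em using (module Separation)
  open Separation Ξ using (Borel; ball-Borel)
  open Sigma em {𝓖 = OpenSet}
  open LeastIndex em {𝓖 = OpenSet}

  -- A Borel partition of X into countably many pieces, each inside a ball of radius 2⁻ʲ. For large
  -- j the pieces separate the points of any given finite set.
  cell : ℕ → X → ℕ
  cell j = leastIndex (λ i x → Near j (dense i) x)

  cell-near : ∀ j x → Near j (dense (cell j x)) x
  cell-near j x = leastIndex-∈ (λ i x → Near j (dense i) x) (dense-near x j)

  cell-mble : ∀ j → Mbleᶠ (cell j)
  cell-mble j = leastIndex-mble _ λ i → ball-Borel j (dense i)

  cell-separates : ∀ (ys : List X) → Σ[ j ∈ ℕ ] (∀ {x y} → x ∈ˡ ys → y ∈ˡ ys → cell j x ≡ cell j y → x ≡ y)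
  cell-separates ys =
    let j , h = eventually-all {P = λ k x → ∀ {y} → y ∈ˡ ys → cell k x ≡ cell k y → x ≡ y} ys
                  (λ {x} _ → eventually-all {P = λ k y → cell k x ≡ cell k y → x ≡ y} ys λ {y} _ → two x y)
    in j , λ x∈ y∈ → h j ℕ.≤-refl x∈ y∈
    where
    two : ∀ x y → Σ[ j ∈ ℕ ] (∀ k → j ≤ k → cell k x ≡ cell k y → x ≡ y)
    two x y with em {P = x ≡ y}
    ... | yes e = 0 , λ _ _ _ → e
    ... | no ne with ¬∀ (λ h → ne (near-sep h))
    ... | j , far = suc j , λ k j<k eq → ⊥-elim (far (near-≤ ℕ.≤-refl (near-tri
          (near-sym (near-≤ j<k (cell-near k x)))
          (near-≤ j<k (subst (λ i → Near k (dense i) y) (sym eq) (cell-near k y))))))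

  -- Countably many Borel labellings that restrict to every labelling of every finite set. All later
  -- Borel choices take the first suitable member of this family.
  colour : ℕ → ℕ → X → ℕ
  colour j e x = table e (cell j x)

  colour-mble : ∀ j e → Mbleᶠ (colour j e)
  colour-mble j e i = value-mble (cell-mble j) (λ k → table e k ≡ i)

  colour-prescribed : ∀ (g : X → ℕ) (ys : List X) → Σ[ j ∈ ℕ ] Σ[ e ∈ ℕ ] (∀ {y} → y ∈ˡ ys → colour j e y ≡ g y)
  colour-prescribed g ys = j , e , λ {y} y∈ → trans (onto (cell j y) (below y∈)) (hit y∈ em)
    where
    j = proj₁ (cell-separates ys)
    pick : ∀ {i} → Dec (Σ[ y ∈ X ] y ∈ˡ ys × cell j y ≡ i) → ℕ
    pick (yes (y , _)) = g y
    pick (no _)        = 0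
    m = proj₁ (bound (cell j) ys)
    below : ∀ {y} → y ∈ˡ ys → cell j y < m
    below = proj₂ (bound (cell j) ys)
    e = proj₁ (table-onto m (λ i → pick {i} em))
    onto = proj₂ (table-onto m (λ i → pick {i} em))
    hit : ∀ {y} → y ∈ˡ ys → (d : Dec (Σ[ y′ ∈ X ] y′ ∈ˡ ys × cell j y′ ≡ cell j y)) → pick d ≡ g y
    hit y∈ (yes (y′ , y′∈ , eq)) = cong g (proj₂ (cell-separates ys) y′∈ y∈ eq)
    hit y∈ (no n) = contradiction (_ , y∈ , refl) n

-- Projections of Borel sets with bounded sections

module BoundedSections (em : Classical) {X : Set} (Ξ : Polish X) where
  open Logic em
  open FiniteLists em
  open Polish Ξ
  open Analytic em
  open Separation Ξ
  open Sigma em {𝓖 = OpenSet}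
  open LeastIndex em {𝓖 = OpenSet}
  open Colours em Ξ

  Borel² : Pred (Pred (X × X) 0ℓ) (lsuc 0ℓ)
  Borel² A = A ∈ σ⟨ Rectangle Borel Borel ⟩

  convergence² : Convergence (X × X)
  convergence² = ×-convergence convergence convergence

  Borel²⇒bianalytic : Borel² ⊆ Bianalytic {κ = convergence²}
  Borel²⇒bianalytic = σ-bianalytic rectangle
    where
    left : ∀ {A} → IsAnalytic convergence A → IsAnalytic convergence² (A ∘ proj₁)
    left = preimage-analytic proj₁ proj₁
    right : ∀ {A} → IsAnalytic convergence A → IsAnalytic convergence² (A ∘ proj₂)
    right = preimage-analytic proj₂ proj₂
    rectangle : Rectangle Borel Borel ⊆ Bianalytic {κ = convergence²}
    rectangle {C} (A , B , mA , mB , C⊆ , ⊆C) =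
      let a , a′ = Borel⇒bianalytic mA ; b , b′ = Borel⇒bianalytic mB in
      analytic-resp (⊆C , C⊆) (∩-analytic (left a) (right b)) ,
      analytic-resp ((λ p c → [ (λ n → n (proj₁ (C⊆ c))) , (λ n → n (proj₂ (C⊆ c))) ]′ p) , split)
        (∪-analytic (left a′) (right b′))
      where
      split : ∁ C ⊆ (∁ A ∘ proj₁) ∪ (∁ B ∘ proj₂)
      split {x , y} ¬c with em {P = A x}
      ... | yes p = inj₂ λ q → ¬c (⊆C (p , q))
      ... | no ¬p = inj₁ ¬p

  module _ {Z : Set} {ℓ : Level} {𝓖 : Pred (Pred Z 0ℓ) ℓ} (M : X → Z → Set) (D : Pred X 0ℓ) (mD : Borel D)
           (total : ∀ {x} → D x → ∃ (M x)) (dom : ∀ {x z} → M x z → D x)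
           (functional : ∀ {x z z′} → M x z → M x z′ → z ≡ z′) where

    -- `M` is the graph of a partial function with Borel domain `D`. Preimages under it commute with
    -- countable unions and, relative to `D`, with complements, so it is enough to treat the
    -- generators.
    partial-preimage-Borel : (∀ {A} → 𝓖 A → Borel (λ x → ∃ λ z → M x z × A z)) →
                             ∀ {A} → A ∈ σ⟨ 𝓖 ⟩ → Borel (λ x → ∃ λ z → M x z × A z)
    partial-preimage-Borel g (basic a) = g a
    partial-preimage-Borel g empty = resp ((λ ()) , λ ()) empty
    partial-preimage-Borel g (compl {A} m) = resp (to , from) (∩-mble mD (compl (partial-preimage-Borel g m)))
      where
      to : ∀ {x} → D x × ¬ (∃ λ z → M x z × A z) → ∃ λ z → M x z × ¬ A z
      to (d , n) = let z , p = total d in z , p , λ a → n (z , p , a)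
      from : ∀ {x} → (∃ λ z → M x z × ¬ A z) → D x × ¬ (∃ λ z → M x z × A z)
      from (z , p , ¬a) = dom p , λ (z′ , p′ , a) → ¬a (subst A (functional p′ p) a)
    partial-preimage-Borel g (union m) = resp
      ((λ (n , z , p , a) → z , p , n , a) , λ (z , p , n , a) → n , z , p , a)
      (union λ n → partial-preimage-Borel g (m n))
    partial-preimage-Borel g (resp (A⊆B , B⊆A) m) =
      resp ((λ (z , p , a) → z , p , A⊆B a) , λ (z , p , b) → z , p , B⊆A b) (partial-preimage-Borel g m)

  limit-unique : ∀ {s y z} → s ⟶ y → s ⟶ z → y ≡ z
  limit-unique l l′ = near-sep λ j → let N , h = l (suc j) ; N′ , h′ = l′ (suc j) in
    near-tri (near-sym (h (N ⊔ N′) (ℕ.m≤m⊔n N N′))) (h′ (N ⊔ N′) (ℕ.m≤n⊔m N N′))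

  module LimitFunction (b : X → Sequence) (mb : ∀ k → Mbleᶠ (λ x → b x k)) where

    Domain : Pred X 0ℓ
    Domain x = ∀ k → Near (suc k) (dense (b x k)) (dense (b x (suc k)))

    Domain-Borel : Borel Domain
    Domain-Borel = ⋂-mble λ k → value₂-mble (mb k) (mb (suc k)) (λ i j → Near (suc k) (dense i) (dense j))

    total : ∀ {x} → Domain x → ∃ (Represents (b x))
    total {x} f = let y , lim = complete (dense ∘ b x) (λ j → suc j , λ i k j<i j<k →
                        near-tri (near-sym (fast-near-≤ f j<i)) (fast-near-≤ f j<k))
                  in y , f , lim

    value-Borel : ∀ {A} → Borel A → Borel (λ x → ∃ λ y → Represents (b x) y × A y)
    value-Borel = partial-preimage-Borel (λ x → Represents (b x)) Domain Domain-Borel total proj₁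
      (λ (_ , l) (_ , l′) → limit-unique l l′) open-case
      where
      open-case : ∀ {O} → OpenSet O → Borel (λ x → ∃ λ y → Represents (b x) y × O y)
      -- The limit is in O exactly when for some k the 2⁻ᵏ-ball around term k + 1 of the name lies
      -- in O, as the limit is in that ball. Only terms of `b x` are inspected, and these are Borel
      -- in x.
      open-case {O} o = resp (to , from) (∩-mble Domain-Borel (union λ k → value-mble (mb (suc k)) (Inside k)))
        where
        Inside : ℕ → ℕ → Set
        Inside k i = ∀ {z} → Near k (dense i) z → O z
        to : ∀ {x} → Domain x × (∃ λ k → Inside k (b x (suc k))) → ∃ λ y → Represents (b x) y × O y
        to (d , k , h) = let y , r = total d in y , r , h (represents-near r k)
        from : ∀ {x} → (∃ λ y → Represents (b x) y × O y) → Domain x × (∃ λ k → Inside k (b x (suc k)))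
        from (y , r , q) = let j , h = o q in
          proj₁ r , suc j , λ p → h (near-tri (near-sym (represents-near r (suc j))) p)

    -- This is the preimage of `E` under the partial map sending x to (x , y), for which it suffices
    -- to treat rectangles.
    graph-Borel : ∀ {E} → Borel² E → Borel (λ x → ∃ λ y → Represents (b x) y × E (x , y))
    graph-Borel m = resp
      ((λ { (_ , (refl , r) , e) → _ , r , e }) , λ (y , r , e) → _ , (refl , r) , e)
      (partial-preimage-Borel (λ x (x′ , y) → x ≡ x′ × Represents (b x) y) Domain Domain-Borel
        (λ d → let y , r = total d in _ , refl , r) (λ (_ , r) → proj₁ r)
        (λ { (refl , _ , l) (refl , _ , l′) → cong (_ ,_) (limit-unique l l′) })
        (λ { (A , B , mA , mB , C⊆ , ⊆C) → resp
          ((λ { (a , y , r , c) → _ , (refl , r) , ⊆C (a , c) }) ,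
           (λ { (_ , (refl , r) , c) → proj₁ (C⊆ c) , _ , r , proj₂ (C⊆ c) }))
          (∩-mble mA (value-Borel mB)) })
        m)

  -- A one-valued analytic relation extends to a Borel partial function: its
  -- dyadic approximations are read off Borel sets separating the points whose
  -- value lies in a given ball from those whose value does not.
  uniformise : ∀ {A} → IsAnalytic convergence² A → (∀ {x y y′} → A (x , y) → A (x , y′) → y ≡ y′) →
    Σ[ b ∈ (X → Sequence) ] (∀ k → Mbleᶠ (λ x → b x k)) × (∀ {x y} → A (x , y) → Represents (b x) y)
  uniformise {A} an unique = b , (λ k → leastIndex-mble _ λ i → proj₁ (proj₂ (separator (suc (suc k)) i))) , represents
    where
    separator : ∀ j i → Separable-by-Borel (λ x → ∃ λ y → A (x , y) × Near j (dense i) y)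
                                            (λ x → ∃ λ y → A (x , y) × ¬ Near j (dense i) y)
    separator j i = lusin-separation
      (projection-analytic (∩-analytic an (preimage-analytic proj₂ proj₂ (proj₁ (Borel⇒bianalytic (ball-Borel j (dense i)))))))
      (projection-analytic (∩-analytic an (preimage-analytic proj₂ proj₂ (proj₂ (Borel⇒bianalytic (ball-Borel j (dense i)))))))
      (λ (y , a , p) (y′ , a′ , q) → q (subst (Near j (dense i)) (unique a a′) p))
    C : ℕ → ℕ → Pred X 0ℓ
    C j i = proj₁ (separator j i)
    b : X → Sequence
    b x k = leastIndex (C (suc (suc k))) x
    near : ∀ {x y} → A (x , y) → ∀ k → Near (suc (suc k)) (dense (b x k)) y
    near {x} {y} a k = dne λ far → proj₂ (proj₂ (proj₂ (separator j (b x k)))) (y , a , far)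
        (leastIndex-∈ (C j) (let i , p = dense-near y j in i , proj₁ (proj₂ (proj₂ (separator j i))) (y , a , p)))
      where j = suc (suc k)
    represents : ∀ {x y} → A (x , y) → Represents (b x) y
    represents a = (λ k → near-tri (near a k) (near-sym (near-weaken (near a (suc k))))) ,
      λ j → j , λ i j≤i → near-≤ (ℕ.≤-trans j≤i (ℕ.m≤n+m i 2)) (near a i)

  SectionsBoundedBy : ℕ → Pred (X × X) 0ℓ → Set
  SectionsBoundedBy k E = ∀ x → Σ[ ys ∈ List X ] length ys ≤ k × (∀ {y} → E (x , y) → y ∈ˡ ys)

  Proj : Pred (X × X) 0ℓ → Pred X 0ℓ
  Proj E x = ∃ λ y → E (x , y)

  -- On `A` the set H coincides with the projection of `F`; elsewhere it is only contained in it.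
  -- `A` is merely analytic in the application, so cutting the projection down to `A` would not
  -- visibly give a Borel set.
  BorelApproximation : Pred (X × X) 0ℓ → Pred X 0ℓ → Set₁
  BorelApproximation F A = Σ[ H ∈ Pred X 0ℓ ] Borel H × H ⊆ Proj F × (∀ {x} → A x → Proj F x → H x)

  abstract
    -- Over `A` the relation `F` is one-valued and extends to a Borel partial function. The x at
    -- which the value of that function satisfies `F` form H; they lie in the projection even
    -- outside `A`.
    projection-over-unique : ∀ {F A} → Borel² F → IsAnalytic convergence A →
      (∀ {x y y′} → A x → F (x , y) → F (x , y′) → y ≡ y′) → BorelApproximation F A
    projection-over-unique {F} {A} mF an unique = approx (uniformise
        (∩-analytic (proj₁ (Borel²⇒bianalytic mF)) (preimage-analytic proj₁ proj₁ an))
        (λ (f , a) (f′ , _) → unique a f f′))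
      where
      approx : Σ[ b ∈ (X → Sequence) ] (∀ k → Mbleᶠ (λ x → b x k)) ×
               (∀ {x y} → F (x , y) × A x → Represents (b x) y) → BorelApproximation F A
      approx (b , mb , rep) = (λ x → ∃ λ y → Represents (b x) y × F (x , y)) , LimitFunction.graph-Borel b mb mF ,
        (λ (y , _ , f) → y , f) , λ a (y , f) → y , rep (f , a) , f

  module MaximalSections {E : Pred (X × X) 0ℓ} (mE : Borel² E) {k : ℕ} (bd : SectionsBoundedBy (suc k) E) where
    open Sigma em {𝓖 = Rectangle Borel Borel} using () renaming (∩-mble to ∩-mble²)

    second : ∀ {A} → Borel A → Borel² (A ∘ proj₂)
    second {A} m = basic (U , A , resp ((λ _ → _) , λ _ ()) (compl empty) , m , (λ a → _ , a) , proj₂)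

    first : ∀ {A} → Borel A → Borel² (A ∘ proj₁)
    first {A} m = basic (A , U , m , resp ((λ _ → _) , λ _ ()) (compl empty) , (λ a → a , _) , proj₁)

    Coloured : ℕ → ℕ → ℕ → Pred (X × X) 0ℓ
    Coloured j e i (x , y) = E (x , y) × colour j e y ≡ i

    Coloured-Borel : ∀ j e i → Borel² (Coloured j e i)
    Coloured-Borel j e i = ∩-mble² mE (second (colour-mble j e i))

    -- A colouring that splits E_x into k + 1 classes makes each class a singleton.
    Split : ℕ → ℕ → Pred X 0ℓ
    Split j e x = ∀ i → i < suc k → Proj (Coloured j e i) x

    -- If y ≠ y′ shared a class, the at most k points of the section other than y′ would still meet
    -- all k + 1 classes.
    split-unique : ∀ {j e i x y y′} → Split j e x → i < suc k →
                   Coloured j e i (x , y) → Coloured j e i (x , y′) → y ≡ y′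
    split-unique {j} {e} {i} {x} {y} {y′} s i≤k (ey , cy) (ey′ , cy′) = dne λ y≢y′ →
      ℕ.<-irrefl refl (begin-strict
        k                                             <⟨ ℕ.≤-refl ⟩
        suc k                                         ≡⟨ length-upTo (suc k) ⟨
        length (upTo (suc k))                         ≤⟨ unique-length-≤ (Unique.upTo⁺ (suc k)) (λ i′∈ → covers y≢y′ (∈-upTo⁻ i′∈)) ⟩
        length (map (colour j e) (remove y′ ys))      ≡⟨ length-map (colour j e) (remove y′ ys) ⟩
        length (remove y′ ys)                         ≤⟨ ℕ.s≤s⁻¹ (ℕ.≤-trans (length-remove (cover ey′)) len) ⟩
        k                                             ∎)
      where
      open ℕ.≤-Reasoning
      ys = proj₁ (bd x)
      len = proj₁ (proj₂ (bd x))
      cover : ∀ {y} → E (x , y) → y ∈ˡ ys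
      cover = proj₂ (proj₂ (bd x))
      hit : ∀ {i′ z} → E (x , z) → ¬ z ≡ y′ → colour j e z ≡ i′ → i′ ∈ˡ map (colour j e) (remove y′ ys)
      hit ez ne refl = ∈-map⁺ (colour j e) (∈-remove (cover ez) ne)
      covers : ¬ y ≡ y′ → ∀ {i′} → i′ < suc k → i′ ∈ˡ map (colour j e) (remove y′ ys)
      covers y≢y′ {i′} i′≤k with i′ ℕ.≟ i
      ... | yes refl = hit ey y≢y′ cy
      ... | no i′≢i = let z , ez , cz = s i′ i′≤k in hit ez (λ { refl → i′≢i (trans (sym cz) cy′) }) cz

    Split-analytic : ∀ j e → IsAnalytic convergence (Split j e)
    Split-analytic j e = ⋂-analytic λ i → at i em
      where
      at : ∀ i → Dec (i < suc k) → IsAnalytic convergence (λ x → i < suc k → Proj (Coloured j e i) x)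
      at i (yes lt) = analytic-resp ((λ p _ → p) , λ h → h lt)
                        (projection-analytic (proj₁ (Borel²⇒bianalytic (Coloured-Borel j e i))))
      at i (no ge)  = closed⇒analytic (λ _ _ _ lt → contradiction lt ge)

    -- `Split j e` is the intersection of the projections of the k + 1 classes. Over `Split j e`
    -- each class is one-valued, which gives a Borel set between `Split j e` and the projection of
    -- that class; intersecting these Borel sets leaves exactly `Split j e`.
    Split-Borel : ∀ j e → Borel (Split j e)
    Split-Borel j e = resp
      ((λ h i lt → proj₁ (proj₂ (proj₂ (approx i))) (h i lt)) ,
       (λ s i lt → proj₂ (proj₂ (proj₂ (approx i))) (s , lt) (s i lt)))
      (⋂-mble λ i → →-mble (const-mble (i < suc k)) (proj₁ (proj₂ (approx i))))
      where
      approx : ∀ i → BorelApproximation (Coloured j e i) (λ x → Split j e x × i < suc k)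
      approx i = projection-over-unique (Coloured-Borel j e i)
        (∩-analytic (Split-analytic j e) (closed⇒analytic λ _ _ h → h 0)) (λ (s , lt) → split-unique s lt)

    -- The x whose section attains the bound k + 1: some `colour j e` gives k + 1 points the colours
    -- 0 to k, whereas fewer points cannot inhabit k + 1 classes.
    Maximal : Pred X 0ℓ
    Maximal x = ∃ λ j → ∃ λ e → Split j e x

    Maximal-Borel : Borel Maximal
    Maximal-Borel = union λ j → union λ e → Split-Borel j e

    Rest : Pred (X × X) 0ℓ
    Rest (x , y) = E (x , y) × ¬ Maximal x

    Rest-Borel : Borel² Rest
    Rest-Borel = ∩-mble² mE (first (compl Maximal-Borel))

    Rest-bounded : SectionsBoundedBy k Rest
    Rest-bounded x with em {P = Maximal x}
    ... | yes mx = [] , z≤n , λ (_ , nm) → contradiction mx nm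
    ... | no nm = zs , ℕ.≮⇒≥ (λ k<len → nm (maximal k<len)) ,
                  λ (ey , _) → ∈-filter⁺ _ (∈-deduplicate⁺ _≟_ (proj₂ (proj₂ (bd x)) ey)) ey
      where
      zs = filter (λ y → em {P = E (x , y)}) (dedup (proj₁ (bd x)))
      number = numbering {xs = zs} (Unique.filter⁺ _ (DecUnique.deduplicate-! _≟_ (proj₁ (bd x))))
      maximal : k < length zs → Maximal x
      maximal k<len = let j , e , presc = colour-prescribed (proj₁ number) zs in j , e , λ i i≤k →
        let y , y∈ , eq = proj₂ number i (ℕ.≤-trans i≤k k<len)
        in y , proj₂ (∈-filter⁻ (λ y → em {P = E (x , y)}) {xs = dedup (proj₁ (bd x))} y∈) , trans (presc y∈) eq

    Proj-split : ∀ {x} → Proj E x → Maximal x ⊎ Proj Rest x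
    Proj-split {x} (y , p) with em {P = Maximal x}
    ... | yes m = inj₁ m
    ... | no nm = inj₂ (y , p , nm)

    Proj-join : ∀ {x} → Maximal x ⊎ Proj Rest x → Proj E x
    Proj-join (inj₁ (j , e , s)) = let y , p , _ = s 0 (s≤s z≤n) in y , p
    Proj-join (inj₂ (y , p , _)) = y , p

  projection-Borel : ∀ k {E} → Borel² E → SectionsBoundedBy k E → Borel (Proj E)
  projection-Borel zero {E} mE bd = resp ((λ ()) , λ (y , p) → none p) empty
    where
    none : ∀ {x y} → E (x , y) → ⊥
    none {x} p with bd x
    ... | [] , _ , h = case h p of λ ()
  projection-Borel (suc k) mE bd = resp (Proj-join , Proj-split)
    (∪-mble Maximal-Borel (projection-Borel k Rest-Borel Rest-bounded))
    where open MaximalSections mE bd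

-- Isomorphisms of balls in graphs

private
  variable
    V W Z : Set

reach-mono : ∀ {G : Graph V} {r s u v} → r ≤ s → Reach G r u v → Reach G s u v
reach-mono r≤s       here       = here
reach-mono (s≤s r≤s) (step e p) = step e (reach-mono r≤s p)

reach-trans : ∀ {G : Graph V} {r s u v w} → Reach G r u v → Reach G s v w → Reach G (r + s) u w
reach-trans {r = r} {s} here q = reach-mono (ℕ.m≤n+m s r) q
reach-trans (step e p) q = step e (reach-trans p q)

-- Isomorphisms of balls, given by a pair of maps that need only be meaningful
-- on the balls.
record LocalIso (G : Graph V) (H : Graph W) (v : V) (w : W) (r : ℕ) : Set where
  field
    to        : V → W
    from      : W → V
    to-root   : to v ≡ w
    to-ball   : ∀ {x} → Reach G r v x → Reach H r w (to x)
    from-ball : ∀ {y} → Reach H r w y → Reach G r v (from y)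
    from-to   : ∀ {x} → Reach G r v x → from (to x) ≡ x
    to-from   : ∀ {y} → Reach H r w y → to (from y) ≡ y
    to-adj    : ∀ {x x′} → Reach G r v x → Reach G r v x′ → Adj G x x′ → Adj H (to x) (to x′)
    from-adj  : ∀ {y y′} → Reach H r w y → Reach H r w y′ → Adj H y y′ → Adj G (from y) (from y′)

  PreservesLabels : (V → ℕ) → (W → ℕ) → Set
  PreservesLabels f g = ∀ {x} → Reach G r v x → g (to x) ≡ f x

open LocalIso using (PreservesLabels)

localIso-sym : ∀ {G : Graph V} {H : Graph W} {v w r} → LocalIso G H v w r → LocalIso H G w v r
localIso-sym L = record
  { to = from ; from = to
  ; to-root = trans (cong from (sym to-root)) (from-to here)
  ; to-ball = from-ball ; from-ball = to-ball ; from-to = to-from ; to-from = from-to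
  ; to-adj = from-adj ; from-adj = to-adj }
  where open LocalIso L

labels-sym : ∀ {G : Graph V} {H : Graph W} {v w r} (L : LocalIso G H v w r) {f g} →
             PreservesLabels L f g → PreservesLabels (localIso-sym L) g f
labels-sym L {f} {g} pl {y} b = trans (sym (pl (from-ball b))) (cong g (to-from b))
  where open LocalIso L

localIso-refl : ∀ {G : Graph V} {v r} → LocalIso G G v v r
localIso-refl = record
  { to = id ; from = id ; to-root = refl ; to-ball = id ; from-ball = id
  ; from-to = λ _ → refl ; to-from = λ _ → refl ; to-adj = λ _ _ → id ; from-adj = λ _ _ → id }

module _ {G : Graph V} {H : Graph W} {v w r} (L : LocalIso G H v w r) where
  open LocalIso L

  -- `a` records how far from the root the walk has come, which keeps each of its edges inside the
  -- ball on which `to` preserves adjacency.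
  to-reach : ∀ a t {u x} → Reach G a v u → a + t ≤ r → Reach G t u x → Reach H t (to u) (to x)
  to-reach a t       p le here       = here
  to-reach a (suc t) p le (step e q) = step
    (to-adj (reach-mono (ℕ.≤-trans (ℕ.m≤m+n a (suc t)) le) p)
            (reach-mono (ℕ.≤-trans (s≤s (ℕ.m≤m+n a t)) le′) (reach-snoc p e)) e)
    (to-reach (suc a) t (reach-snoc p e) le′ q)
    where le′ = ℕ.≤-trans (ℕ.≤-reflexive (sym (ℕ.+-suc a t))) le

module _ {G : Graph V} {H : Graph W} {v w r} (L : LocalIso G H v w r) where
  open LocalIso L

  localIso-restrict : ∀ {a t u} → Reach G a v u → a + t ≤ r → LocalIso G H u (to u) t
  localIso-restrict {a} {t} {u} p le = record
    { to = to ; from = from ; to-root = refl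
    ; to-ball = to-reach L a t p le
    ; from-ball = λ {y} q → subst (λ x → Reach G t x (from y)) u≡ (to-reach (localIso-sym L) a t p′ le q)
    ; from-to = from-to ∘ inner ; to-from = to-from ∘ inner′
    ; to-adj = λ q q′ → to-adj (inner q) (inner q′) ; from-adj = λ q q′ → from-adj (inner′ q) (inner′ q′) }
    where
    inner : ∀ {x} → Reach G t u x → Reach G r v x
    inner q = reach-mono le (reach-trans p q)
    u≡ : from (to u) ≡ u
    u≡ = from-to (inner here)
    p′ : Reach H a w (to u)
    p′ = subst (λ y → Reach H a y (to u)) to-root (to-reach L 0 a here (ℕ.≤-trans (ℕ.m≤m+n a t) le) p)
    inner′ : ∀ {y} → Reach H t (to u) y → Reach H r w y
    inner′ q = reach-mono le (reach-trans p′ q)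

module Neighbourhoods (em : Classical) where
  open Logic em
  open FiniteLists em

  -- Excluded middle makes the irrelevant membership proofs of refinement types usable again.
  unsquash : ∀ {ℓ} {A : Set ℓ} → Irrelevant A → A
  unsquash (irr a) = recompute em a

  localIso⇒≅ʳ : ∀ {G : Graph V} {H : Graph W} {v w r} (L : LocalIso G H v w r) {f g} →
                PreservesLabels L f g → ⟦ G , f , v ⟧ r ≅ʳ ⟦ H , g , w ⟧ r
  localIso⇒≅ʳ {G = G} L pl =
    mk↔ₛ′ (λ (x , p) → to x , Irrelevant.map to-ball p) (λ (y , q) → from y , Irrelevant.map from-ball q)
          (λ (y , q) → value-injective (to-from (unsquash q))) (λ (x , p) → value-injective (from-to (unsquash p))) ,
    (λ (x , p) (x′ , p′) → mk⇔ (to-adj (unsquash p) (unsquash p′)) λ e →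
      subst₂ (Adj G) (from-to (unsquash p)) (from-to (unsquash p′))
        (from-adj (to-ball (unsquash p)) (to-ball (unsquash p′)) e)) ,
    (λ (x , p) → pl (unsquash p)) ,
    value-injective to-root
    where open LocalIso L

  record BoundedDegree {V : Set} (G : Graph V) (Δ : ℕ) : Set where
    field
      nbrs        : V → List V
      length-nbrs : ∀ v → length (nbrs v) ≤ Δ
      ∈-nbrs⁺     : ∀ {u v} → Adj G v u → u ∈ˡ nbrs v
      ∈-nbrs⁻     : ∀ {u v} → u ∈ˡ nbrs v → Adj G v u

  finiteMaxDegree⇒bounded : {G : Graph V} → FiniteMaxDegree G → ∃ (BoundedDegree G)
  finiteMaxDegree⇒bounded {G = G} (Δ , deg) = Δ , record
    { nbrs = λ v → map (point v) (allFin _)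
    ; length-nbrs = λ v → ℕ.≤-trans (ℕ.≤-reflexive (trans (length-map (point v) (allFin _)) (length-tabulate id))) (proj₂ (proj₂ (deg v)))
    ; ∈-nbrs⁺ = λ {u} {v} e → let i = Inverse.to (size v) (u , irr e) in
        subst (_∈ˡ map (point v) (allFin _)) (cong value (Inverse.strictlyInverseʳ (size v) (u , irr e))) (∈-map⁺ (point v) (∈-allFin i))
    ; ∈-nbrs⁻ = λ {u} {v} m → let i , _ , eq = ∈-map⁻ (point v) m in
        subst (Adj G v) (sym eq) (unsquash (proof (Inverse.from (size v) i)))
    }
    where
    size : ∀ v → HasSize [ u ∈ _ ∣ Adj G v u ] (proj₁ (deg v))
    size v = proj₁ (proj₂ (deg v))
    point : ∀ v → Fin (proj₁ (deg v)) → _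
    point v i = value (Inverse.from (size v) i)

  module Balls {V : Set} {G : Graph V} {Δ : ℕ} (bd : BoundedDegree G Δ) where
    open BoundedDegree bd

    ball : ℕ → V → List V
    ball zero    v = v ∷ []
    ball (suc r) v = v ∷ concatMap (ball r) (nbrs v)

    ∈-ball⁺ : ∀ {r v u} → Reach G r v u → u ∈ˡ ball r v
    ∈-ball⁺ {zero}  here       = here refl
    ∈-ball⁺ {suc r} here       = here refl
    ∈-ball⁺ {suc r} (step e p) = there (∈-concatMap⁺ (ball r) (Any.map (λ { refl → ∈-ball⁺ p }) (∈-nbrs⁺ e)))

    ∈-ball⁻ : ∀ {r v u} → u ∈ˡ ball r v → Reach G r v u
    ∈-ball⁻ {zero}  (here refl) = here
    ∈-ball⁻ {suc r} (here refl) = here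
    ∈-ball⁻ {suc r} {v} {u} (there m) = via (nbrs v) ∈-nbrs⁻ (∈-concatMap⁻ (ball r) m)
      where
      via : ∀ xs → (∀ {x} → x ∈ˡ xs → Adj G v x) → Any (λ x → u ∈ˡ ball r x) xs → Reach G (suc r) v u
      via (x ∷ xs) adj (here p)  = step (adj (here refl)) (∈-ball⁻ p)
      via (x ∷ xs) adj (there p) = via xs (adj ∘ there) p

    length-ball : ∀ r v → length (ball r v) ≤ suc Δ ^ r
    length-ball zero    v = ℕ.≤-refl
    length-ball (suc r) v = begin
      suc (length (concatMap (ball r) (nbrs v))) ≤⟨ ℕ.+-mono-≤ (ℕ.m^n>0 (suc Δ) r) (each (nbrs v)) ⟩
      suc Δ ^ r + length (nbrs v) * suc Δ ^ r    ≤⟨ ℕ.+-monoʳ-≤ (suc Δ ^ r) (ℕ.*-monoˡ-≤ (suc Δ ^ r) (length-nbrs v)) ⟩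
      suc Δ * suc Δ ^ r                          ∎
      where
      open ℕ.≤-Reasoning
      each : ∀ xs → length (concatMap (ball r) xs) ≤ length xs * suc Δ ^ r
      each []       = z≤n
      each (x ∷ xs) = ℕ.≤-trans (ℕ.≤-reflexive (length-++ (ball r x))) (ℕ.+-mono-≤ (length-ball r x) (each xs))

-- Borel sets given by local conditions

module LocalBorel (em : Classical) {X : Set} (Ξ : Polish X) (G : Graph X) where
  open Logic em
  open FiniteLists em
  open Neighbourhoods em
  open Polish Ξ using (OpenSet)
  open Analytic em using (module Separation)
  open Separation Ξ using (Borel)
  open BoundedSections em Ξ using (Borel²; projection-Borel)
  open Sigma em {𝓖 = OpenSet}
  open Colours em Ξ

  ◇ : ℕ → Pred X 0ℓ → Pred X 0ℓ
  ◇ r A v = ∃ λ u → Reach G r v u × A u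

  N : Pred X 0ℓ → Pred X 0ℓ
  N A v = ∃ λ u → Adj G v u × A u

  module _ {Δ} (bd : BoundedDegree G Δ) (adjBorel : Borel² (uncurry (Adj G))) where
    open BoundedDegree bd
    open Balls bd

    N-Borel : ∀ {A} → Borel A → Borel (N A)
    N-Borel {A} mA = projection-Borel Δ {λ (v , u) → Adj G v u × A u}
      (∩-mble² adjBorel (basic (U , A , resp ((λ _ → _) , λ _ ()) (compl empty) , mA , (λ a → _ , a) , proj₂)))
      (λ v → nbrs v , length-nbrs v , λ (e , _) → ∈-nbrs⁺ e)
      where open Sigma em {𝓖 = Rectangle Borel Borel} using () renaming (∩-mble to ∩-mble²)

    ◇-Borel : ∀ r {A} → Borel A → Borel (◇ r A)
    ◇-Borel zero    mA = resp ((λ a → _ , here , a) , λ { (_ , here , a) → a }) mA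
    ◇-Borel (suc r) {A} mA = resp (to , from) (∪-mble mA (N-Borel (◇-Borel r mA)))
      where
      to : ∀ {v} → A v ⊎ N (◇ r A) v → ◇ (suc r) A v
      to (inj₁ a) = _ , here , a
      to (inj₂ (_ , e , u , p , a)) = u , step e p , a
      from : ∀ {v} → ◇ (suc r) A v → A v ⊎ N (◇ r A) v
      from (_ , here , a) = inj₁ a
      from (u , step e p , a) = inj₂ (_ , e , u , p , a)

    -- The predicates decided by the isomorphism types of labelled balls.
    LocallyInvariant : (X → ℕ) → ℕ → Pred X 0ℓ → Set
    LocallyInvariant f r P = ∀ {v v′} (L : LocalIso G G v v′ r) → PreservesLabels L f f → P v → P v′

    private
      data Query : Set where
        edge labelled : ℕ → ℕ → Query
        rooted        : ℕ → Query

      queries : ℕ → List Query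
      queries m = cartesianProductWith edge (upTo m) (upTo m) ++
                  cartesianProductWith labelled (upTo m) (upTo m) ++ map rooted (upTo m)

    -- On the set where cell j is injective on the ball of radius r + 1, the
    -- isomorphism type of the ball of radius r is given by the colours that
    -- occur in it, together with those of adjacent pairs, and by the labels.
    module _ {f : X → ℕ} (mf : Mbleᶠ f) (r : ℕ) (j m : ℕ) where
      private
        c : X → ℕ
        c = cell j

      Answer : Query → Pred X 0ℓ
      Answer (edge a b)     = ◇ r (λ u → c u ≡ a × N (λ u′ → c u′ ≡ b) u)
      Answer (labelled a k) = ◇ r (λ u → c u ≡ a × f u ≡ k)
      Answer (rooted a) v     = c v ≡ a

      Answer-Borel : ∀ q → Borel (Answer q)
      Answer-Borel (edge a b)     = ◇-Borel r (∩-mble (cell-mble j a) (N-Borel (cell-mble j b)))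
      Answer-Borel (labelled a k) = ◇-Borel r (∩-mble (cell-mble j a) (mf k))
      Answer-Borel (rooted a)       = cell-mble j a

      -- The first condition says that no finer partition distinguishes two vertices of the ball in
      -- the same cell, so that `cell j` is injective there; this form is built from neighbourhoods
      -- of Borel sets. The second leaves finitely many queries. The radius is r + 1 because the
      -- neighbour produced by an `edge` answer may lie just outside the ball of radius r.
      Rigid : Pred X 0ℓ
      Rigid v = (∀ a k b → ◇ (suc r) (λ u → c u ≡ a × cell k u ≡ b) v → ◇ (suc r) (λ u → c u ≡ a × ¬ cell k u ≡ b) v → ⊥)
              × ¬ ◇ (suc r) (λ u → ¬ (c u < m × f u < m)) v

      Rigid-Borel : Borel Rigid
      Rigid-Borel = ∩-mble
        (⋂-mble λ a → ⋂-mble λ k → ⋂-mble λ b → →-mble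
          (◇-Borel (suc r) (∩-mble (cell-mble j a) (cell-mble k b)))
          (compl (◇-Borel (suc r) (∩-mble (cell-mble j a) (compl (cell-mble k b))))))
        (compl (◇-Borel (suc r) (compl (∩-mble (value-mble (cell-mble j) (_< m)) (value-mble mf (_< m))))))

      rigid-injective : ∀ {v u u′} → Rigid v → Reach G (suc r) v u → Reach G (suc r) v u′ → c u ≡ c u′ → u ≡ u′
      rigid-injective {v} {u} {u′} (inj , _) p p′ eq =
        let k , sep = cell-separates (u ∷ u′ ∷ []) in
        sep (here refl) (there (here refl)) (dne λ ne →
          inj (c u) k (cell k u) (u , p , refl , refl) (u′ , p′ , sym eq , λ e → ne (sym e)))

      rigid-bounded : ∀ {v u} → Rigid v → Reach G (suc r) v u → c u < m × f u < m
      rigid-bounded (_ , small) p = dne λ big → small (_ , p , big)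

      private
        pick : ∀ {v u} → Dec (Σ[ u′ ∈ X ] Reach G r v u′ × c u′ ≡ c u) → X
        pick     (yes (u′ , _)) = u′
        pick {v} (no _)         = v

        pick-spec : ∀ {v u} (d : Dec (Σ[ u′ ∈ X ] Reach G r v u′ × c u′ ≡ c u)) →
                    (Σ[ u′ ∈ X ] Reach G r v u′ × c u′ ≡ c u) → Reach G r v (pick d) × c (pick d) ≡ c u
        pick-spec (yes (_ , s)) _ = s
        pick-spec (no n)        s = contradiction s n

        match : X → X → X
        match v u = pick {v} {u} em

        wider : ∀ {v u} → Reach G r v u → Reach G (suc r) v u
        wider = reach-mono (ℕ.n≤1+n r)

        module Match {v v′} (rv : Rigid v) (rv′ : Rigid v′) (ans : ∀ {q} → q ∈ˡ queries m → Answer q v → Answer q v′) where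

          counterpart : ∀ {u} → Reach G r v u → Σ[ u′ ∈ X ] Reach G r v′ u′ × c u′ ≡ c u × f u′ ≡ f u
          counterpart {u} p =
            let c< , f< = rigid-bounded rv (wider p) in
            ans (∈-++⁺ʳ (cartesianProductWith edge (upTo m) (upTo m))
                  (∈-++⁺ˡ (∈-cartesianProductWith⁺ labelled (∈-upTo⁺ c<) (∈-upTo⁺ f<))))
                (u , p , refl , refl)

          match-spec : ∀ {u} → Reach G r v u → Reach G r v′ (match v′ u) × c (match v′ u) ≡ c u
          match-spec {u} p = let u′ , p′ , e , _ = counterpart p in pick-spec {v′} {u} em (u′ , p′ , e)

          match-unique : ∀ {u u′} → Reach G r v u → Reach G (suc r) v′ u′ → c u′ ≡ c u → match v′ u ≡ u′
          match-unique p p′ e = let q , e′ = match-spec p in rigid-injective rv′ (wider q) p′ (trans e′ (sym e))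

          match-label : ∀ {u} → Reach G r v u → f (match v′ u) ≡ f u
          match-label p = let u′ , p′ , e , e′ = counterpart p in trans (cong f (match-unique p (wider p′) e)) e′

          match-root : match v′ v ≡ v′
          match-root = match-unique here here (ans (∈-++⁺ʳ (cartesianProductWith edge (upTo m) (upTo m))
            (∈-++⁺ʳ (cartesianProductWith labelled (upTo m) (upTo m))
              (∈-map⁺ rooted (∈-upTo⁺ (proj₁ (rigid-bounded rv here)))))) refl)

          match-adj : ∀ {u w} → Reach G r v u → Reach G r v w → Adj G u w → Adj G (match v′ u) (match v′ w)
          match-adj {u} {w} p q e =
            let u′ , p′ , cu , w′ , e′ , cw = ans (∈-++⁺ˡ (∈-cartesianProductWith⁺ edge
                    (∈-upTo⁺ (proj₁ (rigid-bounded rv (wider p)))) (∈-upTo⁺ (proj₁ (rigid-bounded rv (wider q))))))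
                  (u , p , refl , w , e , refl)
            in subst₂ (Adj G) (sym (match-unique p (wider p′) cu)) (sym (match-unique q (reach-snoc p′ e′) cw)) e′

      rigid-localIso : ∀ {v v′} → Rigid v → Rigid v′ →
        (∀ {q} → q ∈ˡ queries m → (Answer q v → Answer q v′) × (Answer q v′ → Answer q v)) →
        Σ[ L ∈ LocalIso G G v v′ r ] PreservesLabels L f f
      rigid-localIso {v} {v′} rv rv′ ans = record
        { to = match v′ ; from = match v ; to-root = A.match-root
        ; to-ball = proj₁ ∘ A.match-spec ; from-ball = proj₁ ∘ B.match-spec
        ; from-to = λ p → let q , e = A.match-spec p in B.match-unique q (wider p) (sym e)
        ; to-from = λ p → let q , e = B.match-spec p in A.match-unique q (wider p) (sym e)
        ; to-adj = A.match-adj ; from-adj = B.match-adj } , A.match-label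
        where
        module A = Match rv rv′ (λ q∈ → proj₁ (ans q∈))
        module B = Match rv′ rv (λ q∈ → proj₂ (ans q∈))

    -- Balls are finite, so every v is rigid for some j and m. For each of these countably many
    -- pairs, finitely many Borel answers decide `P` on the rigid vertices.
    locallyInvariant-Borel : ∀ {f r P} → Mbleᶠ f → LocallyInvariant f r P → Borel P
    locallyInvariant-Borel {f} {r} {P} mf inv = resp ((λ (_ , _ , _ , p) → p) , cover)
      (union λ j → union λ m → determined-mble (Answer mf r j m) (Answer-Borel mf r j m) (queries m) (Rigid-Borel mf r j m) P
        λ rv rv′ ans → let L , pl = rigid-localIso mf r j m rv rv′ ans in inv L pl)
      where
      cover : ∀ {v} → P v → ∃ λ j → ∃ λ m → Rigid mf r j m v × P v
      cover {v} p =
        let j , sep = cell-separates (ball (suc r) v)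
            m , small = bound (cell j) (ball (suc r) v)
            m′ , small′ = bound f (ball (suc r) v)
        in j , m ⊔ m′ ,
          ((λ { a k b (u , q , refl , refl) (u′ , q′ , e , ne) →
                ne (cong (cell k) (sep (∈-ball⁺ q′) (∈-ball⁺ q) e)) }) ,
           λ (u , q , big) → big (ℕ.≤-trans (small (∈-ball⁺ q)) (ℕ.m≤m⊔n m m′) ,
                                  ℕ.≤-trans (small′ (∈-ball⁺ q)) (ℕ.m≤n⊔m m m′))) , p

-- Conditional expectations and the local lemma

sumBelow : ℕ → (ℕ → ℕ) → ℕ
sumBelow zero    φ = 0
sumBelow (suc n) φ = φ 0 + sumBelow n (φ ∘ suc)

sumBelow-cong : ∀ n {φ ψ} → (∀ c → φ c ≡ ψ c) → sumBelow n φ ≡ sumBelow n ψ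
sumBelow-cong zero    e = refl
sumBelow-cong (suc n) e = cong₂ _+_ (e 0) (sumBelow-cong n (e ∘ suc))

sumBelow-mono : ∀ n {φ ψ} → (∀ c → φ c ≤ ψ c) → sumBelow n φ ≤ sumBelow n ψ
sumBelow-mono zero    e = z≤n
sumBelow-mono (suc n) e = ℕ.+-mono-≤ (e 0) (sumBelow-mono n (e ∘ suc))

sumBelow-const : ∀ n a → sumBelow n (λ _ → a) ≡ n * a
sumBelow-const zero    a = refl
sumBelow-const (suc n) a = cong (a +_) (sumBelow-const n a)

sumBelow-+ : ∀ n φ ψ → sumBelow n (λ c → φ c + ψ c) ≡ sumBelow n φ + sumBelow n ψ
sumBelow-+ zero    φ ψ = refl
sumBelow-+ (suc n) φ ψ = trans (cong (φ 0 + ψ 0 +_) (sumBelow-+ n (φ ∘ suc) (ψ ∘ suc))) (+-interchange (φ 0) (ψ 0) _ _)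

sumBelow-* : ∀ n a φ → sumBelow n (λ c → a * φ c) ≡ a * sumBelow n φ
sumBelow-* zero    a φ = sym (ℕ.*-zeroʳ a)
sumBelow-* (suc n) a φ = trans (cong (a * φ 0 +_) (sumBelow-* n a (φ ∘ suc))) (sym (ℕ.*-distribˡ-+ a (φ 0) _))

sumBelow-swap : ∀ m n (φ : ℕ → ℕ → ℕ) →
  sumBelow m (λ c → sumBelow n (λ d → φ c d)) ≡ sumBelow n (λ d → sumBelow m (λ c → φ c d))
sumBelow-swap zero    n φ = sym (trans (sumBelow-const n 0) (ℕ.*-zeroʳ n))
sumBelow-swap (suc m) n φ = trans (cong (sumBelow n (φ 0) +_) (sumBelow-swap m n (φ ∘ suc))) (sym (sumBelow-+ n (φ 0) _))

sumBelow-positive : ∀ n φ → 0 < sumBelow n φ → Σ[ c ∈ ℕ ] 0 < φ c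
sumBelow-positive (suc n) φ p = go (φ 0) refl
  where
  go : ∀ a → φ 0 ≡ a → Σ[ c ∈ ℕ ] 0 < φ c
  go zero    e = let c , q = sumBelow-positive n (φ ∘ suc) (subst (λ a → 0 < a + sumBelow n (φ ∘ suc)) e p) in suc c , q
  go (suc a) e = 0 , subst (0 <_) (sym e) (s≤s z≤n)

sumBelow-tabulate : ∀ n φ → sumBelow n φ ≡ sum (tabulate {n = n} (φ ∘ toℕ))
sumBelow-tabulate zero    φ = refl
sumBelow-tabulate (suc n) φ = cong (φ 0 +_) (sumBelow-tabulate n (φ ∘ suc))

words : ∀ ℓ n → List (Vec (Fin ℓ) n)
words ℓ zero    = Vec.[] ∷ []
words ℓ (suc n) = cartesianProductWith Vec._∷_ (allFin ℓ) (words ℓ n)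

∈-words : ∀ {ℓ n} (θ : Vec (Fin ℓ) n) → θ ∈ˡ words ℓ n
∈-words Vec.[]      = here refl
∈-words (c Vec.∷ θ) = ∈-cartesianProductWith⁺ Vec._∷_ (∈-allFin c) (∈-words θ)

words-unique : ∀ ℓ n → Unique (words ℓ n)
words-unique ℓ zero    = [] ∷ []
words-unique ℓ (suc n) = Unique.cartesianProductWith⁺ Vec._∷_ (λ { refl → refl , refl }) (Unique.allFin⁺ ℓ) (words-unique ℓ n)

sum-cartesian : ∀ {A B C : Set} (f : A → B → C) (h : C → ℕ) xs ys →
  sum (map h (cartesianProductWith f xs ys)) ≡ sum (map (λ x → sum (map (λ y → h (f x y)) ys)) xs)
sum-cartesian f h []       ys = refl
sum-cartesian f h (x ∷ xs) ys = begin
  sum (map h (map (f x) ys ++ cartesianProductWith f xs ys))                       ≡⟨ cong sum (map-++ h (map (f x) ys) _) ⟩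
  sum (map h (map (f x) ys) ++ map h (cartesianProductWith f xs ys))               ≡⟨ sum-++ (map h (map (f x) ys)) _ ⟩
  sum (map h (map (f x) ys)) + sum (map h (cartesianProductWith f xs ys))          ≡⟨ cong₂ _+_ (cong sum (sym (map-∘ ys))) (sum-cartesian f h xs ys) ⟩
  sum (map (h ∘ f x) ys) + sum (map (λ x → sum (map (λ y → h (f x y)) ys)) xs)     ∎
  where open ≡-Reasoning

module Assignments (em : Classical) {V : Set} (ℓ : ℕ) where
  open Logic em
  open FiniteLists em

  Assignment : Set
  Assignment = V → ℕ

  update : Assignment → V → ℕ → Assignment
  update g x c y with em {P = y ≡ x}
  ... | yes _ = c
  ... | no _  = g y

  update-same : ∀ g x {c} → update g x c x ≡ c
  update-same g x with em {P = x ≡ x}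
  ... | yes _ = refl
  ... | no ne = contradiction refl ne

  update-other : ∀ g {x y c} → ¬ y ≡ x → update g x c y ≡ g y
  update-other g {x} {y} ne with em {P = y ≡ x}
  ... | yes e = contradiction e ne
  ... | no _  = refl

  Agree : Pred V 0ℓ → Assignment → Assignment → Set
  Agree S g h = ∀ y → S y → g y ≡ h y

  DependsOn : Pred V 0ℓ → (Assignment → ℕ) → Set
  DependsOn S F = ∀ {g h} → Agree S g h → F g ≡ F h

  update-agree : ∀ {S g h} x c → Agree (λ y → S y × ¬ y ≡ x) g h → Agree S (update g x c) (update h x c)
  update-agree {g = g} {h} x c a y s with em {P = y ≡ x}
  ... | yes _ = refl
  ... | no ne = a y (s , ne)

  -- For values below ℓ: the sum of F over all ways to reassign xs, starting
  -- from g.  Divided by ℓ ^ length xs, this is a conditional expectation,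
  -- whether or not xs has repetitions.
  Sum : List V → (Assignment → ℕ) → Assignment → ℕ
  Sum []       F g = F g
  Sum (x ∷ xs) F g = sumBelow ℓ (λ c → Sum xs F (update g x c))

  size : List V → ℕ
  size xs = ℓ ^ length xs

  Sum-mono : ∀ xs {F H} → (∀ g → F g ≤ H g) → ∀ g → Sum xs F g ≤ Sum xs H g
  Sum-mono []       le g = le g
  Sum-mono (x ∷ xs) le g = sumBelow-mono ℓ (λ c → Sum-mono xs le (update g x c))

  Sum-+ : ∀ xs F H g → Sum xs (λ g → F g + H g) g ≡ Sum xs F g + Sum xs H g
  Sum-+ []       F H g = refl
  Sum-+ (x ∷ xs) F H g = trans (sumBelow-cong ℓ (λ c → Sum-+ xs F H (update g x c))) (sumBelow-+ ℓ _ _)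

  Sum-* : ∀ xs a F g → Sum xs (λ g → a * F g) g ≡ a * Sum xs F g
  Sum-* []       a F g = refl
  Sum-* (x ∷ xs) a F g = trans (sumBelow-cong ℓ (λ c → Sum-* xs a F (update g x c))) (sumBelow-* ℓ a _)

  Sum-++ : ∀ xs {ys} F g → Sum (xs ++ ys) F g ≡ Sum xs (Sum ys F) g
  Sum-++ []       F g = refl
  Sum-++ (x ∷ xs) F g = sumBelow-cong ℓ (λ c → Sum-++ xs F (update g x c))

  Sum-depends : ∀ xs {S F} → DependsOn S F → DependsOn (λ y → S y × ¬ y ∈ˡ xs) (Sum xs F)
  Sum-depends []       dep a = dep (λ y s → a y (s , λ ()))
  Sum-depends (x ∷ xs) {S} dep {g} {h} a = sumBelow-cong ℓ λ c → Sum-depends xs dep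
    (update-agree {λ y → S y × ¬ y ∈ˡ xs} {g} {h} x c
      λ { y ((s , n) , ne) → a y (s , λ { (here e) → ne e ; (there m) → n m }) })

  Sum-irrelevant : ∀ xs {S F} → DependsOn S F → (∀ {x} → x ∈ˡ xs → ¬ S x) → ∀ g → Sum xs F g ≡ size xs * F g
  Sum-irrelevant []       dep avoids g = sym (ℕ.*-identityˡ _)
  Sum-irrelevant (x ∷ xs) {S} {F} dep avoids g = begin
    sumBelow ℓ (λ c → Sum xs F (update g x c)) ≡⟨ sumBelow-cong ℓ (λ c → trans (Sum-irrelevant xs dep (avoids ∘ there) _) (cong (size xs *_)
                                                    (dep λ y s → update-other g λ { refl → avoids (here refl) s }))) ⟩
    sumBelow ℓ (λ _ → size xs * F g)           ≡⟨ sumBelow-const ℓ _ ⟩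
    ℓ * (size xs * F g)                        ≡⟨ ℕ.*-assoc ℓ _ _ ⟨
    ℓ * size xs * F g                          ∎
    where open ≡-Reasoning

  Sum-commute₁ : ∀ x ys {S F} → DependsOn S F → ∀ g →
    sumBelow ℓ (λ c → Sum ys F (update g x c)) ≡ Sum ys (λ g → sumBelow ℓ (λ c → F (update g x c))) g
  Sum-commute₁ x []       dep g = refl
  Sum-commute₁ x (y ∷ ys) {S} {F} dep g = trans (exchange em) (sumBelow-cong ℓ (λ d → Sum-commute₁ x ys dep (update g y d)))
    where
    ext : DependsOn U (Sum ys F)
    ext a = Sum-depends ys dep (λ y _ → a y _)
    exchange : Dec (x ≡ y) → sumBelow ℓ (λ c → sumBelow ℓ (λ d → Sum ys F (update (update g x c) y d))) ≡
                             sumBelow ℓ (λ d → sumBelow ℓ (λ c → Sum ys F (update (update g y d) x c)))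
    -- If x = y, both sides are the same double sum up to renaming c and d.
    exchange (yes refl) = sumBelow-cong ℓ λ c → sumBelow-cong ℓ λ d → refl
    exchange (no x≢y) = trans (sumBelow-swap ℓ ℓ _)
      (sumBelow-cong ℓ λ d → sumBelow-cong ℓ λ c → ext λ z _ → swap c d z em em)
      where
      swap : ∀ c d z → Dec (z ≡ x) → Dec (z ≡ y) → update (update g x c) y d z ≡ update (update g y d) x c z
      swap c d z (yes refl) _ = trans (update-other (update g x c) x≢y) (trans (update-same g x) (sym (update-same (update g y d) x)))
      swap c d z (no z≢x) (yes refl) = trans (update-same (update g x c) y)
        (trans (sym (update-same g y)) (sym (update-other (update g y d) z≢x)))
      swap c d z (no z≢x) (no z≢y) = trans (update-other (update g x c) z≢y) (trans (update-other g z≢x)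
        (sym (trans (update-other (update g y d) z≢x) (update-other g z≢y))))

  Sum-commute : ∀ xs ys {S F} → DependsOn S F → ∀ g → Sum xs (Sum ys F) g ≡ Sum ys (Sum xs F) g
  Sum-commute []       ys dep g = refl
  Sum-commute (x ∷ xs) ys dep g = trans (sumBelow-cong ℓ (λ c → Sum-commute xs ys dep (update g x c)))
    (Sum-commute₁ x ys (Sum-depends xs dep) g)

  -- Order, multiplicity and variables outside `S` do not affect an average. Both sides equal the
  -- sum over `xs` and `ys` together: once one list has been summed over, the other is irrelevant.
  Sum-relevant : ∀ xs ys {S F} → DependsOn S F → (∀ {x} → S x → x ∈ˡ xs → x ∈ˡ ys) → (∀ {x} → S x → x ∈ˡ ys → x ∈ˡ xs) →
                 ∀ g → Sum xs F g * size ys ≡ Sum ys F g * size xs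
  Sum-relevant xs ys {S} {F} dep xs⊆ ys⊆ g = begin
    Sum xs F g * size ys ≡⟨ ℕ.*-comm _ (size ys) ⟩
    size ys * Sum xs F g ≡⟨ Sum-irrelevant ys (Sum-depends xs dep) (λ y∈ (s , n) → n (ys⊆ s y∈)) g ⟨
    Sum ys (Sum xs F) g  ≡⟨ Sum-commute xs ys dep g ⟨
    Sum xs (Sum ys F) g  ≡⟨ Sum-irrelevant xs (Sum-depends ys dep) (λ x∈ (s , n) → n (xs⊆ s x∈)) g ⟩
    size xs * Sum ys F g ≡⟨ ℕ.*-comm (size xs) _ ⟩
    Sum ys F g * size xs ∎
    where open ≡-Reasoning

  -- E[F H] = E[F] E[H] with denominators cleared. Each x in the list concerns at most one of the
  -- two factors; the other is constant in x and comes out of the sum.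
  Sum-independent : ∀ xs {S T F H} → DependsOn S F → DependsOn T H → (∀ {x} → x ∈ˡ xs → S x → ¬ T x) →
                    ∀ g → Sum xs (λ g → F g * H g) g * size xs ≡ Sum xs F g * Sum xs H g
  Sum-independent []       depF depH disj g = ℕ.*-identityʳ _
  Sum-independent (x ∷ xs) {S} {T} {F} {H} depF depH disj g = begin
    sumBelow ℓ (λ c → FH c) * (ℓ * size xs)       ≡⟨ *-swapˡ (sumBelow ℓ FH) ℓ (size xs) ⟩
    ℓ * (sumBelow ℓ (λ c → FH c) * size xs)       ≡⟨ cong (ℓ *_) (ℕ.*-comm _ (size xs)) ⟩
    ℓ * (size xs * sumBelow ℓ (λ c → FH c))       ≡⟨ cong (ℓ *_) (sumBelow-* ℓ (size xs) FH) ⟨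
    ℓ * sumBelow ℓ (λ c → size xs * FH c)         ≡⟨ cong (ℓ *_) (sumBelow-cong ℓ λ c → trans (ℕ.*-comm (size xs) (FH c))
                                                       (Sum-independent xs depF depH (disj ∘ there) (update g x c))) ⟩
    ℓ * sumBelow ℓ (λ c → f c * h c)              ≡⟨ split em ⟩
    sumBelow ℓ f * sumBelow ℓ h                   ∎
    where
    open ≡-Reasoning
    f h FH : ℕ → ℕ
    f c = Sum xs F (update g x c)
    h c = Sum xs H (update g x c)
    FH c = Sum xs (λ g → F g * H g) (update g x c)
    constant : ∀ {R K} → DependsOn R K → ¬ R x → ∀ c → Sum xs K (update g x c) ≡ Sum xs K g
    constant dep ¬r c = Sum-depends xs dep λ y (r , _) → update-other g λ { refl → ¬r r }
    split : Dec (S x) → ℓ * sumBelow ℓ (λ c → f c * h c) ≡ sumBelow ℓ f * sumBelow ℓ h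
    split (yes s) = begin
      ℓ * sumBelow ℓ (λ c → f c * h c)       ≡⟨ cong (ℓ *_) (sumBelow-cong ℓ λ c → trans (ℕ.*-comm (f c) (h c)) (cong (_* f c) (constant depH (disj (here refl) s) c))) ⟩
      ℓ * sumBelow ℓ (λ c → Sum xs H g * f c) ≡⟨ cong (ℓ *_) (sumBelow-* ℓ (Sum xs H g) f) ⟩
      ℓ * (Sum xs H g * sumBelow ℓ f)        ≡⟨ ℕ.*-assoc ℓ _ _ ⟨
      ℓ * Sum xs H g * sumBelow ℓ f          ≡⟨ ℕ.*-comm (ℓ * Sum xs H g) _ ⟩
      sumBelow ℓ f * (ℓ * Sum xs H g)        ≡⟨ cong (sumBelow ℓ f *_) (trans (sumBelow-cong ℓ (constant depH (disj (here refl) s))) (sumBelow-const ℓ _)) ⟨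
      sumBelow ℓ f * sumBelow ℓ h            ∎
    split (no ¬s) = begin
      ℓ * sumBelow ℓ (λ c → f c * h c)       ≡⟨ cong (ℓ *_) (sumBelow-cong ℓ λ c → cong (_* h c) (constant depF ¬s c)) ⟩
      ℓ * sumBelow ℓ (λ c → Sum xs F g * h c) ≡⟨ cong (ℓ *_) (sumBelow-* ℓ (Sum xs F g) h) ⟩
      ℓ * (Sum xs F g * sumBelow ℓ h)        ≡⟨ ℕ.*-assoc ℓ _ _ ⟨
      ℓ * Sum xs F g * sumBelow ℓ h          ≡⟨ cong (_* sumBelow ℓ h) (trans (sumBelow-cong ℓ (constant depF ¬s)) (sumBelow-const ℓ _)) ⟨
      sumBelow ℓ f * sumBelow ℓ h            ∎

  Sum-positive : ∀ xs F g → 0 < Sum xs F g → Σ[ h ∈ Assignment ] 0 < F h × (∀ {y} → ¬ y ∈ˡ xs → h y ≡ g y)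
  Sum-positive []       F g p = g , p , λ _ → refl
  Sum-positive (x ∷ xs) F g p =
    let c , q = sumBelow-positive ℓ _ p ; h , r , off = Sum-positive xs F (update g x c) q in
    h , r , λ n → trans (off (n ∘ there)) (update-other g (n ∘ here))

  assign : Assignment → (xs : List V) → Vec (Fin ℓ) (length xs) → Assignment
  assign g []       θ           = g
  assign g (x ∷ xs) (c Vec.∷ θ) = assign (update g x (toℕ c)) xs θ

  Sum-enumerate : ∀ xs F g → Sum xs F g ≡ sum (map (λ θ → F (assign g xs θ)) (words ℓ (length xs)))
  Sum-enumerate []       F g = sym (ℕ.+-identityʳ (F g))
  Sum-enumerate (x ∷ xs) F g = begin
    sumBelow ℓ (λ c → Sum xs F (update g x c))         ≡⟨ sumBelow-cong ℓ (λ c → Sum-enumerate xs F (update g x c)) ⟩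
    sumBelow ℓ φ                                       ≡⟨ sumBelow-tabulate ℓ φ ⟩
    sum (tabulate {n = ℓ} (φ ∘ toℕ))                   ≡⟨ cong sum (map-tabulate {n = ℓ} id (φ ∘ toℕ)) ⟨
    sum (map (φ ∘ toℕ) (allFin ℓ))                     ≡⟨ sum-cartesian Vec._∷_ (λ θ → F (assign g (x ∷ xs) θ)) (allFin ℓ) (words ℓ (length xs)) ⟨
    sum (map (λ θ → F (assign g (x ∷ xs) θ)) (words ℓ (suc (length xs)))) ∎
    where
    open ≡-Reasoning
    φ : ℕ → ℕ
    φ c = sum (map (λ θ → F (assign (update g x c) xs θ)) (words ℓ (length xs)))

  assign-off : ∀ g xs θ {y} → ¬ y ∈ˡ xs → assign g xs θ y ≡ g y
  assign-off g []       θ           n = refl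
  assign-off g (x ∷ xs) (c Vec.∷ θ) n = trans (assign-off (update g x (toℕ c)) xs θ (n ∘ there)) (update-other g (n ∘ here))

  assign-lookup : ∀ g xs → Unique xs → ∀ θ i → assign g xs θ (lookup xs i) ≡ toℕ (Vec.lookup θ i)
  assign-lookup g (x ∷ xs) (x∉ ∷ u) (c Vec.∷ θ) Fin.zero =
    trans (assign-off (update g x (toℕ c)) xs θ (λ m → All.lookup x∉ m refl)) (update-same g x)
  assign-lookup g (x ∷ xs) (x∉ ∷ u) (c Vec.∷ θ) (Fin.suc i) = assign-lookup (update g x (toℕ c)) xs u θ i

  indicate : ∀ {A : Set} → Dec A → ℕ
  indicate (yes _) = 1
  indicate (no _)  = 0

  abstract
    𝟙 : Set → ℕ
    𝟙 A = indicate (em {P = A})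

    𝟙-≤ : ∀ {A} k → (A → 1 ≤ k) → 𝟙 A ≤ k
    𝟙-≤ {A} k h = go em
      where
      go : (d : Dec A) → indicate d ≤ k
      go (yes a) = h a
      go (no _)  = z≤n

    𝟙-yes : ∀ {A} → A → 𝟙 A ≡ 1
    𝟙-yes {A} a = go em
      where
      go : (d : Dec A) → indicate d ≡ 1
      go (yes _) = refl
      go (no n)  = contradiction a n

    𝟙-positive : ∀ {A} → 0 < 𝟙 A → A
    𝟙-positive {A} = go em
      where
      go : (d : Dec A) → 0 < indicate d → A
      go (yes a) _ = a

  𝟙-mono : ∀ {A B} → (A → B) → 𝟙 A ≤ 𝟙 B
  𝟙-mono {A} {B} f = 𝟙-≤ (𝟙 B) λ a → ℕ.≤-reflexive (sym (𝟙-yes (f a)))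

  𝟙-cong : ∀ {A B} → (A → B) → (B → A) → 𝟙 A ≡ 𝟙 B
  𝟙-cong f g = ℕ.≤-antisym (𝟙-mono f) (𝟙-mono g)

  DependsOnᵖ : Pred V 0ℓ → (Assignment → Set) → Set
  DependsOnᵖ S B = ∀ {g h} → Agree S g h → B g → B h

  𝟙-depends : ∀ {S B} → DependsOnᵖ S B → DependsOn S (λ g → 𝟙 (B g))
  𝟙-depends dep a = 𝟙-cong (dep a) (dep λ y s → sym (a y s))

  -- The symmetric Lovász local lemma, for events of probability at most 1 / 4 d, each linked to at
  -- most d of them. Only the labels of `xs` are random, all others being those of `g`; `Prob` is
  -- the probability times `size xs`.
  module LocalLemma {E : Set} (B : E → Assignment → Set) (vars : E → Pred V 0ℓ)
                    (dep : ∀ e → DependsOnᵖ (vars e) (B e)) (xs : List V) (es : List E)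
                    (g : Assignment) (d : ℕ) (d>0 : 0 < d) (ℓ>0 : 0 < ℓ) where
    private
      instance
        size-nonZero : NonZero (size xs)
        size-nonZero = ℕ.m^n≢0 ℓ (length xs) {{>-nonZero ℓ>0}}

    Linked : E → E → Set
    Linked e e′ = ∃ λ x → x ∈ˡ xs × vars e x × vars e′ x

    linked? : ∀ e e′ → Dec (Linked e e′)
    linked? e e′ = em

    unlinked? : ∀ e e′ → Dec (¬ Linked e e′)
    unlinked? e e′ = em

    Avoids : List E → Assignment → Set
    Avoids S h = ∀ e → e ∈ˡ S → ¬ B e h

    Prob : (Assignment → Set) → ℕ
    Prob A = Sum xs (λ h → 𝟙 (A h)) g

    Avoids-depends : ∀ S → DependsOnᵖ (λ x → Σ[ e ∈ E ] e ∈ˡ S × vars e x) (Avoids S)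
    Avoids-depends S a av e e∈ b = av e e∈ (dep e (λ y v → sym (a y (_ , e∈ , v))) b)

    -- P(avoid T) is at most P(avoid S) plus the sum over u in `e` of P(B u and avoid T). If each
    -- summand is at most P(avoid T) / k, the events of `e` cost at most the fraction `length e` / k
    -- of P(avoid T).
    union-bound : ∀ S T e → (∀ {u} → u ∈ˡ S → u ∈ˡ T ⊎ u ∈ˡ e) → ∀ k →
                  (∀ {u} → u ∈ˡ e → k * Prob (λ h → B u h × Avoids T h) ≤ Prob (Avoids T)) →
                  k * Prob (Avoids T) ≤ k * Prob (Avoids S) + length e * Prob (Avoids T)
    union-bound S T e S⊆ k each = ℕ.≤-trans (ℕ.*-monoʳ-≤ k (go S e S⊆))
      (ℕ.≤-trans (ℕ.≤-reflexive (ℕ.*-distribˡ-+ k (Prob (Avoids S)) (total e))) (ℕ.+-monoʳ-≤ _ (bounded e each)))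
      where
      total : List E → ℕ
      total []      = 0
      total (u ∷ e) = Prob (λ h → B u h × Avoids T h) + total e
      bounded : ∀ e → (∀ {u} → u ∈ˡ e → k * Prob (λ h → B u h × Avoids T h) ≤ Prob (Avoids T)) →
                k * total e ≤ length e * Prob (Avoids T)
      bounded []      _ = ℕ.≤-reflexive (ℕ.*-zeroʳ k)
      bounded (u ∷ e) h = ℕ.≤-trans (ℕ.≤-reflexive (ℕ.*-distribˡ-+ k _ (total e)))
        (ℕ.+-mono-≤ (h (here refl)) (bounded e (h ∘ there)))
      go : ∀ S e → (∀ {u} → u ∈ˡ S → u ∈ˡ T ⊎ u ∈ˡ e) → Prob (Avoids T) ≤ Prob (Avoids S) + total e
      go S []      S⊆ = ℕ.≤-trans (Sum-mono xs (λ h → 𝟙-mono λ av v m → [ av v , (λ ()) ]′ (S⊆ m)) g) (ℕ.≤-reflexive (sym (ℕ.+-identityʳ _)))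
      go S (u ∷ e) S⊆ = begin
        Prob (Avoids T)                                                      ≤⟨ go S′ e S′⊆ ⟩
        Prob (Avoids S′) + total e                                           ≤⟨ ℕ.+-monoˡ-≤ (total e) drop ⟩
        Prob (Avoids S) + Prob (λ h → B u h × Avoids T h) + total e          ≡⟨ ℕ.+-assoc (Prob (Avoids S)) _ _ ⟩
        Prob (Avoids S) + (Prob (λ h → B u h × Avoids T h) + total e)        ∎
        where
        open ℕ.≤-Reasoning
        -- S without u. `T` is appended because the event B u is to be paired with avoiding all of
        -- `T`, and `S` may not contain it.
        S′ = filter (λ v → em {P = v ∈ˡ T ⊎ v ∈ˡ e}) S ++ T
        S′⊆ : ∀ {v} → v ∈ˡ S′ → v ∈ˡ T ⊎ v ∈ˡ e
        S′⊆ m = [ (λ m′ → proj₂ (∈-filter⁻ (λ v → em {P = v ∈ˡ T ⊎ v ∈ˡ e}) {xs = S} m′)) , inj₁ ]′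
                  (∈-++⁻ (filter (λ v → em {P = v ∈ˡ T ⊎ v ∈ˡ e}) S) m)
        pointwise : ∀ h → 𝟙 (Avoids S′ h) ≤ 𝟙 (Avoids S h) + 𝟙 (B u h × Avoids T h)
        pointwise h = 𝟙-≤ _ λ av → case em {P = B u h} of λ
          { (yes b) → ℕ.≤-trans (ℕ.≤-reflexive (sym (𝟙-yes (b , λ v m → av v (∈-++⁺ʳ _ m))))) (ℕ.m≤n+m _ _)
          ; (no ¬b) → ℕ.≤-trans (ℕ.≤-reflexive (sym (𝟙-yes λ v m → case S⊆ m of λ
              { (inj₁ t) → av v (∈-++⁺ʳ _ t)
              ; (inj₂ (here refl)) → ¬b
              ; (inj₂ (there i)) → av v (∈-++⁺ˡ (∈-filter⁺ _ m (inj₂ i))) }))) (ℕ.m≤m+n _ _) }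
        drop : Prob (Avoids S′) ≤ Prob (Avoids S) + Prob (λ h → B u h × Avoids T h)
        drop = ℕ.≤-trans (Sum-mono xs pointwise g) (ℕ.≤-reflexive (Sum-+ xs _ _ g))

    module _ (unlikely : ∀ {e} → e ∈ˡ es → 4 * d * Prob (B e) ≤ size xs)
             (few : ∀ {e S} → e ∈ˡ es → Unique S → (∀ {u} → u ∈ˡ S → u ∈ˡ es × Linked e u) → length S ≤ d) where

      independent-bound : ∀ {e T} → e ∈ˡ es → (∀ {u} → u ∈ˡ T → ¬ Linked e u) →
                          4 * d * Prob (λ h → B e h × Avoids T h) ≤ Prob (Avoids T)
      independent-bound {e} {T} e∈ un = ℕ.*-cancelʳ-≤ _ _ (size xs) (begin
        4 * d * Prob (λ h → B e h × Avoids T h) * size xs   ≤⟨ ℕ.*-monoˡ-≤ (size xs) (ℕ.*-monoʳ-≤ (4 * d) (Sum-mono xs product g)) ⟩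
        4 * d * Joint * size xs                            ≡⟨ ℕ.*-assoc (4 * d) Joint (size xs) ⟩
        4 * d * (Joint * size xs)                          ≡⟨ cong (4 * d *_) (Sum-independent xs (𝟙-depends (dep e)) (𝟙-depends (Avoids-depends T))
                                                                (λ x∈ v (u , u∈ , v′) → un u∈ (_ , x∈ , v , v′)) g) ⟩
        4 * d * (Prob (B e) * Prob (Avoids T))             ≡⟨ ℕ.*-assoc (4 * d) (Prob (B e)) (Prob (Avoids T)) ⟨
        4 * d * Prob (B e) * Prob (Avoids T)               ≤⟨ ℕ.*-monoˡ-≤ (Prob (Avoids T)) (unlikely e∈) ⟩
        size xs * Prob (Avoids T)                          ≡⟨ ℕ.*-comm (size xs) _ ⟩
        Prob (Avoids T) * size xs                          ∎)
        where
        open ℕ.≤-Reasoning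
        Joint = Sum xs (λ h → 𝟙 (B e h) * 𝟙 (Avoids T h)) g
        product : ∀ h → 𝟙 (B e h × Avoids T h) ≤ 𝟙 (B e h) * 𝟙 (Avoids T h)
        product h = 𝟙-≤ _ λ (b , av) → ℕ.≤-reflexive (sym (cong₂ _*_ (𝟙-yes b) (𝟙-yes {Avoids T h} av)))

      -- P(B e | avoid S) ≤ 1 / 2 d, by induction on the length of `S`. Given only that the unlinked
      -- events are avoided, B e has probability at most 1 / 4 d by independence. By induction each
      -- of the at most d linked events has conditional probability at most 1 / 2 d, so avoiding
      -- them too at most halves the probability of the condition.
      conditional-bound : ∀ n {S e} → length S < n → Unique S → (∀ {u} → u ∈ˡ S → u ∈ˡ es) → e ∈ˡ es →
                          2 * d * Prob (λ h → B e h × Avoids S h) ≤ Prob (Avoids S)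
      conditional-bound (suc n) {S} {e} len uS S⊆ e∈ = ℕ.*-cancelˡ-≤ 2 (begin
        2 * (2 * d * Prob (λ h → B e h × Avoids S h))     ≡⟨ ℕ.*-assoc 2 (2 * d) _ ⟨
        2 * (2 * d) * Prob (λ h → B e h × Avoids S h)     ≡⟨ cong (_* Prob (λ h → B e h × Avoids S h)) (ℕ.*-assoc 2 2 d) ⟨
        4 * d * Prob (λ h → B e h × Avoids S h)           ≤⟨ ℕ.*-monoʳ-≤ (4 * d) (Sum-mono xs (λ h → 𝟙-mono λ (b , av) → b , λ v m → av v (proj₁ (far⁻ m))) g) ⟩
        4 * d * Prob (λ h → B e h × Avoids far h)         ≤⟨ independent-bound e∈ (λ m → proj₂ (far⁻ m)) ⟩
        Prob (Avoids far)                                 ≤⟨ double ⟩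
        2 * Prob (Avoids S)                               ∎)
        where
        open ℕ.≤-Reasoning
        near = filter (linked? e) S
        far  = filter (unlinked? e) S
        far⁻ : ∀ {u} → u ∈ˡ far → u ∈ˡ S × ¬ Linked e u
        far⁻ = ∈-filter⁻ (unlinked? e) {xs = S}
        near⁻ : ∀ {u} → u ∈ˡ near → u ∈ˡ S × Linked e u
        near⁻ = ∈-filter⁻ (linked? e) {xs = S}
        cover : ∀ {u} → u ∈ˡ S → u ∈ˡ far ⊎ u ∈ˡ near
        cover {u} m = case em {P = Linked e u} of λ
          { (yes l) → inj₂ (∈-filter⁺ (linked? e) m l) ; (no ¬l) → inj₁ (∈-filter⁺ (unlinked? e) m ¬l) }
        each : ∀ {u} → u ∈ˡ near → 2 * d * Prob (λ h → B u h × Avoids far h) ≤ Prob (Avoids far)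
        each {u} m = conditional-bound n
          (ℕ.<-≤-trans (filter-notAll (unlinked? e) S (Any.map (λ { refl ¬l → ¬l (proj₂ (near⁻ m)) }) (proj₁ (near⁻ m)))) (ℕ.s≤s⁻¹ len))
          (Unique.filter⁺ (unlinked? e) uS) (λ m′ → S⊆ (proj₁ (far⁻ m′))) (S⊆ (proj₁ (near⁻ m)))
        few-near : length near ≤ d
        few-near = few e∈ (Unique.filter⁺ (linked? e) uS) (λ m → S⊆ (proj₁ (near⁻ m)) , proj₂ (near⁻ m))
        double : Prob (Avoids far) ≤ 2 * Prob (Avoids S)
        double = ℕ.*-cancelˡ-≤ d {{>-nonZero d>0}} (ℕ.+-cancelʳ-≤ (d * Prob (Avoids far)) _ _ (begin
          d * Prob (Avoids far) + d * Prob (Avoids far)                  ≡⟨ cong (d * Prob (Avoids far) +_) (ℕ.+-identityʳ _) ⟨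
          2 * (d * Prob (Avoids far))                                    ≡⟨ ℕ.*-assoc 2 d _ ⟨
          2 * d * Prob (Avoids far)                                      ≤⟨ union-bound S far near cover (2 * d) each ⟩
          2 * d * Prob (Avoids S) + length near * Prob (Avoids far)      ≤⟨ ℕ.+-monoʳ-≤ (2 * d * Prob (Avoids S)) (ℕ.*-monoˡ-≤ (Prob (Avoids far)) few-near) ⟩
          2 * d * Prob (Avoids S) + d * Prob (Avoids far)                ≡⟨ cong (_+ d * Prob (Avoids far)) (trans (cong (_* Prob (Avoids S)) (ℕ.*-comm 2 d)) (ℕ.*-assoc d 2 _)) ⟩
          d * (2 * Prob (Avoids S)) + d * Prob (Avoids far)              ∎))

      -- Each further event to be avoided takes away at most the fraction 1 / 2 d < 1 of a positive
      -- probability.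
      avoid-positive : ∀ S → Unique S → (∀ {u} → u ∈ˡ S → u ∈ˡ es) → 0 < Prob (Avoids S)
      avoid-positive [] _ _ = begin-strict
        0                                       <⟨ ℕ.m^n>0 ℓ {{>-nonZero ℓ>0}} (length xs) ⟩
        size xs                                 ≡⟨ ℕ.*-identityʳ _ ⟨
        size xs * 1                             ≡⟨ Sum-irrelevant xs {λ _ → ⊥} {λ _ → 1} (λ _ → refl) (λ _ ()) g ⟨
        Sum xs (λ _ → 1) g                      ≤⟨ Sum-mono xs (λ h → ℕ.≤-reflexive (sym (𝟙-yes {Avoids [] h} λ _ ()))) g ⟩
        Prob (Avoids [])                        ∎
        where open ℕ.≤-Reasoning
      avoid-positive (e ∷ S) (e∉S ∷ uS) S⊆ = ℕ.≰⇒> λ zero≥ → ℕ.<-irrefl refl (begin-strict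
        1 * p                                   <⟨ ℕ.*-monoˡ-< p {{>-nonZero positive}} (ℕ.<-≤-trans (s≤s d>0) (ℕ.+-monoʳ-≤ 1 (ℕ.≤-refl {d}))) ⟩
        (1 + d) * p                             ≤⟨ ℕ.*-monoˡ-≤ p (ℕ.≤-trans (ℕ.+-monoˡ-≤ d d>0) (ℕ.≤-reflexive (cong (d +_) (sym (ℕ.+-identityʳ d))))) ⟩
        2 * d * p                               ≤⟨ union-bound (e ∷ S) S (e ∷ []) (λ { (here refl) → inj₂ (here refl) ; (there m) → inj₁ m }) (2 * d)
                                                     (λ { (here refl) → conditional-bound (suc (length S)) ℕ.≤-refl uS (S⊆ ∘ there) (S⊆ (here refl)) }) ⟩
        2 * d * Prob (Avoids (e ∷ S)) + 1 * p   ≡⟨ cong (λ q → 2 * d * q + 1 * p) (ℕ.n≤0⇒n≡0 zero≥) ⟩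
        2 * d * 0 + 1 * p                       ≡⟨ cong (_+ 1 * p) (ℕ.*-zeroʳ (2 * d)) ⟩
        1 * p                                   ∎)
        where
        open ℕ.≤-Reasoning
        p = Prob (Avoids S)
        positive : 0 < p
        positive = avoid-positive S uS (S⊆ ∘ there)

      local-lemma : Unique es → Σ[ h ∈ Assignment ] (∀ {y} → ¬ y ∈ˡ xs → h y ≡ g y) × Avoids es h
      local-lemma u = let h , p , off = Sum-positive xs _ g (avoid-positive es u id) in h , off , 𝟙-positive p

  -- The conditional expectation of F given the values outside xs is at most q / n.
  Expects : ℕ → ℕ → List V → (Assignment → ℕ) → Assignment → Set
  Expects n q xs F g = n * Sum xs F g ≤ q * size xs

  expects-relevant : 0 < ℓ → ∀ {n q} xs ys {S F} → DependsOn S F →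
    (∀ {x} → S x → x ∈ˡ xs → x ∈ˡ ys) → (∀ {x} → S x → x ∈ˡ ys → x ∈ˡ xs) →
    ∀ {g} → Expects n q xs F g → Expects n q ys F g
  expects-relevant ℓ>0 {n} {q} xs ys {F = F} dep xs⊆ ys⊆ {g} le = ℕ.*-cancelʳ-≤ _ _ (size xs) {{nz}} (begin
    n * Sum ys F g * size xs   ≡⟨ ℕ.*-assoc n _ _ ⟩
    n * (Sum ys F g * size xs) ≡⟨ cong (n *_) (Sum-relevant xs ys dep xs⊆ ys⊆ g) ⟨
    n * (Sum xs F g * size ys) ≡⟨ ℕ.*-assoc n _ _ ⟨
    n * Sum xs F g * size ys   ≤⟨ ℕ.*-monoˡ-≤ (size ys) le ⟩
    q * size xs * size ys      ≡⟨ *-swapʳ q (size xs) (size ys) ⟩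
    q * size ys * size xs      ∎)
    where
    open ℕ.≤-Reasoning
    nz : NonZero (size xs)
    nz = ℕ.m^n≢0 ℓ (length xs) {{>-nonZero ℓ>0}}

  -- By Markov's inequality, for each e the conditional expectation exceeds
  -- 4 d q / n with probability at most 1 / 4 d; the local lemma avoids all of
  -- these events at once.
  fix-variables : 0 < ℓ → ∀ {n q d} → 0 < q → 0 < d → {E : Set} (B : E → Assignment → Set) (vars : E → Pred V 0ℓ) →
    (∀ e → DependsOnᵖ (vars e) (B e)) → (xs : List V) (es : List E) → Unique es →
    (∀ {e S} → e ∈ˡ es → Unique S → (∀ {u} → u ∈ˡ S → ∃ λ x → vars e x × vars u x) → length S ≤ d) →
    (before after : E → List V) →
    (∀ {e x} → e ∈ˡ es → vars e x → x ∈ˡ before e → x ∈ˡ xs ⊎ x ∈ˡ after e) →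
    (∀ {e x} → e ∈ˡ es → vars e x → x ∈ˡ xs ⊎ x ∈ˡ after e → x ∈ˡ before e) →
    ∀ g → (∀ {e} → e ∈ˡ es → Expects n q (before e) (λ h → 𝟙 (B e h)) g) →
    Σ[ h ∈ Assignment ] (∀ {y} → ¬ y ∈ˡ xs → h y ≡ g y) ×
                        (∀ {e} → e ∈ˡ es → Expects n (4 * d * q) (after e) (λ h → 𝟙 (B e h)) h)
  fix-variables ℓ>0 {n} {q} {d} q>0 d>0 {E} B vars dep xs es ues few before after b⊆ ⊆b g exp =
    let h , off , avoid = LL.local-lemma unlikely (λ e∈ uS S⊆ → few e∈ uS (λ m → let x , _ , p = proj₂ (S⊆ m) in x , p)) ues
    in h , off , λ e∈ → ℕ.≮⇒≥ (avoid _ e∈)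
    where
    open ℕ.≤-Reasoning
    rest : E → Assignment → ℕ
    rest e = Sum (after e) (λ h → 𝟙 (B e h))
    Exceeds : E → Assignment → Set
    Exceeds e h = 4 * d * q * size (after e) < n * rest e h
    Exceeds-depends : ∀ e → DependsOnᵖ (vars e) (Exceeds e)
    Exceeds-depends e a lt = subst (λ s → 4 * d * q * size (after e) < n * s)
      (Sum-depends (after e) (𝟙-depends (dep e)) (λ y (v , _) → a y v)) lt
    module LL = LocalLemma Exceeds vars Exceeds-depends xs es g d d>0 ℓ>0
    unlikely : ∀ {e} → e ∈ˡ es → 4 * d * LL.Prob (Exceeds e) ≤ size xs
    unlikely {e} e∈ = ℕ.*-cancelʳ-≤ _ _ (q * size (after e)) {{ℕ.m*n≢0 q (size (after e)) {{>-nonZero q>0}} {{ℕ.m^n≢0 ℓ (length (after e)) {{>-nonZero ℓ>0}}}}}} (begin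
      4 * d * LL.Prob (Exceeds e) * (q * size (after e))        ≡⟨ *-swapʳ (4 * d) (LL.Prob (Exceeds e)) (q * size (after e)) ⟩
      4 * d * (q * size (after e)) * LL.Prob (Exceeds e)        ≡⟨ cong (_* LL.Prob (Exceeds e)) (ℕ.*-assoc (4 * d) q _) ⟨
      4 * d * q * size (after e) * LL.Prob (Exceeds e)          ≡⟨ Sum-* xs (4 * d * q * size (after e)) _ g ⟨
      Sum xs (λ h → 4 * d * q * size (after e) * 𝟙 (Exceeds e h)) g ≤⟨ Sum-mono xs markov g ⟩
      Sum xs (λ h → n * rest e h) g                             ≡⟨ Sum-* xs n (rest e) g ⟩
      n * Sum xs (rest e) g                                     ≡⟨ cong (n *_) (Sum-++ xs _ g) ⟨
      n * Sum (xs ++ after e) (λ h → 𝟙 (B e h)) g               ≤⟨ expects-relevant ℓ>0 {n} {q} (before e) (xs ++ after e) (𝟙-depends (dep e))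
                                                                     (λ v m → [ ∈-++⁺ˡ , ∈-++⁺ʳ xs ]′ (b⊆ e∈ v m)) (λ v m → ⊆b e∈ v (∈-++⁻ xs m)) (exp e∈) ⟩
      q * ℓ ^ length (xs ++ after e)                            ≡⟨ cong (λ k → q * ℓ ^ k) (length-++ xs) ⟩
      q * ℓ ^ (length xs + length (after e))                    ≡⟨ cong (q *_) (ℕ.^-distribˡ-+-* ℓ (length xs) (length (after e))) ⟩
      q * (size xs * size (after e))                            ≡⟨ *-swapˡ q (size xs) (size (after e)) ⟩
      size xs * (q * size (after e))                            ∎)
      where
      markov : ∀ h → 4 * d * q * size (after e) * 𝟙 (Exceeds e h) ≤ n * rest e h
      markov h = case em {P = Exceeds e h} of λ
        { (yes ex) → ℕ.≤-trans (ℕ.≤-reflexive (trans (cong (4 * d * q * size (after e) *_) (𝟙-yes ex)) (ℕ.*-identityʳ _))) (ℕ.<⇒≤ ex)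
        ; (no n) → ℕ.≤-trans (ℕ.*-monoʳ-≤ (4 * d * q * size (after e)) (𝟙-≤ 0 λ ex → contradiction ex n))
                     (ℕ.≤-trans (ℕ.≤-reflexive (ℕ.*-zeroʳ (4 * d * q * size (after e)))) z≤n) }

-- LOCAL algorithms

≅ʳ-sym : {K : RootedLabeledGraph V} {L : RootedLabeledGraph W} → K ≅ʳ L → L ≅ʳ K
≅ʳ-sym {K = K} {L} (φ , adj , lab , rt) = ↔-sym φ ,
  (λ u v → mk⇔
    (λ e → Equivalence.from (adj (from u) (from v)) (subst₂ (Adj (graph L)) (sym (strictlyInverseˡ u)) (sym (strictlyInverseˡ v)) e))
    (λ e → subst₂ (Adj (graph L)) (strictlyInverseˡ u) (strictlyInverseˡ v) (Equivalence.to (adj (from u) (from v)) e))) ,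
  (λ v → trans (sym (lab (from v))) (cong (label L) (strictlyInverseˡ v))) ,
  trans (cong from (sym rt)) (strictlyInverseʳ (root K))
  where open Inverse φ

≅ʳ-trans : {K : RootedLabeledGraph V} {L : RootedLabeledGraph W} {M : RootedLabeledGraph Z} → K ≅ʳ L → L ≅ʳ M → K ≅ʳ M
≅ʳ-trans (φ , adj , lab , rt) (ψ , adj′ , lab′ , rt′) = ↔-trans φ ψ ,
  (λ u v → mk⇔ (λ e → Equivalence.to (adj′ _ _) (Equivalence.to (adj u v) e))
               (λ e → Equivalence.from (adj u v) (Equivalence.from (adj′ _ _) e))) ,
  (λ v → trans (lab′ _) (lab v)) , trans (cong (Inverse.to ψ) rt) rt′

pullback : (K : RootedLabeledGraph W) → V ↔ W → RootedLabeledGraph V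
pullback K φ = record
  { graph = record { Adj = λ u v → Adj (graph K) (to u) (to v) ; symm = symm (graph K) ; irrefl = irrefl (graph K) }
  ; label = label K ∘ to
  ; root  = from (root K) }
  where open Inverse φ

pullback-≅ʳ : (K : RootedLabeledGraph W) (φ : V ↔ W) → pullback K φ ≅ʳ K
pullback-≅ʳ K φ = φ , (λ u v → mk⇔ id id) , (λ v → refl) , Inverse.strictlyInverseˡ φ (root K)

at-≅ʳ : {A : Set} (F : LocalMap A) (K : RootedLabeledGraph V) (L : RootedLabeledGraph W) {b : A} →
        K ≅ʳ L → F at K Is b → F at L Is b
at-≅ʳ F K L K≅L (n , M , M≅K , e) = n , M , ≅ʳ-trans {K = M} {K} {L} M≅K K≅L , e

at-unique : {A : Set} (F : LocalMap A) (K : RootedLabeledGraph V) {b b′ : A} → F at K Is b → F at K Is b′ → b ≡ b′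
at-unique F K (_ , M , M≅K , e) (_ , M′ , M′≅K , e′) =
  trans (sym e) (trans (LocalMap.invariant F (≅ʳ-trans {K = M} {K} {M′} M≅K (≅ʳ-sym {K = M′} {K} M′≅K))) e′)

lookup-injective : ∀ {xs : List V} → Unique xs → ∀ i j → lookup xs i ≡ lookup xs j → i ≡ j
lookup-injective (x∉ ∷ u) Fin.zero    Fin.zero    e = refl
lookup-injective (x∉ ∷ u) Fin.zero    (Fin.suc j) e = contradiction e (All.lookup x∉ (∈-lookup j))
lookup-injective (x∉ ∷ u) (Fin.suc i) Fin.zero    e = contradiction (sym e) (All.lookup x∉ (∈-lookup i))
lookup-injective (x∉ ∷ u) (Fin.suc i) (Fin.suc j) e = cong Fin.suc (lookup-injective u i j e)

index-lookup : ∀ {xs : List V} → Unique xs → ∀ i (p : lookup xs i ∈ˡ xs) → Any.index p ≡ i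
index-lookup u i p = lookup-injective u _ _ (sym (lookup-index p))

module Listings (em : Classical) where
  open Logic em
  open FiniteLists em
  open Neighbourhoods em

  listing : ∀ {xs : List V} → Unique xs → (B : Pred V 0ℓ) → (∀ {x} → B x → x ∈ˡ xs) → (∀ {x} → x ∈ˡ xs → B x) →
            Fin (length xs) ↔ [ x ∈ V ∣ B x ]
  listing {xs = xs} u B B⊆ ⊆B = mk↔ₛ′
    (λ i → lookup xs i , irr (⊆B (∈-lookup i)))
    (λ (x , p) → Any.index (B⊆ (unsquash p)))
    (λ (x , p) → value-injective (sym (lookup-index (B⊆ (unsquash p)))))
    (λ i → index-lookup u i _)

  module Listed (G : Graph V) {xs : List V} (uxs : Unique xs) where
    H : Graph (Fin (length xs))
    H = record { Adj = λ i j → Adj G (lookup xs i) (lookup xs j) ; symm = symm G ; irrefl = irrefl G }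

    H≅induced : H ≅ induced G (_∈ˡ xs)
    H≅induced = listing uxs (_∈ˡ xs) id id , λ i j → mk⇔ id id

    module _ (i : Fin (length xs)) where
      private
        pick : ∀ {y} → Dec (y ∈ˡ xs) → Fin (length xs)
        pick (yes p) = Any.index p
        pick (no _)  = i

        pick-lookup : ∀ {y} (d : Dec (y ∈ˡ xs)) → y ∈ˡ xs → lookup xs (pick d) ≡ y
        pick-lookup (yes p) _ = sym (lookup-index p)
        pick-lookup (no n)  p = contradiction p n

      position : V → Fin (length xs)
      position y = pick (em {P = y ∈ˡ xs})

      lookup-position : ∀ {y} → y ∈ˡ xs → lookup xs (position y) ≡ y
      lookup-position = pick-lookup em

      position-lookup : ∀ j → position (lookup xs j) ≡ j
      position-lookup j = lookup-injective uxs _ _ (lookup-position (∈-lookup j))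

      reach-lookup : ∀ {r j k} → Reach H r j k → Reach G r (lookup xs j) (lookup xs k)
      reach-lookup here       = here
      reach-lookup (step e p) = step e (reach-lookup p)

      reach-position : ∀ {r u y} → (∀ {z} → Reach G r u z → z ∈ˡ xs) → Reach G r u y → Reach H r (position u) (position y)
      reach-position in-xs here       = here
      reach-position in-xs (step e p) = step
        (subst₂ (Adj G) (sym (lookup-position (in-xs here))) (sym (lookup-position (in-xs (step e here)))) e)
        (reach-position (in-xs ∘ step e) p)

      listed-localIso : ∀ {r} → (∀ {z} → Reach G r (lookup xs i) z → z ∈ˡ xs) → LocalIso H G i (lookup xs i) r
      listed-localIso {r} in-xs = record
        { to = lookup xs ; from = position ; to-root = refl
        ; to-ball = reach-lookup
        ; from-ball = λ {y} q → subst (λ j → Reach H r j (position y)) (position-lookup i) (reach-position in-xs q)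
        ; from-to = λ {x} _ → position-lookup x
        ; to-from = λ q → lookup-position (in-xs q)
        ; to-adj = λ _ _ e → e
        ; from-adj = λ q q′ e → subst₂ (Adj G) (sym (lookup-position (in-xs q))) (sym (lookup-position (in-xs q′))) e }

  finite-bounded : ∀ {n} (H : Graph (Fin n)) → BoundedDegree H n
  finite-bounded {n} H = record
    { nbrs = λ v → filter (λ u → em {P = Adj H v u}) (allFin n)
    ; length-nbrs = λ v → ℕ.≤-trans (length-filter (λ u → em {P = Adj H v u}) (allFin n)) (ℕ.≤-reflexive (length-tabulate id))
    ; ∈-nbrs⁺ = λ {u} {v} e → ∈-filter⁺ (λ u → em {P = Adj H v u}) (∈-allFin u) e
    ; ∈-nbrs⁻ = λ {u} {v} m → proj₂ (∈-filter⁻ (λ u → em {P = Adj H v u}) {xs = allFin n} m) }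

  module Locality (Π : LCL) (𝒜 : LocalAlgorithm) (T : ℕ) where
    R = radius Π

    abstract
      -- The algorithm is evaluated on a copy of the ball with vertices in some `Fin k`, which the
      -- degree bound makes available; by invariance the value is the same for every copy.
      output : ∀ {V} {G : Graph V} {Δ} → BoundedDegree G Δ → (V → ℕ) → V → ℕ
      output-spec : ∀ {V} {G : Graph V} {Δ} (bd : BoundedDegree G Δ) g v → 𝒜 at ⟦ G , g , v ⟧ T Is output bd g v

      private
        run : ∀ {V} {G : Graph V} {Δ} → BoundedDegree G Δ → (g : V → ℕ) (v : V) → Σ[ k ∈ ℕ ] 𝒜 at ⟦ G , g , v ⟧ T Is k
        run {G = G} bd g v = eval 𝒜 (pullback K φ) , length (dedup (ball T v)) , pullback K φ , pullback-≅ʳ K φ , refl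
          where
          open Balls bd
          K : RootedLabeledGraph [ u ∈ _ ∣ Ball G v T u ]
          K = ⟦ G , g , v ⟧ T
          φ : Fin (length (dedup (ball T v))) ↔ [ u ∈ _ ∣ Ball G v T u ]
          φ = listing (DecUnique.deduplicate-! _≟_ (ball T v)) (Ball G v T)
                (λ p → ∈-deduplicate⁺ _≟_ (∈-ball⁺ p)) (λ m → ∈-ball⁻ (∈-deduplicate⁻ _≟_ (ball T v) m))

      output bd g v = proj₁ (run bd g v)
      output-spec bd g v = proj₂ (run bd g v)

    Accepts : ∀ {V} {G : Graph V} {Δ} → BoundedDegree G Δ → V → (V → ℕ) → Set₁
    Accepts {G = G} bd v g = accept Π at ⟦ G , output bd g , v ⟧ R Is true

    output-local : ∀ {V W} {G : Graph V} {H : Graph W} {Δ Δ′} (bd : BoundedDegree G Δ) (bd′ : BoundedDegree H Δ′) {v w}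
      (L : LocalIso G H v w T) {g h} → PreservesLabels L g h → output bd′ h w ≡ output bd g v
    output-local {G = G} {H} bd bd′ {v} {w} L {g} {h} pl =
      at-unique 𝒜 (⟦ H , h , w ⟧ T) (output-spec bd′ h w)
        (at-≅ʳ 𝒜 (⟦ G , g , v ⟧ T) (⟦ H , h , w ⟧ T) (localIso⇒≅ʳ L {g} {h} pl) (output-spec bd g v))

    -- The verdict at v involves the outputs within distance R, and each of these the labels within
    -- a further distance T.
    accepts-local : ∀ {V W} {G : Graph V} {H : Graph W} {Δ Δ′} (bd : BoundedDegree G Δ) (bd′ : BoundedDegree H Δ′) {v w}
      (L : LocalIso G H v w (R + T)) {g h} → PreservesLabels L g h → Accepts bd v g → Accepts bd′ w h
    accepts-local {G = G} {H} bd bd′ {v} {w} L {g} {h} pl =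
      at-≅ʳ (accept Π) (⟦ G , output bd g , v ⟧ R) (⟦ H , output bd′ h , w ⟧ R) (localIso⇒≅ʳ L′ {output bd g} {output bd′ h} outputs)
      where
      open LocalIso L using (to; to-root)
      L′ : LocalIso G H v w R
      L′ = subst (λ y → LocalIso G H v y R) to-root (localIso-restrict L here (ℕ.m≤m+n R T))
      to≡ : ∀ {y} (e : to v ≡ y) x → LocalIso.to (subst (λ y → LocalIso G H v y R) e (localIso-restrict L here (ℕ.m≤m+n R T))) x ≡ to x
      to≡ refl x = refl
      outputs : PreservesLabels L′ (output bd g) (output bd′ h)
      outputs {x} p = trans (cong (output bd′ h) (to≡ to-root x))
        (output-local bd bd′ (localIso-restrict L p ℕ.≤-refl) (λ q → pl (reach-trans p q)))

    Fails : ∀ {V} {G : Graph V} {Δ} → BoundedDegree G Δ → V → (V → ℕ) → Set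
    Fails bd v g = ¬ ⟪ Accepts bd v g ⟫

    fails-local : ∀ {V W} {G : Graph V} {H : Graph W} {Δ Δ′} (bd : BoundedDegree G Δ) (bd′ : BoundedDegree H Δ′) {v w}
      (L : LocalIso G H v w (R + T)) {g h} → PreservesLabels L g h → Fails bd v g → Fails bd′ w h
    fails-local bd bd′ L pl f a = f (into (accepts-local bd′ bd (localIso-sym L) (labels-sym L pl) (out a)))

    succeeds⇒accepts : ∀ {V} {G : Graph V} {Δ} (bd : BoundedDegree G Δ) {g} → Succeeds Π 𝒜 T G g → ∀ v → Accepts bd v g
    succeeds⇒accepts {G = G} bd {g} (f , run , col) v =
      at-≅ʳ (accept Π) (⟦ G , f , v ⟧ R) (⟦ G , output bd g , v ⟧ R)
        (localIso⇒≅ʳ localIso-refl {f} {output bd g} (λ {x} _ → at-unique 𝒜 (⟦ G , g , x ⟧ T) (output-spec bd g x) (run x))) (col v)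

  ones-below : ∀ {A : Set} {P : A → Set₁} (f : A → ℕ) → (∀ x → f x ≤ 1) → (∀ x → P x → f x ≡ 0) → ∀ xs →
               sum (map f xs) + length (filter (λ x → em {P = P x}) xs) ≤ length xs
  ones-below f ≤1 0≡ [] = z≤n
  ones-below {P = P} f ≤1 0≡ (x ∷ xs) with em {P = P x}
  ... | yes p rewrite 0≡ x p = ℕ.≤-trans (ℕ.≤-reflexive (ℕ.+-suc (sum (map f xs)) _)) (s≤s (ones-below f ≤1 0≡ xs))
  ... | no _ = ℕ.≤-trans (ℕ.≤-reflexive (ℕ.+-assoc (f x) _ _)) (ℕ.+-mono-≤ (≤1 x) (ones-below f ≤1 0≡ xs))

  size-of-list : ∀ {A : Set} {xs : List A} → Unique xs → (∀ x → x ∈ˡ xs) → ∀ {n} → HasSize A n → n ≡ length xs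
  size-of-list {A} {xs} u all {n} φ = ℕ.≤-antisym
    (subst (_≤ length xs) len (unique-length-≤ (Unique.map⁺ inj (Unique.allFin⁺ n)) (λ {x} _ → all x)))
    (subst (length xs ≤_) len (unique-length-≤ u λ {x} _ → subst (_∈ˡ map from (allFin n)) (strictlyInverseʳ x) (∈-map⁺ from (∈-allFin (to x)))))
    where
    open Inverse φ
    len : length (map from (allFin n)) ≡ n
    len = trans (length-map from (allFin n)) (length-tabulate id)
    inj : ∀ {i j} → from i ≡ from j → i ≡ j
    inj {i} {j} e = trans (sym (strictlyInverseˡ i)) (trans (cong to e) (strictlyInverseˡ j))

  size-of-subset : ∀ {A : Set} {P : A → Set₁} {xs : List A} → (∀ x → x ∈ˡ xs) → ∀ {n} → HasSize [ x ∈ A ∣ P x ] n →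
                   n ≤ length (filter (λ x → em {P = P x}) xs)
  size-of-subset {A} {P} {xs} all {n} φ = subst (_≤ length (filter (λ x → em {P = P x}) xs)) len
    (unique-length-≤ (Unique.map⁺ inj (Unique.allFin⁺ n)) λ m → let i , _ , e = ∈-map⁻ (value ∘ from) m in
      ∈-filter⁺ (λ x → em {P = P x}) (all _) (subst P (sym e) (unsquash (proof (from i)))))
    where
    open Inverse φ
    len : length (map (value ∘ from) (allFin n)) ≡ n
    len = trans (length-map (value ∘ from) (allFin n)) (length-tabulate id)
    inj : ∀ {i j} → value (from i) ≡ value (from j) → i ≡ j
    inj {i} {j} e = trans (sym (strictlyInverseˡ i)) (trans (cong to (value-injective e)) (strictlyInverseˡ j))

-- From the success of the algorithm to failure probabilities

length-cartesian : ∀ {A B C : Set} (f : A → B → C) xs ys → length (cartesianProductWith f xs ys) ≡ length xs * length ys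
length-cartesian f []       ys = refl
length-cartesian f (x ∷ xs) ys = trans (length-++ (map (f x) ys)) (cong₂ _+_ (length-map (f x) ys) (length-cartesian f xs ys))

length-words : ∀ ℓ n → length (words ℓ n) ≡ ℓ ^ n
length-words ℓ zero    = refl
length-words ℓ (suc n) = trans (length-cartesian Vec._∷_ (allFin ℓ) (words ℓ n)) (cong₂ _*_ (length-tabulate {n = ℓ} id) (length-words ℓ n))

complement-bound : ∀ n .{{_ : NonZero n}} k N → 1ℚ ℚ.- (ℤ.+ 1 ℚ./ n) ℚ.≤ ℤ.+ k ℚ./ suc N → n * suc N ≤ n * k + suc N
complement-bound (suc m) k N le = begin
  suc m * suc N              ≡⟨ ℕ.*-comm (suc m) (suc N) ⟩
  suc N * suc m              ≡⟨ ℕ.*-identityˡ _ ⟨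
  1 * (suc N * suc m)        ≤⟨ ℤ.drop‿+≤+ (subst₂ ℤ._≤_ left right (ℚᵘ.drop-*≤* sum≥1)) ⟩
  k * suc m + 1 * suc N      ≡⟨ cong₂ _+_ (ℕ.*-comm k (suc m)) (ℕ.*-identityˡ (suc N)) ⟩
  suc m * k + suc N          ∎
  where
  open ℕ.≤-Reasoning
  a b : ℚᵘ
  a = mkℚᵘ (ℤ.+ k) N
  b = mkℚᵘ (ℤ.+ 1) m
  cancel : (1ℚ ℚ.- ℚ.fromℚᵘ b) ℚ.+ ℚ.fromℚᵘ b ≡ 1ℚ
  cancel = trans (ℚ.+-assoc 1ℚ (ℚ.- ℚ.fromℚᵘ b) (ℚ.fromℚᵘ b)) (trans (cong (1ℚ ℚ.+_) (ℚ.+-inverseˡ (ℚ.fromℚᵘ b))) (ℚ.+-identityʳ 1ℚ))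
  sum≥1 : mkℚᵘ (ℤ.+ 1) 0 ℚᵘ.≤ a ℚᵘ.+ b
  sum≥1 = ℚᵘ.≤-respʳ-≃
    (ℚᵘ.≃-trans (ℚ.toℚᵘ-homo-+ (ℚ.fromℚᵘ a) (ℚ.fromℚᵘ b)) (ℚᵘ.+-cong (ℚ.toℚᵘ-fromℚᵘ a) (ℚ.toℚᵘ-fromℚᵘ b)))
    (ℚ.toℚᵘ-mono-≤ (subst (ℚ._≤ ℚ.fromℚᵘ a ℚ.+ ℚ.fromℚᵘ b) cancel (ℚ.+-monoˡ-≤ (ℚ.fromℚᵘ b) le)))
  left : ℤ.+ 1 ℤ.* ℤ.+ (suc N * suc m) ≡ ℤ.+ (1 * (suc N * suc m))
  left = sym (ℤ.pos-* 1 (suc N * suc m))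
  right : (ℤ.+ k ℤ.* ℤ.+ suc m ℤ.+ ℤ.+ 1 ℤ.* ℤ.+ suc N) ℤ.* ℤ.+ 1 ≡ ℤ.+ (k * suc m + 1 * suc N)
  right = trans (ℤ.*-identityʳ _) (trans (cong₂ ℤ._+_ (sym (ℤ.pos-* k (suc m))) (sym (ℤ.pos-* 1 (suc N)))) (sym (ℤ.pos-+ (k * suc m) (1 * suc N))))

module Simulation (em : Classical) (Π : LCL) (𝒜 : LocalAlgorithm) (T ℓ : ℕ) where
  open Logic em
  open FiniteLists em
  open Neighbourhoods em
  open Listings em
  open Locality Π 𝒜 T

  module _ {V : Set} {G : Graph V} {Δ : ℕ} (bd : BoundedDegree G Δ) where
    open Assignments em {V} ℓ

    -- The algorithm run on G[xs], for xs ⊇ the ball of radius R + T around v,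
    -- is correct at v exactly when the algorithm run on G is.
    failure-probability : ∀ {xs : List V} (uxs : Unique xs) .{{_ : NonZero (length xs)}} {q v} →
      (∀ {z} → Reach G (R + T) v z → z ∈ˡ xs) →
      Uniformℙ (λ (θ : Vec (Fin ℓ) (length xs)) → Succeeds Π 𝒜 T (Listed.H G uxs) (toℕ ∘ Vec.lookup θ)) Is q →
      1ℚ ℚ.- (ℤ.+ 1 ℚ./ length xs) ℚ.≤ q →
      ∀ g → Expects (length xs) 1 xs (λ h → 𝟙 (Fails bd v h)) g
    failure-probability {xs} uxs {v = v} in-xs (N , k , sizeΩ , sizeE , refl) q≥ g =
      -- k counts the successful labellings. It is added on both sides in place of being subtracted
      -- from the number of all labellings.
      ℕ.+-cancelʳ-≤ (n * k) _ _ (begin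
        n * Sum xs F g + n * k                                       ≡⟨ ℕ.*-distribˡ-+ n (Sum xs F g) k ⟨
        n * (Sum xs F g + k)                                         ≤⟨ ℕ.*-monoʳ-≤ n (ℕ.+-monoʳ-≤ (Sum xs F g) (size-of-subset ∈-words sizeE)) ⟩
        n * (Sum xs F g + length succeeding)                         ≡⟨ cong (λ s → n * (s + length succeeding)) (Sum-enumerate xs F g) ⟩
        n * (sum (map Φ (words ℓ n)) + length succeeding)            ≤⟨ ℕ.*-monoʳ-≤ n (ones-below Φ (λ θ → 𝟙-≤ 1 λ _ → ℕ.≤-refl) (λ θ s → ℕ.n≤0⇒n≡0 (𝟙-≤ 0 λ f → ⊥-elim (correct θ s f))) (words ℓ n)) ⟩
        n * length (words ℓ n)                                       ≡⟨ cong (n *_) sucN ⟨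
        n * suc N                                                    ≤⟨ complement-bound n k N q≥ ⟩
        n * k + suc N                                                ≡⟨ ℕ.+-comm (n * k) (suc N) ⟩
        suc N + n * k                                                ≡⟨ cong (_+ n * k) (trans sucN (trans (length-words ℓ n) (sym (ℕ.*-identityˡ _)))) ⟩
        1 * size xs + n * k                                          ∎)
      where
      open ℕ.≤-Reasoning
      open Listed G uxs
      n = length xs
      F : Assignment → ℕ
      F h = 𝟙 (Fails bd v h)
      Φ : Vec (Fin ℓ) n → ℕ
      Φ θ = F (assign g xs θ)
      succeeding = filter (λ (θ : Vec (Fin ℓ) n) → em {P = Succeeds Π 𝒜 T H (toℕ ∘ Vec.lookup θ)}) (words ℓ n)
      sucN : suc N ≡ length (words ℓ n)
      sucN = size-of-list (words-unique ℓ n) ∈-words sizeΩ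
      correct : ∀ θ → Succeeds Π 𝒜 T H (toℕ ∘ Vec.lookup θ) → ¬ Fails bd v (assign g xs θ)
      correct θ s f = f (into (subst (λ w → Accepts bd w (assign g xs θ)) (lookup-position i₀ v∈)
        (accepts-local (finite-bounded H) bd (listed-localIso i in-xs′) (λ {j} _ → assign-lookup g xs uxs θ j)
          (succeeds⇒accepts (finite-bounded H) s i))))
        where
        v∈ = in-xs here
        i₀ = Any.index v∈
        i = position i₀ v
        in-xs′ : ∀ {z} → Reach G (R + T) (lookup xs i) z → z ∈ˡ xs
        in-xs′ = subst (λ w → ∀ {z} → Reach G (R + T) w z → z ∈ˡ xs) (sym (lookup-position i₀ v∈)) in-xs

-- Fixing the random labels one part at a time

module Components (em : Classical) {X : Set} (G : Graph X) (ρ : ℕ) (C : Pred X 0ℓ) where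
  open Logic em
  open FiniteLists em
  open Neighbourhoods em

  -- Unlike edges of the power graph, links may be loops, so that linking two vertices requires no
  -- proof that they differ.
  Link : X → X → Set
  Link x y = C x × C y × Reach G ρ x y

  Connected : X → X → Set
  Connected = Star Link

  module _ (finite : ComponentFinite (induced (power G ρ) C)) where
    private
      lift : ∀ {x y} (c : C x) (c′ : C y) → Connected x y →
             Star (Adj (induced (power G ρ) C)) (x , irr c) (y , irr c′)
      lift c c′ Star.ε = Star.ε
      lift {x} c c′ (_◅_ {j = z} (_ , cz , p) ps) = go em
        where
        go : Dec (x ≡ z) → Star (Adj (induced (power G ρ) C)) (x , irr c) (_ , irr c′)
        go (yes refl) = lift cz c′ ps
        go (no x≢z)   = (x≢z , p) ◅ lift cz c′ ps

      connected-∈ : ∀ {x y} → C x → Connected x y → C y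
      connected-∈ c Star.ε = c
      connected-∈ c ((_ , c′ , _) ◅ ps) = connected-∈ c′ ps

      members : ∀ {x} → C x → List X
      members {x} c = map (value ∘ value ∘ Inverse.from (proj₂ (finite (x , irr c)))) (allFin _)

      ∈-members : ∀ {x y} (c : C x) → Connected x y → y ∈ˡ members c
      ∈-members {x} {y} c p = subst (_∈ˡ members c) (cong (value ∘ value) (strictlyInverseʳ point))
        (∈-map⁺ (value ∘ value ∘ from) (∈-allFin (to point)))
        where
        open Inverse (proj₂ (finite (x , irr c)))
        point = (y , irr (connected-∈ c p)) , irr (lift c (connected-∈ c p) p)

    component : ∀ {x} → C x → Σ[ ys ∈ List X ] (∀ {y} → Connected x y → y ∈ˡ ys) × (∀ {y} → y ∈ˡ ys → Connected x y × C y)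
    component {x} c = filter (λ y → em {P = Connected x y}) (members c) ,
      (λ p → ∈-filter⁺ (λ y → em {P = Connected x y}) (∈-members c p) p) ,
      λ m → let p = proj₂ (∈-filter⁻ (λ y → em {P = Connected x y}) {xs = members c} m) in p , connected-∈ c p

module SumTransport (em : Classical) {V : Set} (ℓ : ℕ) where
  open Assignments em {V} ℓ

  -- `to` is injective on the ball, so relabelling x there corresponds to relabelling `to x` and
  -- nothing else.
  Sum-map : ∀ {G : Graph V} {v v′ r} (L : LocalIso G G v v′ r) {F F′ : Assignment → ℕ} →
    (∀ {g g′} → LocalIso.PreservesLabels L g g′ → F g ≡ F′ g′) →
    ∀ xs {g g′} → (∀ {x} → x ∈ˡ xs → Reach G r v x) → (∀ {x} → Reach G r v x → ¬ x ∈ˡ xs → g′ (LocalIso.to L x) ≡ g x) →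
    Sum xs F g ≡ Sum (map (LocalIso.to L) xs) F′ g′
  Sum-map L eq [] xs⊆ pl = eq (λ p → pl p λ ())
  Sum-map {G} {v} {v′} {r} L eq (x ∷ xs) {g} {g′} xs⊆ pl = sumBelow-cong ℓ λ c →
    Sum-map L eq xs (xs⊆ ∘ there) (λ {z} p n → step-case c z p n em)
    where
    open LocalIso L
    step-case : ∀ c z → Reach G r v z → ¬ z ∈ˡ xs → Dec (z ≡ x) → update g′ (to x) c (to z) ≡ update g x c z
    step-case c z p n (yes refl) = trans (update-same g′ (to x)) (sym (update-same g x))
    step-case c z p n (no z≢x)   = trans
      (update-other g′ λ e → z≢x (trans (sym (from-to p)) (trans (cong from e) (from-to (xs⊆ (here refl))))))
      (trans (pl p λ { (here e) → z≢x e ; (there m) → n m }) (sym (update-other g z≢x)))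

module Stages (em : Classical) (Π : LCL) (𝒜 : LocalAlgorithm) (T ℓ : ℕ) (ℓ>0 : 0 < ℓ)
              {X : Set} (Ξ : Polish X) {G : Graph X} {Δ : ℕ} where
  open Logic em
  open FiniteLists em
  open Neighbourhoods em
  open Listings em
  open Locality Π 𝒜 T
  open Polish Ξ using (OpenSet)
  open Analytic em using (module Separation)
  open Separation Ξ using (Borel)
  open BoundedSections em Ξ using (Borel²)
  open Sigma em {𝓖 = OpenSet}
  open LeastIndex em {𝓖 = OpenSet}
  open Colours em Ξ
  open LocalBorel em Ξ G
  open Assignments em {X} ℓ
  open SumTransport em {X} ℓ

  module _ (bd : BoundedDegree G Δ) (adjBorel : Borel² (uncurry (Adj G))) where
    open Balls bd

    -- Failure at a vertex depends on the labels within ρ, so two failures can share a label only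
    -- within 2 ρ, and `d` bounds the size of a ball of that radius.
    ρ d : ℕ
    ρ = R + T
    d = suc Δ ^ (ρ + ρ)

    d>0 : 0 < d
    d>0 = ℕ.m^n>0 (suc Δ) (ρ + ρ)

    failure : X → Assignment → ℕ
    failure v h = 𝟙 (Fails bd v h)

    fails-depends : ∀ v → DependsOnᵖ (Reach G ρ v) (Fails bd v)
    fails-depends v a = fails-local bd bd localIso-refl (λ {x} p → sym (a x p))

    failure-depends : ∀ v → DependsOn (Reach G ρ v) (failure v)
    failure-depends v = 𝟙-depends (fails-depends v)

    free : Pred X 0ℓ → X → List X
    free D v = filter (λ x → em {P = ¬ D x}) (ball ρ v)

    ∈-free⁺ : ∀ {D v x} → Reach G ρ v x → ¬ D x → x ∈ˡ free D v
    ∈-free⁺ {D} p = ∈-filter⁺ (λ x → em {P = ¬ D x}) (∈-ball⁺ p)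

    ∈-free⁻ : ∀ {D v x} → x ∈ˡ free D v → Reach G ρ v x × ¬ D x
    ∈-free⁻ {D} {v} m = let m′ , n = ∈-filter⁻ (λ x → em {P = ¬ D x}) {xs = ball ρ v} m in ∈-ball⁻ m′ , n

    -- With the values on D fixed to those of θ, each vertex fails with conditional probability at most q / n.
    Safe : ℕ → ℕ → Pred X 0ℓ → Assignment → Pred X 0ℓ
    Safe n q D θ v = Expects n q (free D v) (failure v) θ

    safe-cong : ∀ {n q D v θ θ′} → (∀ {x} → Reach G ρ v x → D x → θ x ≡ θ′ x) → Safe n q D θ v → Safe n q D θ′ v
    safe-cong {n} {q} {D} {v} e = subst (λ s → n * s ≤ q * size (free D v))
      (Sum-depends (free D v) (failure-depends v) λ x (p , nf) → e p (dne λ nd → nf (∈-free⁺ p nd)))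

    -- Safety at v is read off the ball of radius ρ together with `D` and the values of `θ` on `D`.
    -- The labelling `f` encodes both: 0 off `D`, and one more than `θ` on `D`.
    safe-Borel : ∀ n q {D θ} → Borel D → Mbleᶠ θ → Borel (Safe n q D θ)
    safe-Borel n q {D} {θ} mD mθ = locallyInvariant-Borel bd adjBorel {f} {ρ} f-Borel invariant
      where
      mark : ∀ {x} → Dec (D x) → ℕ
      mark {x} (yes _) = suc (θ x)
      mark     (no _)  = 0
      f : X → ℕ
      f x = mark {x} em
      mark-∈ : ∀ {x} (dx : Dec (D x)) → D x → mark dx ≡ suc (θ x)
      mark-∈ (yes _) _ = refl
      mark-∈ (no n)  p = contradiction p n
      mark-∉ : ∀ {x} (dx : Dec (D x)) → ¬ D x → mark dx ≡ 0
      mark-∉ (yes p) n = contradiction p n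
      mark-∉ (no _)  _ = refl
      f-Borel : Mbleᶠ f
      f-Borel i = resp (to , from) (∪-mble (∩-mble mD (value-mble mθ (λ k → suc k ≡ i))) (∩-mble (compl mD) (const-mble (0 ≡ i))))
        where
        to : ∀ {x} → (D x × suc (θ x) ≡ i) ⊎ (¬ D x × 0 ≡ i) → f x ≡ i
        to (inj₁ (p , e)) = trans (mark-∈ em p) e
        to (inj₂ (n , e)) = trans (mark-∉ em n) e
        from : ∀ {x} → f x ≡ i → (D x × suc (θ x) ≡ i) ⊎ (¬ D x × 0 ≡ i)
        from {x} e with em {P = D x}
        ... | yes p = inj₁ (p , e)
        ... | no n  = inj₂ (n , e)
      same-D : ∀ {x y} → f x ≡ f y → D x → D y
      same-D e p = dne λ n → case trans (sym (mark-∈ em p)) (trans e (mark-∉ em n)) of λ ()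
      same-θ : ∀ {x y} → f x ≡ f y → D x → θ x ≡ θ y
      same-θ e p = ℕ.suc-injective (trans (sym (mark-∈ em p)) (trans e (mark-∈ em (same-D e p))))
      invariant : LocallyInvariant bd adjBorel f ρ (Safe n q D θ)
      -- The image of `free D v` and `free D v′` list the same vertices, but possibly in another
      -- order and with other multiplicities.
      invariant {v} {v′} L pl safe = expects-relevant ℓ>0 {n} {q} (map to (free D v)) (free D v′) (failure-depends v′)
        (λ {y} _ m → let x , m′ , e = ∈-map⁻ to m ; p , n = ∈-free⁻ m′ in
          subst (_∈ˡ free D v′) (sym e) (∈-free⁺ (to-ball p) λ dx → n (same-D (pl p) dx)))
        (λ {y} q m → let n = proj₂ (∈-free⁻ m) in
          subst (_∈ˡ map to (free D v)) (to-from q) (∈-map⁺ to (∈-free⁺ (from-ball q)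
            λ dx → n (subst D (to-from q) (same-D (sym (pl (from-ball q))) dx)))))
        (subst₂ (λ s k → n * s ≤ q * ℓ ^ k)
          (Sum-map L {failure v} {failure v′} (λ pl′ → 𝟙-cong (fails-local bd bd L pl′) (fails-local bd bd (localIso-sym L) (labels-sym L pl′)))
            (free D v) (λ m → proj₁ (∈-free⁻ m)) (λ p nf → sym (same-θ (sym (pl p)) (dne λ nd → nf (∈-free⁺ p nd)))))
          (sym (length-map to (free D v))) safe)
        where open LocalIso L

    module Step {n q : ℕ} (q>0 : 0 < q) {D C : Pred X 0ℓ} (mD : Borel D) (mC : Borel C) (disjoint : ∀ {x} → C x → ¬ D x)
                (finite : ComponentFinite (induced (power G (ρ + ρ)) C))
                {θ : Assignment} (mθ : Mbleᶠ θ) (safe : ∀ v → Safe n q D θ v) where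
      open Components em G (ρ + ρ) C

      combine : (X → ℕ) → Assignment
      combine σ x = go em
        where
        go : Dec (C x) → ℕ
        go (yes _) = σ x
        go (no _)  = θ x

      combine-in : ∀ σ {x} → C x → combine σ x ≡ σ x
      combine-in σ {x} c with em {P = C x}
      ... | yes _ = refl
      ... | no n  = contradiction c n

      combine-out : ∀ σ {x} → ¬ C x → combine σ x ≡ θ x
      combine-out σ {x} n with em {P = C x}
      ... | yes c = contradiction c n
      ... | no _  = refl

      combine-Borel : ∀ {σ} → Mbleᶠ σ → Mbleᶠ (combine σ)
      combine-Borel {σ} mσ i = resp (to , from) (∪-mble (∩-mble mC (mσ i)) (∩-mble (compl mC) (mθ i)))
        where
        to : ∀ {x} → (C x × σ x ≡ i) ⊎ (¬ C x × θ x ≡ i) → combine σ x ≡ i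
        to (inj₁ (c , e)) = trans (combine-in σ c) e
        to (inj₂ (n , e)) = trans (combine-out σ n) e
        from : ∀ {x} → combine σ x ≡ i → (C x × σ x ≡ i) ⊎ (¬ C x × θ x ≡ i)
        from {x} e with em {P = C x}
        ... | yes c = inj₁ (c , e)
        ... | no n  = inj₂ (n , e)

      σ : ℕ → X → ℕ
      σ m = colour (proj₁ (unpair m)) (proj₂ (unpair m))

      q′ : ℕ
      q′ = 4 * d * q

      Good : ℕ → Pred X 0ℓ
      Good m = Safe n q′ (D ∪ C) (combine (σ m))

      Good-Borel : ∀ m → Borel (Good m)
      Good-Borel m = safe-Borel n q′ (∪-mble mD mC) (combine-Borel (colour-mble (proj₁ (unpair m)) (proj₂ (unpair m))))

      -- k links inside `C` lead to a vertex within ρ of one that is not good. The recursion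
      -- expresses reachability within a component by neighbourhoods of Borel sets.
      BadWithin : ℕ → ℕ → Pred X 0ℓ
      BadWithin m zero    = C ∩ ◇ ρ (∁ (Good m))
      BadWithin m (suc k) = C ∩ ◇ (ρ + ρ) (BadWithin m k)

      BadWithin-Borel : ∀ m k → Borel (BadWithin m k)
      BadWithin-Borel m zero    = ∩-mble mC (◇-Borel bd adjBorel ρ (compl (Good-Borel m)))
      BadWithin-Borel m (suc k) = ∩-mble mC (◇-Borel bd adjBorel (ρ + ρ) (BadWithin-Borel m k))

      badWithin-∈ : ∀ m k {x} → BadWithin m k x → C x
      badWithin-∈ m zero    = proj₁
      badWithin-∈ m (suc k) = proj₁

      -- Relabelling the component of x by σ m keeps every vertex near it safe.
      -- Each solution on a finite component is the restriction of some σ m, so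
      -- the least such m is a Borel choice that is constant on components.
      Solves : ℕ → Pred X 0ℓ
      Solves m = C ∩ ∁ (⋃ ℕ (BadWithin m))

      Solves-Borel : ∀ m → Borel (Solves m)
      Solves-Borel m = ∩-mble mC (compl (union (BadWithin-Borel m)))

      solves-link : ∀ {m x y} → C y → Reach G (ρ + ρ) x y → Solves m x → Solves m y
      solves-link cy p (cx , nb) = cy , λ (k , b) → nb (suc k , cx , _ , p , b)

      module _ {x : X} (xs : List X) (xs⁺ : ∀ {y} → Connected x y → y ∈ˡ xs) (xs⁻ : ∀ {y} → y ∈ˡ xs → Connected x y × C y) where
        private
          -- The vertices whose failure can depend on a label in the component of x.
          es : List X
          es = dedup (concatMap (ball ρ) xs)

          es⁺ : ∀ {y v} → Connected x y → Reach G ρ y v → v ∈ˡ es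
          es⁺ c p = ∈-deduplicate⁺ _≟_ (∈-concatMap⁺ (ball ρ) (Any.map (λ { refl → ∈-ball⁺ p }) (xs⁺ c)))

          es⁻ : ∀ {v} → v ∈ˡ es → ∃ λ y → Connected x y × C y × Reach G ρ y v
          es⁻ {v} m = find xs id (∈-concatMap⁻ (ball ρ) (∈-deduplicate⁻ _≟_ (concatMap (ball ρ) xs) m))
            where
            find : ∀ ys → (∀ {y} → y ∈ˡ ys → y ∈ˡ xs) → Any (λ y → v ∈ˡ ball ρ y) ys → ∃ λ y → Connected x y × C y × Reach G ρ y v
            find (y ∷ ys) ys⊆ (here p)  = let c , cy = xs⁻ (ys⊆ (here refl)) in y , c , cy , ∈-ball⁻ p
            find (y ∷ ys) ys⊆ (there a) = find ys (ys⊆ ∘ there) a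

          few : ∀ {v S} → v ∈ˡ es → Unique S → (∀ {u} → u ∈ˡ S → ∃ λ y → Reach G ρ v y × Reach G ρ u y) → length S ≤ d
          few {v} _ uS near = ℕ.≤-trans
            (unique-length-≤ uS λ m → let y , p , p′ = near m in ∈-ball⁺ (reach-trans p (reach-sym p′)))
            (length-ball (ρ + ρ) v)

          -- v is within ρ of the component, so a vertex of `C` within ρ of v is within 2 ρ of the
          -- component and belongs to it. Fixing `xs` therefore fixes all of `C` that failure at v
          -- sees.
          before⊆ : ∀ {v y} → v ∈ˡ es → Reach G ρ v y → y ∈ˡ free D v → y ∈ˡ xs ⊎ y ∈ˡ free (D ∪ C) v
          before⊆ {v} {y} v∈ p m = split em
            where
            split : Dec (C y) → y ∈ˡ xs ⊎ y ∈ˡ free (D ∪ C) v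
            split (yes cy) = let z , c , cz , p′ = es⁻ v∈ in inj₁ (xs⁺ (c ◅◅ (cz , cy , reach-trans p′ p) ◅ Star.ε))
            split (no nc)  = inj₂ (∈-free⁺ p [ proj₂ (∈-free⁻ m) , nc ]′)

          ⊆before : ∀ {v y} → v ∈ˡ es → Reach G ρ v y → y ∈ˡ xs ⊎ y ∈ˡ free (D ∪ C) v → y ∈ˡ free D v
          ⊆before _ p (inj₁ m) = ∈-free⁺ p (disjoint (proj₂ (xs⁻ m)))
          ⊆before _ p (inj₂ m) = ∈-free⁺ p (proj₂ (∈-free⁻ m) ∘ inj₁)

          Solution : Assignment → Set
          Solution h = (∀ {y} → ¬ y ∈ˡ xs → h y ≡ θ y) ×
                       (∀ {v} → v ∈ˡ es → Expects n q′ (free (D ∪ C) v) (failure v) h)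

          solution : ∃ Solution
          solution = fix-variables ℓ>0 {n} {q} {d} q>0 d>0 (Fails bd) (Reach G ρ) fails-depends xs es
            (DecUnique.deduplicate-! _≟_ _) few (free D) (free (D ∪ C)) before⊆ ⊆before θ (λ {v} _ → safe v)

          module _ {h : Assignment} (off : ∀ {y} → ¬ y ∈ˡ xs → h y ≡ θ y)
                   (expects : ∀ {v} → v ∈ˡ es → Expects n q′ (free (D ∪ C) v) (failure v) h)
                   {m : ℕ} (σ-h : ∀ {y} → y ∈ˡ xs → σ m y ≡ h y) where

            good : ∀ {y v} → Connected x y → C y → Reach G ρ y v → Good m v
            good {y} {v} c cy p = safe-cong {n} {q′} {D ∪ C} (λ p′ _ → agree p′ em) (expects (es⁺ c p))
              where
              agree : ∀ {z} → Reach G ρ v z → Dec (C z) → h z ≡ combine (σ m) z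
              agree p′ (yes cz) = trans (sym (σ-h (xs⁺ (c ◅◅ (cy , cz , reach-trans p p′) ◅ Star.ε)))) (sym (combine-in (σ m) cz))
              agree p′ (no nc)  = trans (off (λ z∈ → nc (proj₂ (xs⁻ z∈)))) (sym (combine-out (σ m) nc))

            never : ∀ k {y} → Connected x y → ¬ BadWithin m k y
            never zero    c (cy , v , p , bad) = bad (good c cy p)
            never (suc k) c (cy , z , p , b)   = never k (c ◅◅ (cy , badWithin-∈ m k b , p) ◅ Star.ε) b

          prescribed : ∀ {h} → Solution h → Σ[ j ∈ ℕ ] Σ[ e ∈ ℕ ] (∀ {y} → y ∈ˡ xs → colour j e y ≡ h y) →
                       C x → Σ[ m ∈ ℕ ] Solves m x
          prescribed (off , expects) (j , e , eq) cx = pair j e , cx , λ (k , b) → never off expects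
            (λ {y} y∈ → trans (cong (λ (j , e) → colour j e y) (unpair-pair j e)) (eq y∈)) k Star.ε b

        solvable-component : C x → Σ[ m ∈ ℕ ] Solves m x
        solvable-component = prescribed (proj₂ solution) (colour-prescribed (proj₁ solution) xs)

      solvable : ∀ {x} → C x → Σ[ m ∈ ℕ ] Solves m x
      solvable cx = let xs , xs⁺ , xs⁻ = component finite cx in solvable-component xs xs⁺ xs⁻ cx

      choice : X → ℕ
      choice = leastIndex Solves

      choice-link : ∀ {x y} → C x → C y → Reach G (ρ + ρ) x y → choice x ≡ choice y
      choice-link {x} {y} cx cy p = least-unique {P = λ m → Solves m x} (leastIndex-least Solves (solvable cx))
        (let s , l = leastIndex-least Solves (solvable cy) in
         solves-link cx (reach-sym p) s , λ m m< sx → l m m< (solves-link cy p sx))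

      chosen : X → ℕ
      chosen x = σ (choice x) x

      chosen-Borel : Mbleᶠ chosen
      chosen-Borel i = resp ((λ { (m , refl , e) → e }) , λ e → _ , refl , e)
        (union λ m → ∩-mble (leastIndex-mble Solves Solves-Borel m) (colour-mble (proj₁ (unpair m)) (proj₂ (unpair m)) i))

      θ′ : Assignment
      θ′ = combine chosen

      θ′-Borel : Mbleᶠ θ′
      θ′-Borel = combine-Borel chosen-Borel

      -- Any two vertices of `C` within ρ of v are linked, so they share one choice, and this choice
      -- makes v good. If there are none, nothing that v sees has changed, and q ≤ 4 d q.
      θ′-safe : ∀ v → Safe n q′ (D ∪ C) θ′ v
      θ′-safe v with em {P = ∃ λ x → Reach G ρ v x × C x}
      ... | yes (x , p , cx) = safe-cong {n} {q′} {D ∪ C} agree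
            (dne λ bad → proj₂ (leastIndex-∈ Solves (solvable cx)) (0 , cx , v , reach-sym p , bad))
        where
        agree : ∀ {z} → Reach G ρ v z → D z ⊎ C z → combine (σ (choice x)) z ≡ θ′ z
        agree {z} p′ _ = case em {P = C z} of λ
          { (yes cz) → trans (combine-in (σ (choice x)) cz)
              (trans (cong (λ m → σ m z) (choice-link cx cz (reach-trans (reach-sym p) p′))) (sym (combine-in chosen cz)))
          ; (no nc) → trans (combine-out (σ (choice x)) nc) (sym (combine-out chosen nc)) }
      ... | no none = safe-cong {n} {q′} {D ∪ C} (λ p _ → sym (combine-out chosen λ c → none (_ , p , c)))
            (expects-relevant ℓ>0 {n} {q′} (free D v) (free (D ∪ C) v) (failure-depends v)
              (λ p m → ∈-free⁺ p [ proj₂ (∈-free⁻ m) , (λ c → none (_ , p , c)) ]′)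
              (λ p m → ∈-free⁺ p (proj₂ (∈-free⁻ m) ∘ inj₁))
              (ℕ.≤-trans (safe v) (ℕ.*-monoˡ-≤ (size (free D v)) (ℕ.m≤n*m q (4 * d) {{ℕ.m*n≢0 4 d {{_}} {{>-nonZero d>0}}}}))))

-- Choice of n, and the conclusion

σ-mono : ∀ {X : Set} {ℓ ℓ′} {𝓖 : Pred (Pred X 0ℓ) ℓ} {𝓗 : Pred (Pred X 0ℓ) ℓ′} → 𝓖 ⊆ 𝓗 → σ⟨ 𝓖 ⟩ ⊆ σ⟨ 𝓗 ⟩
σ-mono g (basic a)  = basic (g a)
σ-mono g empty      = empty
σ-mono g (compl m)  = compl (σ-mono g m)
σ-mono g (union m)  = union (λ n → σ-mono g (m n))
σ-mono g (resp e m) = resp e (σ-mono g m)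

suc≤2^ : ∀ n → suc n ≤ 2 ^ n
suc≤2^ zero    = ℕ.≤-refl
suc≤2^ (suc n) = ℕ.≤-trans (ℕ.≤-reflexive (ℕ.+-comm 1 (suc n)))
  (ℕ.+-mono-≤ (suc≤2^ n) (ℕ.≤-trans (ℕ.m^n>0 2 n) (ℕ.m≤m+n (2 ^ n) 0)))

<log₂⇒2^< : ∀ {e n} → e < ⌊log₂ n ⌋ → 2 ^ e < n
<log₂⇒2^< {e} {n} lt = ℕ.≰⇒> λ n≤ → ℕ.<-irrefl refl
  (ℕ.<-≤-trans lt (ℕ.≤-trans (⌊log₂⌋-mono-≤ n≤) (ℕ.≤-reflexive (⌊log₂[2^n]⌋≡n e))))

module Growth (Δ R s : ℕ) where

  -- From 4 = 2² and Δ + 1 ≤ 2^(Δ + 1) one gets (4 d)^(s + 1) ≤ 2^(offset + slope T), with an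
  -- exponent that is affine in T.
  slope offset : ℕ
  slope  = 2 * (suc Δ * suc s)
  offset = (2 + suc Δ * (R + R)) * suc s

  -- One half of log₂ n pays for slope T, the other for offset + 1; the extra 1 makes the inequality
  -- strict.
  degree-bound : ∀ {n T} → 2 * slope * T ≤ ⌊log₂ n ⌋ → 2 ^ (2 * suc offset) ≤ n →
                 (4 * suc Δ ^ ((R + T) + (R + T))) ^ suc s < n
  degree-bound {n} {T} le n≥ = ℕ.≤-<-trans (begin
    (4 * suc Δ ^ ((R + T) + (R + T))) ^ suc s              ≤⟨ ℕ.^-monoˡ-≤ (suc s) (ℕ.*-monoʳ-≤ 4 (ℕ.^-monoˡ-≤ ((R + T) + (R + T)) (ℕ.≤-trans (ℕ.n≤1+n (suc Δ)) (suc≤2^ (suc Δ))))) ⟩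
    (2 ^ 2 * (2 ^ suc Δ) ^ ((R + T) + (R + T))) ^ suc s    ≡⟨ cong (λ x → (2 ^ 2 * x) ^ suc s) (ℕ.^-*-assoc 2 (suc Δ) ((R + T) + (R + T))) ⟩
    (2 ^ 2 * 2 ^ (suc Δ * ((R + T) + (R + T)))) ^ suc s    ≡⟨ cong (_^ suc s) (ℕ.^-distribˡ-+-* 2 2 (suc Δ * ((R + T) + (R + T)))) ⟨
    (2 ^ (2 + suc Δ * ((R + T) + (R + T)))) ^ suc s        ≡⟨ ℕ.^-*-assoc 2 (2 + suc Δ * ((R + T) + (R + T))) (suc s) ⟩
    2 ^ ((2 + suc Δ * ((R + T) + (R + T))) * suc s)        ≡⟨ cong (2 ^_) (expand (suc Δ) R T (suc s)) ⟩
    2 ^ (offset + slope * T)                               ∎) (<log₂⇒2^< exponent)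
    where
    open ℕ.≤-Reasoning
    expand : ∀ D R T s → (2 + D * ((R + T) + (R + T))) * s ≡ (2 + D * (R + R)) * s + 2 * (D * s) * T
    expand = solve-∀
    exponent : suc (offset + slope * T) ≤ ⌊log₂ n ⌋
    exponent = ℕ.*-cancelˡ-≤ 2 (begin
      2 * suc (offset + slope * T)                ≡⟨ ℕ.*-distribˡ-+ 2 (suc offset) (slope * T) ⟩
      2 * suc offset + 2 * (slope * T)            ≡⟨ cong (2 * suc offset +_) (ℕ.*-assoc 2 slope T) ⟨
      2 * suc offset + 2 * slope * T              ≤⟨ ℕ.+-mono-≤ (ℕ.≤-trans (ℕ.≤-reflexive (sym (⌊log₂[2^n]⌋≡n (2 * suc offset)))) (⌊log₂⌋-mono-≤ n≥)) le ⟩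
      ⌊log₂ n ⌋ + ⌊log₂ n ⌋                       ≡⟨ cong (⌊log₂ n ⌋ +_) (ℕ.+-identityʳ ⌊log₂ n ⌋) ⟨
      2 * ⌊log₂ n ⌋                               ∎)

module BorelColoring (em : Classical) (Π : LCL) {X : Set} (Ξ : Polish X) {G : Graph X} {Δ : ℕ} where
  open Logic em
  open FiniteLists em
  open Neighbourhoods em
  open Listings em
  open Polish Ξ using (OpenSet)
  open Analytic em using (module Separation)
  open Separation Ξ using (Borel)
  open BoundedSections em Ξ using (Borel²)
  open Sigma em {𝓖 = OpenSet}
  open Colours em Ξ
  open LocalBorel em Ξ G

  module _ (bd : BoundedDegree G Δ) (adjBorel : Borel² (uncurry (Adj G))) where
    open Balls bd

    BorelColorable : Set₁
    BorelColorable = Σ[ f ∈ (X → ℕ) ] Mbleᶠ f × IsColoring Π G f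

    finite-Borel : ∀ {xs : List X} → (∀ x → x ∈ˡ xs) → ∀ P → Borel P
    finite-Borel {xs} all P = resp {A = U ∩ P} (proj₂ , λ p → _ , p)
      (determined-mble (λ i x → cell j x ≡ i) (cell-mble j) (upTo m) (const-mble _) P
        λ {x} {y} _ _ eq p → subst P (sep (all x) (all y) (sym (proj₁ (eq (∈-upTo⁺ (small (all x)))) refl))) p)
      where
      j = proj₁ (cell-separates xs)
      sep = proj₂ (cell-separates xs)
      m = proj₁ (bound (cell j) xs)
      small = proj₂ (bound (cell j) xs)

    finite-colorable : ∀ {xs : List X} (uxs : Unique xs) → (∀ x → x ∈ˡ xs) → X → Colorable Π (Listed.H G uxs) → BorelColorable
    finite-colorable {xs} uxs all x₀ (f , col) = f ∘ position i₀ , (λ i → finite-Borel all _) , λ v →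
      at-≅ʳ (accept Π) (⟦ H , f , position i₀ v ⟧ (radius Π)) (⟦ G , f ∘ position i₀ , v ⟧ (radius Π))
        (localIso⇒≅ʳ (L v) {f} {f ∘ position i₀} (λ {j} _ → labels v j)) (col (position i₀ v))
      where
      open Listed G uxs
      i₀ = Any.index (all x₀)
      L : ∀ v → LocalIso H G (position i₀ v) v (radius Π)
      L v = subst (λ w → LocalIso H G (position i₀ v) w (radius Π)) (lookup-position i₀ (all v))
        (listed-localIso (position i₀ v) (λ {z} _ → all z))
      labels : ∀ v j → f (position i₀ (LocalIso.to (L v) j)) ≡ f j
      labels v j = cong f (transported (lookup-position i₀ (all v)))
        where
        transported : ∀ {w} (e : lookup xs (position i₀ v) ≡ w) →
          position i₀ (LocalIso.to (subst (λ w → LocalIso H G (position i₀ v) w (radius Π)) e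
            (listed-localIso (position i₀ v) (λ {z} _ → all z))) j) ≡ j
        transported refl = position-lookup i₀ j

    extend-list : (∀ ys → Σ[ x ∈ X ] ¬ x ∈ˡ ys) → ∀ k {xs} → Unique xs →
                  Σ[ ys ∈ List X ] Unique ys × length ys ≡ k + length xs × (∀ {x} → x ∈ˡ xs → x ∈ˡ ys)
    extend-list new zero    {xs} u = xs , u , refl , id
    extend-list new (suc k) {xs} u =
      let ys , uys , len , sub = extend-list new k u ; x , x∉ = new ys in
      x ∷ ys , All.tabulate (λ { m refl → x∉ m }) ∷ uys , cong suc len , there ∘ sub

    module Run (𝒜 : LocalAlgorithm) (T ℓ : ℕ) (ℓ>0 : 0 < ℓ) where
      open Locality Π 𝒜 T
      open Assignments em {X} ℓ
      open Simulation em Π 𝒜 T ℓ using (failure-probability)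
      module Stage = Stages em Π 𝒜 T ℓ ℓ>0 Ξ {G} {Δ}

      ρ d : ℕ
      ρ = R + T
      d = Stage.d bd adjBorel

      output-Borel : ∀ {θ} → Mbleᶠ θ → Mbleᶠ (output bd θ)
      output-Borel {θ} mθ i = locallyInvariant-Borel bd adjBorel mθ λ L pl e → trans (output-local bd bd L pl) e

      module _ (n : ℕ) .{{_ : NonZero n}}
               (solved : ∀ {xs} (uxs : Unique xs) (eq : length xs ≡ n) →
                 Σ[ q ∈ ℚ ] (Uniformℙ (λ (θ : Vec (Fin ℓ) (length xs)) → Succeeds Π 𝒜 T (Listed.H G uxs) (toℕ ∘ Vec.lookup θ)) Is q)
                          × 1ℚ ℚ.- (ℤ.+ 1 ℚ./ n) ℚ.≤ q)
               (new : ∀ ys → Σ[ x ∈ X ] ¬ x ∈ˡ ys) (d≤n : d ≤ n) where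

        -- The ball has at most d ≤ n vertices and is padded to exactly n, the size for which the
        -- algorithm comes with a guarantee.
        ball-list : ∀ v → Σ[ ys ∈ List X ] Unique ys × length ys ≡ n × (∀ {x} → Reach G ρ v x → x ∈ˡ ys)
        ball-list v = let ys , u , len , sub = extend-list new (n ℕ.∸ length xs) (DecUnique.deduplicate-! _≟_ (ball ρ v)) in
          ys , u , trans len (ℕ.m∸n+n≡m small) , λ p → sub (∈-deduplicate⁺ _≟_ (∈-ball⁺ p))
          where
          xs = dedup (ball ρ v)
          small : length xs ≤ n
          small = ℕ.≤-trans (length-deduplicate _≟_ (ball ρ v)) (ℕ.≤-trans (length-ball ρ v)
            (ℕ.≤-trans (ℕ.^-monoʳ-≤ (suc Δ) (ℕ.m≤m+n ρ ρ)) d≤n))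

        initially-safe : ∀ g v → Stage.Safe bd adjBorel n 1 ∅ g v
        initially-safe g v = let ys , u , len , sub = ball-list v ; q , unif , q≥ = solved u len in
          expects-relevant ℓ>0 {n} {1} ys (Stage.free bd adjBorel ∅ v) (Stage.failure-depends bd adjBorel v)
            (λ p _ → Stage.∈-free⁺ bd adjBorel p id) (λ p _ → sub p)
            (transport len u sub unif q≥)
          where
          transport : ∀ {m ys q} .{{_ : NonZero m}} (len : length ys ≡ m) (u : Unique ys) → (∀ {x} → Reach G ρ v x → x ∈ˡ ys) →
            (Uniformℙ (λ (θ : Vec (Fin ℓ) (length ys)) → Succeeds Π 𝒜 T (Listed.H G u) (toℕ ∘ Vec.lookup θ)) Is q) →
            1ℚ ℚ.- (ℤ.+ 1 ℚ./ m) ℚ.≤ q → Expects m 1 ys (Stage.failure bd adjBorel v) g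
          transport refl u sub unif q≥ = failure-probability bd u sub unif q≥ g

        module _ {s : ℕ} (P : Fin (suc s) → Pred X 0ℓ) (partition : ∀ v → ∃! _≡_ (λ i → P i v)) (mP : ∀ i → Borel (P i))
                 (finite : ∀ i → ComponentFinite (induced (power G (ρ + ρ)) (P i))) where

          Covered : List (Fin (suc s)) → Pred X 0ℓ
          Covered []       = ∅
          Covered (i ∷ is) = Covered is ∪ P i

          covered-∈ : ∀ is {x} → Covered is x → ∃ λ i → i ∈ˡ is × P i x
          covered-∈ (i ∷ is) (inj₁ c) = let j , j∈ , p = covered-∈ is c in j , there j∈ , p
          covered-∈ (i ∷ is) (inj₂ p) = i , here refl , p

          ∈-covered : ∀ {is i x} → i ∈ˡ is → P i x → Covered is x
          ∈-covered (here refl) p = inj₂ p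
          ∈-covered (there m)   p = inj₁ (∈-covered m p)

          unique-part : ∀ {x i j} → P i x → P j x → i ≡ j
          unique-part {x} p q = let _ , _ , u = partition x in trans (sym (u p)) (u q)

          fresh-part : ∀ {i is} → All (λ j → ¬ i ≡ j) is → ∀ {x} → P i x → ¬ Covered is x
          fresh-part {is = is} i∉ p c = let j , j∈ , p′ = covered-∈ is c in All.lookup i∉ j∈ (unique-part p p′)

          covered-Borel : ∀ is → Borel (Covered is)
          covered-Borel []       = empty
          covered-Borel (i ∷ is) = ∪-mble (covered-Borel is) (mP i)

          SafeLabelling : List (Fin (suc s)) → Set₁
          SafeLabelling is = Σ[ θ ∈ (X → ℕ) ] Mbleᶠ θ × (∀ v → Stage.Safe bd adjBorel n ((4 * d) ^ length is) (Covered is) θ v)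

          stages : ∀ is → Unique is → SafeLabelling is
          stages [] _ = (λ _ → 0) , (λ i → const-mble (0 ≡ i)) , initially-safe (λ _ → 0)
          stages (i ∷ is) (i∉ ∷ u) = advance (stages is u)
            where
            advance : SafeLabelling is → SafeLabelling (i ∷ is)
            advance (θ , mθ , safe) = θ′ , θ′-Borel , θ′-safe
              where
              open Stage.Step bd adjBorel {n} {(4 * d) ^ length is}
                (ℕ.m^n>0 (4 * d) {{ℕ.m*n≢0 4 d {{_}} {{>-nonZero (Stage.d>0 bd adjBorel)}}}} (length is))
                (covered-Borel is) (mP i)
                (fresh-part i∉)
                (finite i) mθ safe

          colorable : (4 * d) ^ suc s < n → BorelColorable
          colorable small = conclude (stages (allFin (suc s)) (Unique.allFin⁺ (suc s)))
            where
            conclude : SafeLabelling (allFin (suc s)) → BorelColorable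
            conclude (θ , mθ , safe) = output bd θ , output-Borel mθ , λ v → out (dne (never-fails v))
              where
              all-fixed : ∀ v → Stage.free bd adjBorel (Covered (allFin (suc s))) v ≡ []
              all-fixed v = filter-none (λ x → em {P = ¬ Covered (allFin (suc s)) x}) {xs = ball ρ v}
                (All.tabulate λ {x} _ n → n (∈-covered (∈-allFin (proj₁ (partition x))) (proj₁ (proj₂ (partition x)))))
              -- No label is left free, so the conditional expectation is the indicator of failure
              -- itself, and 1 would exceed the bound.
              never-fails : ∀ v → ¬ Fails bd v θ
              never-fails v f = ℕ.<-irrefl refl (begin-strict
                n                                ≡⟨ ℕ.*-identityʳ n ⟨
                n * 1                            ≡⟨ cong (n *_) (𝟙-yes f) ⟨
                n * 𝟙 (Fails bd v θ)             ≤⟨ subst (λ xs → Expects n ((4 * d) ^ length (allFin (suc s))) xs (Stage.failure bd adjBorel v) θ) (all-fixed v) (safe v) ⟩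
                (4 * d) ^ length (allFin (suc s)) * 1 ≡⟨ ℕ.*-identityʳ _ ⟩
                (4 * d) ^ length (allFin (suc s))     ≡⟨ cong ((4 * d) ^_) (length-tabulate {n = suc s} id) ⟩
                (4 * d) ^ suc s                  <⟨ small ⟩
                n                                ∎)
                where open ℕ.≤-Reasoning

module Main (em : Classical) (Π : LCL) (𝔾 : GraphClass)
            (colorable : ∀ {n} (H : Graph (Fin n)) → Member 𝔾 H → Colorable Π H)
            {ρ : ℕ → ℕ ⁺} (rand : RandIs Π 𝔾 ρ) (sublog : IsLittleOLog ρ) where
  open Logic em
  open FiniteLists em
  open Neighbourhoods em
  open Listings em

  randSolvable : ∀ n .{{_ : NonZero n}} {T} → ρ n ≡ fin T → RandSolvable Π 𝔾 n T
  randSolvable n eq = proj₁ (subst (Smallest (RandSolvable Π 𝔾 n) Is_) eq (rand n))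

  separates-bounded : ∀ {S : StandardBorelSpace} {G : Graph (Carrier S)} {e s} → SiIs S G e → e ≤⁺ fin s →
                      Σ[ s′ ∈ ℕ ] s′ ≤ s × Separates S G s′
  separates-bounded (sep , _) [ le ] = _ , le , sep

  module _ (S : StandardBorelSpace) (G : Graph (Carrier S)) where
    private
      X = Carrier S
      μ = proj₁ (StandardBorelSpace.isPolish S)
      complete = proj₁ (proj₂ (StandardBorelSpace.isPolish S))
      separable = proj₁ (proj₂ (proj₂ (StandardBorelSpace.isPolish S)))
      isBorel = proj₂ (proj₂ (proj₂ (StandardBorelSpace.isPolish S)))

    module _ (x₀ : X) (adjBorel : uncurry (Adj G) ∈ σ⟨ Rectangle (IsBorel S) (IsBorel S) ⟩)
             {Δ} (bd : BoundedDegree G Δ) (members : FiniteInducedSubgraphsIn 𝔾 G) (asi : AsiFinite S G) where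
      private
        Ξ : Polish X
        Ξ = polish μ complete separable x₀

      open Polish Ξ using (OpenSet)
      open Analytic em using (module Separation)
      open Separation Ξ using (Borel)
      open BoundedSections em Ξ using (Borel²)
      open BorelColoring em Π Ξ {G} {Δ}

      toBorel : ∀ {A} → IsBorel S A → Borel A
      toBorel b = σ-mono (Open⇒OpenSet μ complete separable x₀) (Equivalence.to (isBorel _) b)

      fromBorel : ∀ {A} → Borel A → IsBorel S A
      fromBorel b = Equivalence.from (isBorel _) (σ-mono (OpenSet⇒Open μ complete separable x₀) b)

      adjBorel′ : Borel² (uncurry (Adj G))
      adjBorel′ = σ-mono (λ { (A , B , mA , mB , e) → A , B , toBorel mA , toBorel mB , e }) adjBorel

      -- The whole graph is one of its own finite induced subgraphs, hence in the class and
      -- colourable, and every subset of a finite space is Borel.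
      finite-case : ∀ {xs} → (∀ x → x ∈ˡ xs) → BorelColorable bd adjBorel′
      finite-case {xs} all = finite-colorable bd adjBorel′ uxs (λ x → ∈-deduplicate⁺ _≟_ (all x)) x₀
        (colorable (Listed.H G uxs) (members (_∈ˡ dedup xs) (Listed.H G uxs) (Listed.H≅induced G uxs)))
        where
        uxs : Unique (dedup xs)
        uxs = DecUnique.deduplicate-! _≟_ xs

      module _ (new : ∀ ys → Σ[ x ∈ X ] ¬ x ∈ˡ ys) where
        s : ℕ
        s = proj₁ asi

        open Growth Δ (radius Π) s

        threshold n : ℕ
        threshold = proj₁ (sublog (2 * slope))
        -- Both `slope` and `offset` involve s but not T, so n can be chosen before the algorithm
        -- and its running time are known.
        n = threshold ⊔ 2 ^ (2 * suc offset)

        solve : ∀ n .{{_ : NonZero n}} T → (4 * suc Δ ^ ((radius Π + T) + (radius Π + T))) ^ suc s < n →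
                RandSolvable Π 𝔾 n T → BorelColorable bd adjBorel′
        solve n T small (ℓ , ℓ≢0 , 𝒜 , prob) =
          Run.colorable bd adjBorel′ 𝒜 T ℓ (ℕ.>-nonZero⁻¹ ℓ {{ℓ≢0}}) n
            (λ { uxs refl → prob (Listed.H G uxs) (members _ (Listed.H G uxs) (Listed.H≅induced G uxs)) })
            new (ℕ.<⇒≤ (ℕ.≤-<-trans d≤ small))
            (proj₁ parts) (proj₁ (proj₂ parts)) (λ i → toBorel (proj₁ (proj₂ (proj₂ parts)) i)) (proj₂ (proj₂ (proj₂ parts)))
            (ℕ.≤-<-trans (ℕ.^-monoʳ-≤ (4 * D) {{ℕ.m*n≢0 4 D {{_}} {{D≢0}}}} (s≤s s′≤s)) small)
          where
          D = suc Δ ^ ((radius Π + T) + (radius Π + T))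
          D≢0 : NonZero D
          D≢0 = ℕ.m^n≢0 (suc Δ) ((radius Π + T) + (radius Π + T))
          d≤ : D ≤ (4 * D) ^ suc s
          d≤ = ℕ.≤-trans (ℕ.m≤n*m D 4) (ℕ.m≤m*n (4 * D) ((4 * D) ^ s) {{ℕ.m^n≢0 (4 * D) s {{ℕ.m*n≢0 4 D {{_}} {{D≢0}}}}}})
          separated = separates-bounded {S} {power G ((radius Π + T) + (radius Π + T))} (proj₁ (proj₂ (proj₂ asi)) ((radius Π + T) + (radius Π + T)))
                        (proj₁ (proj₂ (proj₂ (proj₂ asi))) ((radius Π + T) + (radius Π + T)))
          s′≤s = proj₁ (proj₂ separated)
          parts = proj₂ (proj₂ separated)

        infinite-case : BorelColorable bd adjBorel′
        infinite-case = let T , eq , le = proj₂ (sublog (2 * slope)) n (ℕ.m≤m⊔n threshold _) in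
          solve n {{n≢0}} T (degree-bound le (ℕ.m≤n⊔m threshold _)) (randSolvable n {{n≢0}} eq)
          where
          n≢0 : NonZero n
          n≢0 = >-nonZero (ℕ.<-≤-trans (ℕ.m^n>0 2 (2 * suc offset)) (ℕ.m≤n⊔m threshold _))

      nonempty-case : Dec (Σ[ xs ∈ List X ] ∀ x → x ∈ˡ xs) → Σ[ f ∈ (X → ℕ) ] BorelFunction S f × IsColoring Π G f
      nonempty-case (yes (xs , all)) = let f , mf , col = finite-case all in f , (λ i → fromBorel (mf i)) , col
      nonempty-case (no infinite) =
        let f , mf , col = infinite-case (λ ys → ¬∀ λ all → infinite (ys , all)) in f , (λ i → fromBorel (mf i)) , col

theorem1p42 : Classical →
    (Π : LCL) (𝔾 : GraphClass) →
    (∀ {n : ℕ} (H : Graph (Fin n)) → Member 𝔾 H → Colorable Π H) →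
    RandIsLittleOLog Π 𝔾 →
    (𝓖 : BorelGraph) →
    let V = BorelGraph.space 𝓖
        G = BorelGraph.graph 𝓖 in
    FiniteMaxDegree G →
    FiniteInducedSubgraphsIn 𝔾 G →
    AsiFinite V G →
    Σ[ f ∈ (Carrier V → ℕ) ] BorelFunction V f × IsColoring Π G f
theorem1p42 em Π 𝔾 colorable (ρ , rand , sublog) 𝓖 degree members asi = cases em
  where
  open BorelGraph 𝓖 renaming (graph to G)
  isBorel = proj₂ (proj₂ (proj₂ (StandardBorelSpace.isPolish space)))
  bounded = Neighbourhoods.finiteMaxDegree⇒bounded em degree
  cases : Dec (Carrier space) → Σ[ f ∈ (Carrier space → ℕ) ] BorelFunction space f × IsColoring Π G f
  cases (yes x₀) = Main.nonempty-case em Π 𝔾 colorable rand sublog space G x₀ adjBorel (proj₂ bounded) members asi em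
  cases (no none) = (λ _ → 0) , (λ i → Equivalence.from (isBorel (λ _ → 0 ≡ i)) (resp ((λ ()) , λ {x} _ → contradiction x none) empty)) ,
    λ v → contradiction v none
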